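{- There exists a prosolvable extension $K/\mathbb{Q}$ such that $K$ has a field extension of degree $2$, but the non-degenerate quadratic form $\langle 1,1\rangle$ over $K$ is not isomorphic (over $K$) to a scaled trace form over $K$.
   Context: An algebraic extension $K/\mathbb{Q}$ is called prosolvable if for every finite subextension $L_0/\mathbb{Q}$ (with $L_0\subseteq K$) the Galois group of the Galois closure of $L_0/\mathbb{Q}$ is solvable. A scaled trace form over $K$ is a quadratic form of the shape $x\mapsto \mathrm{Tr}_{F/K}(\alpha x^2)$, $x\in F$, where $F/K$ is a finite separable field extension and $\alpha\in F$ is nonzero; it is a quadratic form over $K$ of dimension $[F:K]$. $\langle 1,1\rangle$ denotes the two-dimensional quadratic form $(x,y)\mapsto x^2+y^2$. -}

module Defs where

open import Level using (0ℓ; suc)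
open import Algebra.Bundles using (CommutativeRing; Group)
open import Algebra.Module.Bundles using (LeftModule)
import Algebra.Module.Construct.DirectProduct as DirectProduct
import Algebra.Module.Construct.TensorUnit as TensorUnit
import Algebra.Module.Morphism.Structures as ModuleMorphism
open import Algebra.Morphism.Bundles using (RingHomomorphism)
import Algebra.Morphism.Construct.Composition as Compose
import Algebra.Morphism.Construct.Identity as Identity
import Algebra.Properties.AbelianGroup as AbelianGroupProperties
import Algebra.Properties.CommutativeMonoid.Sum as CMSum
import Algebra.Properties.Monoid.Mult as Mult
import Algebra.Properties.Ring as RingProperties
import Algebra.Properties.Semiring.Exp as Exp
import Algebra.Properties.Semiring.Sum as SemiringSum
import Algebra.Solver.Ring.NaturalCoefficients.Default as SemiringSolver
open import Data.Fin.Base as Fin using (Fin; toℕ; fromℕ)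
open import Data.Nat.Base as ℕ using (ℕ)
open import Data.Product.Base using (Σ; ∃; _×_; _,_; proj₂)
import Data.Rational as ℚ
import Data.Rational.Properties as ℚ
open import Data.Vec.Functional using (Vector)
open import Function.Base using (_∘_)
open import Function.Definitions using (Surjective)
open import Relation.Binary.Definitions using (Decidable)
import Relation.Binary.Reasoning.Setoid as SetoidReasoning
open import Relation.Nullary using (¬_)

------------------------------------------------------------------------
-- Fields and extensions

-- Discrete fields: classically, decidability of equality is no restriction.
-- Carriers in Set lose nothing here: only algebraic extensions of ℚ matter.

record Field : Set₁ where
  field
    commutativeRing : CommutativeRing 0ℓ 0ℓ
  open CommutativeRing commutativeRing public
  field
    1≉0     : ¬ 1# ≈ 0#
    inverse : ∀ x → ¬ x ≈ 0# → ∃ λ y → x * y ≈ 1#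
    _≟_     : Decidable _≈_

ℚ-field : Field
ℚ-field = record
  { commutativeRing = ℚ.+-*-commutativeRing
  ; 1≉0             = λ ()
  ; inverse         = λ p p≢0 → ℚ.1/_ p {{ℚ.≢-nonZero p≢0}} , ℚ.*-inverseʳ p {{ℚ.≢-nonZero p≢0}}
  ; _≟_             = ℚ._≟_
  }

record Extension (K : Field) : Set₁ where
  field
    top  : Field
    base : RingHomomorphism (Field.rawRing K) (Field.rawRing top)
  open Field top public
  open RingHomomorphism base public using () renaming
    ( ⟦_⟧ to ι; ⟦⟧-cong to ι-cong; +-homo to ι-+; *-homo to ι-*
    ; 0#-homo to ι-0; 1#-homo to ι-1; -‿homo to ι-neg )

VectorSpace : Field → Set₁
VectorSpace K = LeftModule (Field.ring K) 0ℓ 0ℓ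

module _ {K : Field} where

  private module K = Field K

  vectorSpace : Extension K → VectorSpace K
  vectorSpace F = record
    { Carrierᴹ     = Carrier
    ; _≈ᴹ_         = _≈_
    ; _+ᴹ_         = _+_
    ; _*ₗ_         = λ k x → ι k * x
    ; 0ᴹ           = 0#
    ; -ᴹ_          = -_
    ; isLeftModule = record
      { isLeftSemimodule = record
        { +ᴹ-isCommutativeMonoid = +-isCommutativeMonoid
        ; isPreleftSemimodule    = record
          { *ₗ-cong      = λ k≈l x≈y → *-cong (ι-cong k≈l) x≈y
          ; *ₗ-zeroˡ     = λ x → trans (*-congʳ ι-0) (zeroˡ x)
          ; *ₗ-distribʳ  = λ x k l → trans (*-congʳ (ι-+ k l)) (distribʳ x (ι k) (ι l))
          ; *ₗ-identityˡ = λ x → trans (*-congʳ ι-1) (*-identityˡ x)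
          ; *ₗ-assoc     = λ k l x → trans (*-congʳ (ι-* k l)) (*-assoc (ι k) (ι l) x)
          ; *ₗ-zeroʳ     = λ k → zeroʳ (ι k)
          ; *ₗ-distribˡ  = λ k x y → distribˡ (ι k) x y
          }
        }
      ; -ᴹ‿cong    = -‿cong
      ; -ᴹ‿inverse = -‿inverse
      }
    } where open Extension F

  -- Homomorphisms over K; they are injective because the source is a field.
  record Embedding (E F : Extension K) : Set where
    private
      module E = Extension E
      module F = Extension F
    field
      hom   : RingHomomorphism E.rawRing F.rawRing
      fixes : ∀ k → RingHomomorphism.⟦_⟧ hom (E.ι k) F.≈ F.ι k
    open RingHomomorphism hom public

  record Automorphism (E : Extension K) : Set where
    open Extension E
    field
      to from : Embedding E E
    open Embedding to public using (⟦_⟧)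
    field
      to∘from : ∀ x → Embedding.⟦_⟧ to (Embedding.⟦_⟧ from x) ≈ x
      from∘to : ∀ x → Embedding.⟦_⟧ from (Embedding.⟦_⟧ to x) ≈ x

  Gal : Extension K → Group 0ℓ 0ℓ
  Gal E = record
    { Carrier = Automorphism E
    ; _≈_     = λ σ τ → ∀ x → ⟦ σ ⟧ x ≈ ⟦ τ ⟧ x
    ; _∙_     = λ σ τ → record
      { to      = compose (to σ) (to τ)
      ; from    = compose (from τ) (from σ)
      ; to∘from = λ x → trans (Embedding.⟦⟧-cong (to σ) (to∘from τ _)) (to∘from σ x)
      ; from∘to = λ x → trans (Embedding.⟦⟧-cong (from τ) (from∘to σ _)) (from∘to τ x)
      }
    ; ε       = record
      { to = identity ; from = identity ; to∘from = λ _ → refl ; from∘to = λ _ → refl }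
    ; _⁻¹     = λ σ → record
      { to = from σ ; from = to σ ; to∘from = from∘to σ ; from∘to = to∘from σ }
    ; isGroup = record
      { isMonoid = record
        { isSemigroup = record
          { isMagma = record
            { isEquivalence = record
              { refl  = λ _ → refl
              ; sym   = λ σ≈τ x → sym (σ≈τ x)
              ; trans = λ ρ≈σ σ≈τ x → trans (ρ≈σ x) (σ≈τ x)
              }
            ; ∙-cong = λ {_} {σ′} {τ} σ≈σ′ τ≈τ′ x →
                trans (σ≈σ′ (⟦ τ ⟧ x)) (Embedding.⟦⟧-cong (to σ′) (τ≈τ′ x))
            }
          ; assoc = λ _ _ _ _ → refl
          }
        ; identity = (λ _ _ → refl) , (λ _ _ → refl)
        }
      ; inverse = from∘to , to∘from
      ; ⁻¹-cong = λ {σ} {τ} σ≈τ x →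
          trans (Embedding.⟦⟧-cong (from σ) (sym (to∘from τ x)))
            (trans (Embedding.⟦⟧-cong (from σ) (sym (σ≈τ (Embedding.⟦_⟧ (from τ) x))))
              (from∘to σ (Embedding.⟦_⟧ (from τ) x)))
      }
    }
    where
    open Extension E
    open Automorphism

    compose : Embedding E E → Embedding E E → Embedding E E
    compose f g = record
      { hom   = Compose.ringHomomorphism {M₁ = ring} {M₂ = ring} {M₃ = ring}
                  (Embedding.hom g) (Embedding.hom f)
      ; fixes = λ k → trans (Embedding.⟦⟧-cong f (Embedding.fixes g k)) (Embedding.fixes f k)
      }

    identity : Embedding E E
    identity = record { hom = Identity.ringHomomorphism ring ; fixes = λ _ → refl }

------------------------------------------------------------------------
-- Bases and traces

module _ (K : Field) where

  private module K = Field K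

  record Basis (V : VectorSpace K) (n : ℕ) : Set where
    open LeftModule V
    open CMSum +ᴹ-commutativeMonoid using (sum)
    field
      vec         : Vector Carrierᴹ n
      coord       : Carrierᴹ → Vector K.Carrier n
      expand      : ∀ x → x ≈ᴹ sum (λ i → coord x i *ₗ vec i)
      independent : ∀ (c : Vector K.Carrier n) →
                    sum (λ i → c i *ₗ vec i) ≈ᴹ 0ᴹ → ∀ i → c i K.≈ K.0#

    trace : (Carrierᴹ → Carrierᴹ) → K.Carrier
    trace f = CMSum.sum K.+-commutativeMonoid (λ i → coord (f (vec i)) i)

module _ {K : Field} where

  HasDegree : Extension K → ℕ → Set
  HasDegree F n = Basis K (vectorSpace F) n

  Finite : Extension K → Set
  Finite F = ∃ (HasDegree F)

  -- The trace of multiplication by x; it does not depend on the chosen basis.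
  Tr : (F : Extension K) → Finite F → Extension.Carrier F → Field.Carrier K
  Tr F (_ , b) x = Basis.trace b (λ y → x * y)
    where open Extension F

------------------------------------------------------------------------
-- Polynomials, algebraic and separable extensions

-- c : Vector K n stands for the polynomial Σ_{i<n} c i Xⁱ, possibly with
-- vanishing leading coefficients.

module _ {K : Field} where

  private module K = Field K

  eval : (F : Extension K) → ∀ {n} → Vector K.Carrier n → Extension.Carrier F → Extension.Carrier F
  eval F c x = sum (λ i → ι (c i) * x ^ toℕ i)
    where
    open Extension F
    open CMSum +-commutativeMonoid using (sum)
    open Exp semiring using (_^_)

  derivative : ∀ {n} → Vector K.Carrier (ℕ.suc n) → Vector K.Carrier n
  derivative c i = ℕ.suc (toℕ i) ·  c (Fin.suc i)
    where open Mult K.+-monoid renaming (_×_ to _·_)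

  Algebraic : Extension K → Set
  Algebraic F = ∀ x → ∃ λ n → Σ (Vector K.Carrier n) λ c →
    (∃ λ i → ¬ c i K.≈ K.0#) × eval F c x ≈ 0#
    where open Extension F

  record IsMinimalPolynomial (F : Extension K) (x : Extension.Carrier F)
                             {n} (c : Vector K.Carrier (ℕ.suc n)) : Set where
    open Extension F
    field
      monic   : c (fromℕ n) K.≈ K.1#
      root    : eval F c x ≈ 0#
      minimal : ∀ (d : Vector K.Carrier n) → eval F d x ≈ 0# → ∀ i → d i K.≈ K.0#

  -- No multiple root in any extension field.
  IsSeparablePolynomial : ∀ {n} → Vector K.Carrier (ℕ.suc n) → Set₁
  IsSeparablePolynomial c = ∀ (E : Extension K) → let open Extension E in
    ∀ r → eval E c r ≈ 0# → ¬ eval E (derivative c) r ≈ 0#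

  Separable : Extension K → Set₁
  Separable F = ∀ x → ∃ λ n → Σ (Vector K.Carrier (ℕ.suc n)) λ c →
    IsMinimalPolynomial F x c × IsSeparablePolynomial c

------------------------------------------------------------------------
-- Solvable groups

module _ (G : Group 0ℓ 0ℓ) where

  open Group G

  data DerivedSeries : ℕ → Carrier → Set where
    whole      : ∀ g → DerivedSeries 0 g
    commutator : ∀ {n g h} → DerivedSeries n g → DerivedSeries n h →
                 DerivedSeries (ℕ.suc n) (((g ∙ h) ∙ g ⁻¹) ∙ h ⁻¹)
    unit       : ∀ {n} → DerivedSeries (ℕ.suc n) ε
    product    : ∀ {n g h} → DerivedSeries (ℕ.suc n) g → DerivedSeries (ℕ.suc n) h →
                 DerivedSeries (ℕ.suc n) (g ∙ h)
    inv        : ∀ {n g} → DerivedSeries (ℕ.suc n) g → DerivedSeries (ℕ.suc n) (g ⁻¹)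
    resp       : ∀ {n g h} → g ≈ h → DerivedSeries (ℕ.suc n) g → DerivedSeries (ℕ.suc n) h

  Solvable : Set
  Solvable = ∃ λ n → ∀ g → DerivedSeries n g → g ≈ ε

------------------------------------------------------------------------
-- Galois closures and prosolvable extensions

module _ {K : Field} where

  -- Finite, with the base field as fixed field of the automorphism group.
  record IsFiniteGalois (E : Extension K) : Set where
    open Extension E
    field
      finite     : Finite E
      fixedField : ∀ x → (∀ (σ : Automorphism E) → Automorphism.⟦_⟧ σ x ≈ x) →
                   ∃ λ k → x ≈ ι k

  -- The smallest Galois extension of K containing the finite extension L.
  -- Intermediate fields are given by embeddings rather than by subsets.
  record GaloisClosure (L : Extension K) : Set₁ where
    field
      closure        : Extension K
      isFiniteGalois : IsFiniteGalois closure
      embed          : Embedding L closure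
    open Extension closure
    field
      smallest : ∀ (E : Extension K) (j : Embedding L E) (i : Embedding E closure) →
                 (∀ x → Embedding.⟦_⟧ i (Embedding.⟦_⟧ j x) ≈ Embedding.⟦_⟧ embed x) →
                 IsFiniteGalois E →
                 Surjective (Extension._≈_ E) _≈_ (Embedding.⟦_⟧ i)

-- A finite subextension of K/ℚ is a finite L/ℚ together with an embedding of
-- L into K over ℚ.
Prosolvable : Extension ℚ-field → Set₁
Prosolvable K = Algebraic K ×
  (∀ (L : Extension ℚ-field) → Finite L → Embedding L K →
    Σ (GaloisClosure L) λ N → Solvable (Gal (GaloisClosure.closure N)))

------------------------------------------------------------------------
-- Quadratic forms

module _ (K : Field) where

  private module K = Field K

  record QuadraticForm (V : VectorSpace K) : Set where
    open LeftModule V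
    field
      q : Carrierᴹ → K.Carrier

    polar : Carrierᴹ → Carrierᴹ → K.Carrier
    polar u v = (q (u +ᴹ v) K.- q u) K.- q v

    field
      q-cong      : ∀ {u v} → u ≈ᴹ v → q u K.≈ q v
      q-scale     : ∀ k v → q (k *ₗ v) K.≈ (k K.* k) K.* q v
      polar-add   : ∀ u v w → polar (u +ᴹ v) w K.≈ polar u w K.+ polar v w
      polar-scale : ∀ k u v → polar (k *ₗ u) v K.≈ k K.* polar u v

  NonDegenerate : ∀ {V} → QuadraticForm V → Set
  NonDegenerate {V} Q = ∀ u → (∀ v → polar u v K.≈ K.0#) → u ≈ᴹ 0ᴹ
    where
    open LeftModule V
    open QuadraticForm Q

  Isometric : ∀ {V W} → QuadraticForm V → QuadraticForm W → Set
  Isometric {V} {W} Q R = Σ (V.Carrierᴹ → W.Carrierᴹ) λ f →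
    IsLeftModuleIsomorphism f × (∀ v → QuadraticForm.q R (f v) K.≈ QuadraticForm.q Q v)
    where
    module V = LeftModule V
    module W = LeftModule W
    open ModuleMorphism.LeftModuleMorphisms V.rawLeftModule W.rawLeftModule

  -- The form v ↦ B(v,v) of a symmetric bilinear form B.
  module _ (V : VectorSpace K) where
    open LeftModule V
    open SemiringSolver K.commutativeSemiring using (solve; _:=_; _:+_)
    open SetoidReasoning K.setoid

    diagonal : (B : Carrierᴹ → Carrierᴹ → K.Carrier) →
      (∀ {u u′ v v′} → u ≈ᴹ u′ → v ≈ᴹ v′ → B u v K.≈ B u′ v′) →
      (∀ u v → B u v K.≈ B v u) →
      (∀ u v w → B (u +ᴹ v) w K.≈ B u w K.+ B v w) →
      (∀ k u v → B (k *ₗ u) v K.≈ k K.* B u v) →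
      QuadraticForm V
    diagonal B B-cong B-sym B-add B-scale = record
      { q           = λ v → B v v
      ; q-cong      = λ u≈v → B-cong u≈v u≈v
      ; q-scale     = λ k v → begin
          B (k *ₗ v) (k *ₗ v)        ≈⟨ B-scale k v (k *ₗ v) ⟩
          k K.* B v (k *ₗ v)         ≈⟨ K.*-congˡ (B-sym v (k *ₗ v)) ⟩
          k K.* B (k *ₗ v) v         ≈⟨ K.*-congˡ (B-scale k v v) ⟩
          k K.* (k K.* B v v)        ≈⟨ K.*-assoc k k (B v v) ⟨
          (k K.* k) K.* B v v        ∎
      ; polar-add   = λ u v w → begin
          polarB (u +ᴹ v) w                                ≈⟨ polar≈2B (u +ᴹ v) w ⟩
          B (u +ᴹ v) w K.+ B (u +ᴹ v) w                    ≈⟨ K.+-cong (B-add u v w) (B-add u v w) ⟩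
          (B u w K.+ B v w) K.+ (B u w K.+ B v w)          ≈⟨ solve 2 (λ a b → (a :+ b) :+ (a :+ b) := (a :+ a) :+ (b :+ b))
                                                                K.refl (B u w) (B v w) ⟩
          (B u w K.+ B u w) K.+ (B v w K.+ B v w)          ≈⟨ K.+-cong (polar≈2B u w) (polar≈2B v w) ⟨
          polarB u w K.+ polarB v w                        ∎
      ; polar-scale = λ k u v → begin
          polarB (k *ₗ u) v                ≈⟨ polar≈2B (k *ₗ u) v ⟩
          B (k *ₗ u) v K.+ B (k *ₗ u) v    ≈⟨ K.+-cong (B-scale k u v) (B-scale k u v) ⟩
          k K.* B u v K.+ k K.* B u v      ≈⟨ K.distribˡ k (B u v) (B u v) ⟨
          k K.* (B u v K.+ B u v)          ≈⟨ K.*-congˡ (polar≈2B u v) ⟨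
          k K.* polarB u v                 ∎
      }
      where
      polarB : Carrierᴹ → Carrierᴹ → K.Carrier
      polarB u v = (B (u +ᴹ v) (u +ᴹ v) K.- B u u) K.- B v v

      polar≈2B : ∀ u v → polarB u v K.≈ B u v K.+ B u v
      polar≈2B u v = begin
        polarB u v
          ≈⟨ K.+-congʳ (K.+-congʳ (K.trans (B-add u v (u +ᴹ v)) (K.+-cong
               (K.trans (B-sym u (u +ᴹ v)) (B-add u v u))
               (K.trans (B-sym v (u +ᴹ v)) (B-add u v v))))) ⟩
        (((B u u K.+ B v u) K.+ (B u v K.+ B v v)) K.- B u u) K.- B v v
          ≈⟨ K.+-congʳ (K.+-congʳ (K.+-congʳ (K.+-congˡ (B-sym v u)))) ⟩
        (((B u u K.+ B u v) K.+ (B u v K.+ B v v)) K.- B u u) K.- B v v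
          ≈⟨ K.+-congʳ (K.+-congʳ (solve 3 (λ a b c → (a :+ b) :+ (b :+ c) := a :+ (c :+ (b :+ b)))
               K.refl (B u u) (B u v) (B v v))) ⟩
        ((B u u K.+ (B v v K.+ (B u v K.+ B u v))) K.- B u u) K.- B v v
          ≈⟨ K.+-congʳ (xyx⁻¹≈y (B u u) _) ⟩
        (B v v K.+ (B u v K.+ B u v)) K.- B v v
          ≈⟨ xyx⁻¹≈y (B v v) _ ⟩
        B u v K.+ B u v ∎
        where open AbelianGroupProperties K.+-abelianGroup using (xyx⁻¹≈y)

module _ (K : Field) where

  open Field K
  open SemiringSolver commutativeSemiring using (solve; _:=_; _:+_; _:*_)

  plane : VectorSpace K
  plane = DirectProduct.leftModule TensorUnit.leftModule TensorUnit.leftModule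

  ⟨1,1⟩ : QuadraticForm K plane
  ⟨1,1⟩ = diagonal K plane
    (λ (x , y) (x′ , y′) → x * x′ + y * y′)
    (λ (p , q) (r , s) → +-cong (*-cong p r) (*-cong q s))
    (λ (x , y) (x′ , y′) → +-cong (*-comm x x′) (*-comm y y′))
    (λ (x , y) (x′ , y′) (a , b) →
      solve 6 (λ x y x′ y′ a b → (x :+ x′) :* a :+ (y :+ y′) :* b
                              := (x :* a :+ y :* b) :+ (x′ :* a :+ y′ :* b))
        refl x y x′ y′ a b)
    (λ k (x , y) (a , b) →
      solve 5 (λ k x y a b → (k :* x) :* a :+ (k :* y) :* b := k :* (x :* a :+ y :* b))
        refl k x y a b)

------------------------------------------------------------------------
-- Scaled trace forms

module _ {K : Field} {V : VectorSpace K} {n} (b : Basis K V n) where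

  private module K = Field K
  open LeftModule V
  open Basis b
  open CMSum +ᴹ-commutativeMonoid using (sum; sum-cong-≋; ∑-distrib-+)
  open SetoidReasoning ≈ᴹ-setoid

  private
    comb : Vector K.Carrier n → Carrierᴹ
    comb c = sum (λ i → c i *ₗ vec i)

    comb-+ : ∀ c d → comb (λ i → c i K.+ d i) ≈ᴹ comb c +ᴹ comb d
    comb-+ c d = ≈ᴹ-trans (sum-cong-≋ (λ i → *ₗ-distribʳ (vec i) (c i) (d i)))
      (∑-distrib-+ (λ i → c i *ₗ vec i) (λ i → d i *ₗ vec i))

    scale-sum : ∀ k {m} (f : Vector Carrierᴹ m) → k *ₗ sum f ≈ᴹ sum (λ i → k *ₗ f i)
    scale-sum k {ℕ.zero}  f = *ₗ-zeroʳ k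
    scale-sum k {ℕ.suc m} f =
      ≈ᴹ-trans (*ₗ-distribˡ k _ _) (+ᴹ-congˡ (scale-sum k (f ∘ Fin.suc)))

    comb-* : ∀ k c → comb (λ i → k K.* c i) ≈ᴹ k *ₗ comb c
    comb-* k c = ≈ᴹ-trans (sum-cong-≋ (λ i → *ₗ-assoc k (c i) (vec i)))
      (≈ᴹ-sym (scale-sum k (λ i → c i *ₗ vec i)))

    comb-injective : ∀ c d → comb c ≈ᴹ comb d → ∀ i → c i K.≈ d i
    comb-injective c d c≈d i = pointwise
      where
      -d : Vector K.Carrier n
      -d j = (K.- K.1#) K.* d j
      cancel : comb d +ᴹ comb -d ≈ᴹ 0ᴹ
      cancel = begin
        comb d +ᴹ comb -d            ≈⟨ comb-+ d -d ⟨
        comb (λ j → d j K.+ -d j)    ≈⟨ sum-cong-≋ (λ j → ≈ᴹ-trans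
                                          (*ₗ-congʳ (zero-d j)) (*ₗ-zeroˡ (vec j))) ⟩
        sum {n} (λ _ → 0ᴹ)           ≈⟨ CMSum.sum-replicate-zero +ᴹ-commutativeMonoid n ⟩
        0ᴹ                           ∎
        where
        zero-d : ∀ j → d j K.+ -d j K.≈ K.0#
        zero-d j = K.trans (K.+-congˡ (RingProperties.-1*x≈-x K.ring (d j))) (K.-‿inverseʳ (d j))
      vanish : ∀ j → c j K.+ -d j K.≈ K.0#
      vanish = independent (λ j → c j K.+ -d j) (begin
        comb (λ j → c j K.+ -d j)    ≈⟨ comb-+ c -d ⟩
        comb c +ᴹ comb -d            ≈⟨ +ᴹ-congʳ c≈d ⟩
        comb d +ᴹ comb -d            ≈⟨ cancel ⟩
        0ᴹ                           ∎)
      pointwise : c i K.≈ d i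
      pointwise = RingProperties.x∙y⁻¹≈ε⇒x≈y K.ring (c i) (d i)
        (K.trans (K.+-congˡ (K.sym (RingProperties.-1*x≈-x K.ring (d i)))) (vanish i))

  coord-cong : ∀ {x y} → x ≈ᴹ y → ∀ i → coord x i K.≈ coord y i
  coord-cong {x} {y} x≈y = comb-injective (coord x) (coord y)
    (≈ᴹ-trans (≈ᴹ-sym (expand x)) (≈ᴹ-trans x≈y (expand y)))

  coord-+ : ∀ x y i → coord (x +ᴹ y) i K.≈ coord x i K.+ coord y i
  coord-+ x y = comb-injective (coord (x +ᴹ y)) (λ i → coord x i K.+ coord y i) (begin
    comb (coord (x +ᴹ y))                    ≈⟨ expand (x +ᴹ y) ⟨
    x +ᴹ y                                   ≈⟨ +ᴹ-cong (expand x) (expand y) ⟩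
    comb (coord x) +ᴹ comb (coord y)         ≈⟨ comb-+ (coord x) (coord y) ⟨
    comb (λ i → coord x i K.+ coord y i)     ∎)

  coord-* : ∀ k x i → coord (k *ₗ x) i K.≈ k K.* coord x i
  coord-* k x = comb-injective (coord (k *ₗ x)) (λ i → k K.* coord x i) (begin
    comb (coord (k *ₗ x))                    ≈⟨ expand (k *ₗ x) ⟨
    k *ₗ x                                   ≈⟨ *ₗ-congˡ (expand x) ⟩
    k *ₗ comb (coord x)                      ≈⟨ comb-* k (coord x) ⟨
    comb (λ i → k K.* coord x i)             ∎)

module _ {K : Field} (F : Extension K) (fin : Finite F) where

  private
    module K = Field K
    b = proj₂ fin
  open Extension F
  open Basis b using (vec; coord)
  open SemiringSum K.semiring using (sum-cong-≋; ∑-distrib-+; *-distribˡ-sum)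

  Tr-cong : ∀ {x y} → x ≈ y → Tr F fin x K.≈ Tr F fin y
  Tr-cong x≈y = sum-cong-≋ (λ i → coord-cong b (*-congʳ x≈y) i)

  Tr-+ : ∀ x y → Tr F fin (x + y) K.≈ Tr F fin x K.+ Tr F fin y
  Tr-+ x y = K.trans
    (sum-cong-≋ (λ i → K.trans (coord-cong b (distribʳ (vec i) x y) i)
                               (coord-+ b (x * vec i) (y * vec i) i)))
    (∑-distrib-+ (λ i → coord (x * vec i) i) (λ i → coord (y * vec i) i))

  Tr-* : ∀ k x → Tr F fin (ι k * x) K.≈ k K.* Tr F fin x
  Tr-* k x = K.trans
    (sum-cong-≋ (λ i → K.trans (coord-cong b (*-assoc (ι k) x (vec i)) i)
                               (coord-* b k (x * vec i) i)))
    (K.sym (*-distribˡ-sum k (λ i → coord (x * vec i) i)))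

  scaledTraceForm : Carrier → QuadraticForm K (vectorSpace F)
  scaledTraceForm α = diagonal K (vectorSpace F)
    (λ x y → Tr F fin (α * (x * y)))
    (λ x≈x′ y≈y′ → Tr-cong (*-congˡ (*-cong x≈x′ y≈y′)))
    (λ x y → Tr-cong (*-congˡ (*-comm x y)))
    (λ x y z → K.trans
      (Tr-cong (solve 4 (λ a x y z → a :* ((x :+ y) :* z) := a :* (x :* z) :+ a :* (y :* z))
        refl α x y z))
      (Tr-+ (α * (x * z)) (α * (y * z))))
    (λ k x y → K.trans
      (Tr-cong (solve 4 (λ a k x y → a :* ((k :* x) :* y) := k :* (a :* (x :* y)))
        refl α (ι k) x y))
      (Tr-* k (α * (x * y))))
    where
    open SemiringSolver commutativeSemiring using (solve; _:=_; _:+_; _:*_)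

IsScaledTraceForm : ∀ K {V : VectorSpace K} → QuadraticForm K V → Set₁
IsScaledTraceForm K Q =
  Σ (Extension K) λ F → Σ (Finite F) λ fin → Separable F ×
  (let open Extension F in
    ∃ λ α → ¬ α ≈ 0# × Isometric K Q (scaledTraceForm F fin α))

{-# OPTIONS --safe #-}
module Submission where

open import Defs
open import Level using (0ℓ)
open import Algebra.Bundles using (CommutativeRing; Group)
open import Algebra.Module.Bundles using (LeftModule)
import Algebra.Module.Morphism.Structures as ModuleMorphism
import Algebra.Morphism.Construct.Composition as Compose
import Algebra.Morphism.Construct.Identity as Identity
import Algebra.Properties.Ring as RingProperties
import Algebra.Properties.Semiring.Exp as Exp
import Algebra.Properties.Semiring.Mult.TCOptimised as Mult′
import Algebra.Properties.Semiring.Sum as SemiringSum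
import Algebra.Solver.Ring as RingSolver
open import Algebra.Solver.Ring.AlmostCommutativeRing using (fromCommutativeRing; _-Raw-AlmostCommutative⟶_)
open import Algebra.Structures using (IsCommutativeRing)
open import Data.Bool.Base using (Bool; true; false)
open import Data.Fin.Base using (Fin; zero; suc; toℕ; fromℕ<; splitAt; punchIn; combine; remQuot)
import Data.Fin.Properties as Finₚ
open import Data.Integer.Base as ℤ using (ℤ; +_; -[1+_])
import Data.Integer.Properties as ℤₚ
open import Data.Maybe.Base using (Maybe; just; nothing)
open import Data.Nat.Base as ℕ using (ℕ; zero; suc; _≤_; s≤s; z≤n; _≤′_; ≤′-step; ≤′-reflexive)
open import Data.Nat.Coprimality as Coprimality using (Coprime)
open import Data.Nat.Divisibility using (_∣_; divides; ∣⇒≤)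
import Data.Nat.Properties as ℕₚ
open import Data.Product.Base using (Σ; ∃; _×_; _,_; proj₁; proj₂)
open import Data.Rational as ℚ using (ℚ; mkℚ; ↥_; ↧_; ↧ₙ_; 0ℚ; toℚᵘ)
import Data.Rational.Properties as ℚₚ
open import Data.Rational.Unnormalised.Base as ℚᵘ using (mkℚᵘ; *≡*)
import Data.Rational.Unnormalised.Properties as ℚᵘₚ
import Data.Sign.Base as Sign
open import Data.Sum.Base using (_⊎_; inj₁; inj₂; [_,_]′)
open import Data.Unit.Base using (⊤; tt)
open import Data.Vec.Functional using (Vector; _∷_; _++_; insertAt; removeAt; tail)
import Data.Vec.Functional.Properties as Vecₚ
open import Function.Base using (_∘_)
open import Relation.Binary.PropositionalEquality as ≡ using (_≡_; _≢_)
import Relation.Binary.Reasoning.Setoid as SetoidReasoning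
open import Relation.Nullary using (¬_; Dec; yes; no; contradiction)
open import Relation.Nullary.Decidable using (map′; ¬?; _×-dec_)

-- A quadratic form ⟨1,1⟩ that is a scaled trace form of F/K has an orthonormal
-- basis e₁, e₂ ∈ F, and x = e₂ / e₁ satisfies x² = 1 + c x with c ∈ K.  If 1 + h²
-- is a square in K for every h ∈ K, then x ∈ K, which is absurd.  So we take for K the
-- Pythagorean closure of ℚ; it is formally real, so -1 is not a square.
--
-- K is the union of a chain of fields M_k, each obtained from the previous one
-- by adjoining the square roots of all conjugates of elements 1 + a².  Whether
-- an element of M_k is a square is decidable, and M_k is Galois over ℚ: it carries
-- a finite family of endomorphisms f_j with Σ f_j(x) = t(x) ∈ ℚ.  As M_k is formally
-- real, the form t(xy) is anisotropic, and Gram–Schmidt together with Dedekind's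
-- independence of characters yields the Galois theory of M_k: embeddings of
-- subfields extend to some f_j, and subfields are fixed fields.  A finite L
-- embedded in K lands in some M_k; its Galois closure is the fixed field of the f_j
-- that fix all conjugates of L, and its group is a quotient of Gal(M_k),
-- which is solvable because M_k is an iterated quadratic extension.

-- All fields have decidable equality, and adjoining a root of d gives a field only when d is known
-- to be a nonsquare; this forces the decision procedure for squares to travel up the chain, while
-- splitting fields and factorisation are avoided. Formal reality does most of the remaining work.
-- It gives 2 ≠ 0 for that procedure, and it turns Σ f_j(x)² = 0 into x = 0, so that bases,
-- projections and nonzero traces come from positivity. It survives each step because the adjoined
-- root is that of 1 + a². The f_j may repeat: Dedekind's theorem is used in a form in which only
-- the total coefficient of equal characters counts. Each step treats finitely many a, so
-- enumerations of the M_k must be kept compatible for the union to miss nothing. The fields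
-- strictly between two stages need not be Galois, so solvability is carried up in a form that does
-- not mention normality. The constant term 1 in x² = 1 + c x arises because multiplication by x is
-- self-adjoint for the trace form: the coefficient of e₁ in x e₂ is the product of x e₂ with e₁,
-- that is, of e₂ with x e₁ = e₂. With h = c/2 the equation reads (x - h)² = 1 + h².

-- Ring identities with integer coefficients

module IntegerSolver (R : CommutativeRing 0ℓ 0ℓ) where
  open CommutativeRing R
  open RingProperties ring
  open Mult′ semiring using (×-homo-+; ×1-homo-*; 1+×) renaming (_×_ to _·_)
  open SetoidReasoning setoid

  private
    ⟦_⟧ : ℤ → Carrier
    ⟦ + n      ⟧ = n · 1#
    ⟦ -[1+ n ] ⟧ = - (suc n · 1#)

    suc· : ∀ n → suc n · 1# ≈ 1# + n · 1#
    suc· n = 1+× n 1#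

    cancel-one : ∀ a b → (1# + a) - (1# + b) ≈ a - b
    cancel-one a b = begin
      (1# + a) - (1# + b)        ≈⟨ +-cong (+-comm 1# a) (sym (-‿+-comm 1# b)) ⟩
      (a + 1#) + (- 1# + - b)    ≈⟨ +-assoc a 1# _ ⟩
      a + (1# + (- 1# + - b))    ≈⟨ +-congˡ (sym (+-assoc 1# (- 1#) (- b))) ⟩
      a + ((1# - 1#) + - b)      ≈⟨ +-congˡ (trans (+-congʳ (-‿inverseʳ 1#)) (+-identityˡ (- b))) ⟩
      a - b                      ∎

    ⊖-homo : ∀ m n → ⟦ m ℤ.⊖ n ⟧ ≈ m · 1# - n · 1#
    ⊖-homo zero    zero    = sym (-‿inverseʳ 0#)
    ⊖-homo zero    (suc n) = sym (+-identityˡ _)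
    ⊖-homo (suc m) zero    = sym (trans (+-congˡ -0#≈0#) (+-identityʳ _))
    ⊖-homo (suc m) (suc n) = begin
      ⟦ suc m ℤ.⊖ suc n ⟧               ≡⟨ ≡.cong ⟦_⟧ (ℤₚ.[1+m]⊖[1+n]≡m⊖n m n) ⟩
      ⟦ m ℤ.⊖ n ⟧                       ≈⟨ ⊖-homo m n ⟩
      m · 1# - n · 1#                   ≈⟨ cancel-one _ _ ⟨
      (1# + m · 1#) - (1# + n · 1#)     ≈⟨ +-cong (suc· m) (-‿cong (suc· n)) ⟨
      suc m · 1# - suc n · 1#           ∎

    +-homo : ∀ x y → ⟦ x ℤ.+ y ⟧ ≈ ⟦ x ⟧ + ⟦ y ⟧
    +-homo (+ m)      (+ n)      = ×-homo-+ 1# m n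
    +-homo (+ m)      -[1+ n ]   = ⊖-homo m (suc n)
    +-homo -[1+ m ]   (+ n)      = trans (⊖-homo n (suc m)) (+-comm _ _)
    +-homo -[1+ m ]   -[1+ n ]   = begin
      - (suc (suc (m ℕ.+ n)) · 1#)        ≈⟨ -‿cong (suc· (suc (m ℕ.+ n))) ⟩
      - (1# + (suc m ℕ.+ n) · 1#)         ≈⟨ -‿cong (+-congˡ (×-homo-+ 1# (suc m) n)) ⟩
      - (1# + (suc m · 1# + n · 1#))      ≈⟨ -‿cong (trans (sym (+-assoc _ _ _)) (trans (+-congʳ (+-comm _ _)) (+-assoc _ _ _))) ⟩
      - (suc m · 1# + (1# + n · 1#))      ≈⟨ -‿cong (+-congˡ (sym (suc· n))) ⟩
      - (suc m · 1# + suc n · 1#)         ≈⟨ -‿+-comm _ _ ⟨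
      - (suc m · 1#) + - (suc n · 1#)     ∎

    +◃ : ∀ n → ⟦ Sign.+ ℤ.◃ n ⟧ ≈ n · 1#
    +◃ n = reflexive (≡.cong ⟦_⟧ (ℤₚ.+◃n≡+n n))

    -◃ : ∀ n → ⟦ Sign.- ℤ.◃ n ⟧ ≈ - (n · 1#)
    -◃ zero    = sym -0#≈0#
    -◃ (suc n) = refl

    *-homo : ∀ x y → ⟦ x ℤ.* y ⟧ ≈ ⟦ x ⟧ * ⟦ y ⟧
    *-homo (+ m)    (+ n)    = trans (+◃ (m ℕ.* n)) (×1-homo-* m n)
    *-homo (+ m)    -[1+ n ] = trans (-◃ (m ℕ.* suc n))
      (trans (-‿cong (×1-homo-* m (suc n))) (-‿distribʳ-* _ _))
    *-homo -[1+ m ] (+ n)    = trans (-◃ (suc m ℕ.* n))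
      (trans (-‿cong (×1-homo-* (suc m) n)) (-‿distribˡ-* _ _))
    *-homo -[1+ m ] -[1+ n ] = trans (+◃ (suc m ℕ.* suc n)) (trans (×1-homo-* (suc m) (suc n))
      (trans (sym (-‿involutive _)) (trans (-‿cong (-‿distribʳ-* _ _)) (-‿distribˡ-* _ _))))

    -‿homo : ∀ x → ⟦ ℤ.- x ⟧ ≈ - ⟦ x ⟧
    -‿homo (+ zero)    = sym -0#≈0#
    -‿homo (+ (suc n)) = refl
    -‿homo -[1+ n ]    = sym (-‿involutive _)

    ℤ-morphism : ℤ.+-*-rawRing -Raw-AlmostCommutative⟶ fromCommutativeRing R
    ℤ-morphism = record
      { ⟦_⟧ = ⟦_⟧ ; +-homo = +-homo ; *-homo = *-homo ; -‿homo = -‿homo ; 0-homo = refl ; 1-homo = refl }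

    -- Integers can be compared even where elements of R cannot, and this lets normal forms cancel
    -- opposite terms. The answer `nothing` claims nothing about the images of distinct integers in
    -- R.
    coefficients≟ : ∀ x y → Maybe (⟦ x ⟧ ≈ ⟦ y ⟧)
    coefficients≟ x y with x ℤₚ.≟ y
    ... | yes x≡y = just (reflexive (≡.cong ⟦_⟧ x≡y))
    ... | no  _   = nothing

  open RingSolver ℤ.+-*-rawRing (fromCommutativeRing R) ℤ-morphism coefficients≟ public
    using (solve; _:=_; _:+_; _:*_; :-_; _:-_; con)

-- Fields, extensions and embeddings

module FieldProperties (F : Field) where
  open Field F public hiding (zero)
  open RingProperties ring public using (-0#≈0#; -1*x≈-x; x∙y⁻¹≈ε⇒x≈y; -‿involutive)
  open IntegerSolver commutativeRing public
  open SemiringSum semiring public using (sum; sum-cong-≋; ∑-distrib-+; *-distribˡ-sum; *-distribʳ-sum; sum-remove; ∑-comm)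
  open SetoidReasoning setoid

  recip : ∀ x → ¬ x ≈ 0# → Carrier
  recip x x≉0 = proj₁ (inverse x x≉0)

  recipʳ : ∀ x x≉0 → x * recip x x≉0 ≈ 1#
  recipʳ x x≉0 = proj₂ (inverse x x≉0)

  cancel : ∀ {x y} → ¬ x ≈ 0# → x * y ≈ 0# → y ≈ 0#
  cancel {x} {y} x≉0 xy≈0 = begin
    y                  ≈⟨ trans (*-congʳ (recipʳ x x≉0)) (*-identityˡ y) ⟨
    (x * x⁻¹) * y      ≈⟨ solve 3 (λ x x⁻¹ y → (x :* x⁻¹) :* y := x⁻¹ :* (x :* y)) refl x x⁻¹ y ⟩
    x⁻¹ * (x * y)      ≈⟨ trans (*-congˡ xy≈0) (zeroʳ x⁻¹) ⟩
    0#                 ∎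
    where x⁻¹ = recip x x≉0

  zero-product : ∀ {x y} → x * y ≈ 0# → x ≈ 0# ⊎ y ≈ 0#
  zero-product {x} xy≈0 with x ≟ 0#
  ... | yes x≈0 = inj₁ x≈0
  ... | no  x≉0 = inj₂ (cancel x≉0 xy≈0)

  square-zero : ∀ {x} → x * x ≈ 0# → x ≈ 0#
  square-zero xx≈0 with zero-product xx≈0
  ... | inj₁ p = p
  ... | inj₂ p = p

  *-nonzero : ∀ {x y} → ¬ x ≈ 0# → ¬ y ≈ 0# → ¬ x * y ≈ 0#
  *-nonzero x≉0 y≉0 xy≈0 = y≉0 (cancel x≉0 xy≈0)

  x-y≈0⇒x≈y : ∀ {x y} → x - y ≈ 0# → x ≈ y
  x-y≈0⇒x≈y = x∙y⁻¹≈ε⇒x≈y _ _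

  x≈y⇒x-y≈0 : ∀ {x y} → x ≈ y → x - y ≈ 0#
  x≈y⇒x-y≈0 {y = y} x≈y = trans (+-congʳ x≈y) (-‿inverseʳ y)

  *-cancelˡ : ∀ {x y z} → ¬ x ≈ 0# → x * y ≈ x * z → y ≈ z
  *-cancelˡ {x} {y} {z} x≉0 xy≈xz = x-y≈0⇒x≈y (cancel x≉0 (begin
    x * (y - z)      ≈⟨ solve 3 (λ x y z → x :* (y :- z) := x :* y :- x :* z) refl x y z ⟩
    x * y - x * z    ≈⟨ x≈y⇒x-y≈0 xy≈xz ⟩
    0#               ∎))

  sum-zero : ∀ {n} (v : Fin n → Carrier) → (∀ i → v i ≈ 0#) → sum v ≈ 0#
  sum-zero {zero}  v v≈0 = refl
  sum-zero {suc n} v v≈0 = trans (+-cong (v≈0 zero) (sum-zero (λ i → v (suc i)) (λ i → v≈0 (suc i)))) (+-identityˡ 0#)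

  sum-neg : ∀ {n} (v : Fin n → Carrier) → sum (λ i → - v i) ≈ - sum v
  sum-neg {zero}  v = sym -0#≈0#
  sum-neg {suc n} v = trans (+-congˡ (sum-neg (λ i → v (suc i))))
    (solve 2 (λ x y → :- x :+ :- y := :- (x :+ y)) refl (v zero) _)

module ExtensionProperties {K : Field} (E : Extension K) where
  open FieldProperties (Extension.top E) public
  open Extension E public using (ι; ι-cong; ι-+; ι-*; ι-0; ι-1; ι-neg)
  private
    module K = FieldProperties K

  ι-injective : ∀ {x y} → ι x ≈ ι y → x K.≈ y
  ι-injective {x} {y} ιx≈ιy with (x K.- y) K.≟ K.0#
  ... | yes p = K.x-y≈0⇒x≈y p
  ... | no  p = contradiction 1≈0 1≉0
    where
    open SetoidReasoning setoid
    z = x K.- y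
    1≈0 : 1# ≈ 0#
    1≈0 = begin
      1#                           ≈⟨ trans (ι-cong (K.recipʳ z p)) ι-1 ⟨
      ι (z K.* K.recip z p)        ≈⟨ ι-* _ _ ⟩
      ι z * ι (K.recip z p)        ≈⟨ *-congʳ (trans (ι-+ x (K.- y)) (trans (+-congˡ (ι-neg y)) (x≈y⇒x-y≈0 ιx≈ιy))) ⟩
      0# * ι (K.recip z p)         ≈⟨ zeroˡ _ ⟩
      0#                           ∎

  ι-sum : ∀ {n} (v : Fin n → K.Carrier) → ι (K.sum v) ≈ sum (λ i → ι (v i))
  ι-sum {zero}  v = ι-0
  ι-sum {suc n} v = trans (ι-+ _ _) (+-congˡ (ι-sum (λ i → v (suc i))))

module _ {K : Field} where

  infixl 9 _·_

  _·_ : {E F : Extension K} → Embedding E F → Extension.Carrier E → Extension.Carrier F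
  f · x = Embedding.⟦_⟧ f x

  infix 4 _≐_

  _≐_ : {E F : Extension K} → Embedding E F → Embedding E F → Set
  _≐_ {F = F} f g = ∀ x → Extension._≈_ F (f · x) (g · x)

  module _ (E F : Extension K) where
    private
      module E = ExtensionProperties E
      module F = ExtensionProperties F

    -- The laws for 0 and 1 follow from the one for constants of K, and compatibility with negation
    -- follows from additivity.
    mkEmbedding : (f : E.Carrier → F.Carrier) →
      (∀ {x y} → x E.≈ y → f x F.≈ f y) →
      (∀ x y → f (x E.+ y) F.≈ f x F.+ f y) →
      (∀ x y → f (x E.* y) F.≈ f x F.* f y) →
      (∀ k → f (E.ι k) F.≈ F.ι k) → Embedding E F
    mkEmbedding f f-cong f-+ f-* f-ι = record
      { hom = record
        { ⟦_⟧ = f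
        ; isRingHomomorphism = record
          { isSemiringHomomorphism = record
            { isNearSemiringHomomorphism = record
              { +-isMonoidHomomorphism = record
                { isMagmaHomomorphism = record
                  { isRelHomomorphism = record { cong = f-cong } ; homo = f-+ }
                ; ε-homo = f-0 }
              ; *-homo = f-* }
            ; 1#-homo = F.trans (f-cong (E.sym E.ι-1)) (F.trans (f-ι _) F.ι-1) }
          ; -‿homo = f-neg } }
      ; fixes = f-ι }
      where
      f-0 : f E.0# F.≈ F.0#
      f-0 = F.trans (f-cong (E.sym E.ι-0)) (F.trans (f-ι _) F.ι-0)
      f-neg : ∀ x → f (E.- x) F.≈ F.- f x
      f-neg x = F.x-y≈0⇒x≈y (begin
        f (E.- x) F.- F.- f x      ≈⟨ F.+-congˡ (F.-‿involutive (f x)) ⟩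
        f (E.- x) F.+ f x          ≈⟨ f-+ _ _ ⟨
        f (E.- x E.+ x)            ≈⟨ f-cong (E.-‿inverseˡ x) ⟩
        f E.0#                     ≈⟨ f-0 ⟩
        F.0#                       ∎)
        where open SetoidReasoning F.setoid

  module EmbeddingProperties {E F : Extension K} (f : Embedding E F) where
    private
      module E = ExtensionProperties E
      module F = ExtensionProperties F
    open Embedding f public using (fixes) renaming
      (⟦⟧-cong to cong; +-homo to +-hom; *-homo to *-hom; 0#-homo to 0-hom; 1#-homo to 1-hom; -‿homo to neg-hom)

    sub-hom : ∀ x y → f · (x E.- y) F.≈ f · x F.- f · y
    sub-hom x y = F.trans (+-hom _ _) (F.+-congˡ (neg-hom y))

    sum-hom : ∀ {n} (v : Fin n → E.Carrier) → f · E.sum v F.≈ F.sum (λ i → f · v i)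
    sum-hom {zero}  v = 0-hom
    sum-hom {suc n} v = F.trans (+-hom _ _) (F.+-congˡ (sum-hom (λ i → v (suc i))))

    scale-hom : ∀ k x → f · (E.ι k E.* x) F.≈ F.ι k F.* f · x
    scale-hom k x = F.trans (*-hom _ _) (F.*-congʳ (fixes k))

    combination-hom : ∀ {n} (c : Fin n → Field.Carrier K) (v : Fin n → E.Carrier) →
      f · E.sum (λ i → E.ι (c i) E.* v i) F.≈ F.sum (λ i → F.ι (c i) F.* f · v i)
    combination-hom c v = F.trans (sum-hom (λ i → E.ι (c i) E.* v i)) (F.sum-cong-≋ (λ i → scale-hom (c i) (v i)))

    injective-0 : ∀ {x} → f · x F.≈ F.0# → x E.≈ E.0#
    injective-0 {x} fx≈0 with x E.≟ E.0#
    ... | yes p = p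
    ... | no  p = contradiction (begin
        F.1#                          ≈⟨ F.trans (cong (E.recipʳ x p)) 1-hom ⟨
        f · (x E.* E.recip x p)       ≈⟨ *-hom _ _ ⟩
        f · x F.* f · E.recip x p     ≈⟨ F.trans (F.*-congʳ fx≈0) (F.zeroˡ _) ⟩
        F.0#                          ∎) F.1≉0
        where open SetoidReasoning F.setoid

    injective : ∀ {x y} → f · x F.≈ f · y → x E.≈ y
    injective {x} {y} fx≈fy = E.x-y≈0⇒x≈y (injective-0 (F.trans (sub-hom x y) (F.x≈y⇒x-y≈0 fx≈fy)))

  idₑ : {E : Extension K} → Embedding E E
  idₑ {E} = record { hom = Identity.ringHomomorphism E.ring ; fixes = λ _ → E.refl }
    where module E = Extension E

  infixr 8 _∘ₑ_

  _∘ₑ_ : {E F G : Extension K} → Embedding F G → Embedding E F → Embedding E G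
  _∘ₑ_ {E} {F} {G} g f = record
    { hom = Compose.ringHomomorphism {M₁ = Extension.ring E} {M₂ = Extension.ring F} {M₃ = Extension.ring G}
              (Embedding.hom f) (Embedding.hom g)
    ; fixes = λ k → Extension.trans G (Embedding.⟦⟧-cong g (Embedding.fixes f k)) (Embedding.fixes g k) }

Square : (F : Field) → Field.Carrier F → Set
Square F x = ∃ λ y → y * y ≈ x
  where open Field F

-- Quadratic extensions

module QuadraticExtension (F : Field) (d : Field.Carrier F) (d-nonsquare : ¬ Square F d) where
  open FieldProperties F

  -- The pair (x , y) stands for x + y√d.
  C² : Set
  C² = Carrier × Carrier

  infix 4 _≈²_
  _≈²_ : C² → C² → Set
  (x , y) ≈² (x′ , y′) = x ≈ x′ × y ≈ y′

  norm : C² → Carrier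
  norm (x , y) = x * x - d * (y * y)

  _+²_ _*²_ : C² → C² → C²
  (x , y) +² (x′ , y′) = x + x′ , y + y′
  (x , y) *² (x′ , y′) = x * x′ + d * (y * y′) , x * y′ + y * x′

  -²_ : C² → C²
  -² (x , y) = - x , - y

  abstract
    isCommutativeRing² : IsCommutativeRing _≈²_ _+²_ _*²_ -²_ (0# , 0#) (1# , 0#)
    isCommutativeRing² = record
        { isRing = record
          { +-isAbelianGroup = record
            { isGroup = record
              { isMonoid = record
                { isSemigroup = record
                  { isMagma = record
                    { isEquivalence = record
                      { refl = refl , refl
                      ; sym = λ (p , q) → sym p , sym q
                      ; trans = λ (p , q) (r , s) → trans p r , trans q s }
                    ; ∙-cong = λ (p , q) (r , s) → +-cong p r , +-cong q s }
                  ; assoc = λ _ _ _ → +-assoc _ _ _ , +-assoc _ _ _ }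
                ; identity = (λ _ → +-identityˡ _ , +-identityˡ _) , (λ _ → +-identityʳ _ , +-identityʳ _) }
              ; inverse = (λ _ → -‿inverseˡ _ , -‿inverseˡ _) , (λ _ → -‿inverseʳ _ , -‿inverseʳ _)
              ; ⁻¹-cong = λ (p , q) → -‿cong p , -‿cong q }
            ; comm = λ _ _ → +-comm _ _ , +-comm _ _ }
          ; *-cong = λ (p , q) (r , s) →
              +-cong (*-cong p r) (*-congˡ (*-cong q s)) , +-cong (*-cong p s) (*-cong q r)
          ; *-assoc = λ (x , y) (x′ , y′) (x″ , y″) →
              solve 7 (λ d x y x′ y′ x″ y″ →
                (x :* x′ :+ d :* (y :* y′)) :* x″ :+ d :* ((x :* y′ :+ y :* x′) :* y″) :=
                x :* (x′ :* x″ :+ d :* (y′ :* y″)) :+ d :* (y :* (x′ :* y″ :+ y′ :* x″)))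
                refl d x y x′ y′ x″ y″
            , solve 7 (λ d x y x′ y′ x″ y″ →
                (x :* x′ :+ d :* (y :* y′)) :* y″ :+ (x :* y′ :+ y :* x′) :* x″ :=
                x :* (x′ :* y″ :+ y′ :* x″) :+ y :* (x′ :* x″ :+ d :* (y′ :* y″)))
                refl d x y x′ y′ x″ y″
          ; *-identity = (λ (x , y) →
                trans (+-cong (*-identityˡ x) (trans (*-congˡ (zeroˡ y)) (zeroʳ d))) (+-identityʳ x)
              , trans (+-cong (*-identityˡ y) (zeroˡ x)) (+-identityʳ y))
            , (λ (x , y) →
                trans (+-cong (*-identityʳ x) (trans (*-congˡ (zeroʳ y)) (zeroʳ d))) (+-identityʳ x)
              , trans (+-cong (zeroʳ x) (*-identityʳ y)) (+-identityˡ y))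
          ; distrib = (λ (x , y) (x′ , y′) (x″ , y″) →
                solve 7 (λ d x y x′ y′ x″ y″ →
                  x :* (x′ :+ x″) :+ d :* (y :* (y′ :+ y″)) :=
                  (x :* x′ :+ d :* (y :* y′)) :+ (x :* x″ :+ d :* (y :* y″)))
                  refl d x y x′ y′ x″ y″
              , solve 6 (λ x y x′ y′ x″ y″ →
                  x :* (y′ :+ y″) :+ y :* (x′ :+ x″) :=
                  (x :* y′ :+ y :* x′) :+ (x :* y″ :+ y :* x″))
                  refl x y x′ y′ x″ y″)
            , (λ (x , y) (x′ , y′) (x″ , y″) →
                solve 7 (λ d x y x′ y′ x″ y″ →
                  (x′ :+ x″) :* x :+ d :* ((y′ :+ y″) :* y) :=
                  (x′ :* x :+ d :* (y′ :* y)) :+ (x″ :* x :+ d :* (y″ :* y)))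
                  refl d x y x′ y′ x″ y″
              , solve 6 (λ x y x′ y′ x″ y″ →
                  (x′ :+ x″) :* y :+ (y′ :+ y″) :* x :=
                  (x′ :* y :+ y′ :* x) :+ (x″ :* y :+ y″ :* x))
                  refl x y x′ y′ x″ y″)
          }
        ; *-comm = λ (x , y) (x′ , y′) →
            +-cong (*-comm x x′) (*-congˡ (*-comm y y′))
          , trans (+-comm _ _) (+-cong (*-comm y x′) (*-comm x y′))
        }

  ring² : CommutativeRing _ _
  ring² = record { isCommutativeRing = isCommutativeRing² }

  -- If x² = dy² with y ≠ 0, then x/y is a square root of d.
  norm-nonzero : ∀ z → ¬ z ≈² (0# , 0#) → ¬ norm z ≈ 0#
  norm-nonzero (x , y) z≉0 norm≈0 with y ≟ 0#
  ... | yes y≈0 = z≉0 (square-zero (trans (x-y≈0⇒x≈y norm≈0)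
                    (trans (*-congˡ (trans (*-congʳ y≈0) (zeroˡ y))) (zeroʳ d))) , y≈0)
  ... | no y≉0 = d-nonsquare (x * y⁻¹ , (begin
      (x * y⁻¹) * (x * y⁻¹)      ≈⟨ solve 2 (λ x y → (x :* y) :* (x :* y) := (x :* x) :* (y :* y)) refl x y⁻¹ ⟩
      (x * x) * (y⁻¹ * y⁻¹)      ≈⟨ *-congʳ (x-y≈0⇒x≈y norm≈0) ⟩
      (d * (y * y)) * (y⁻¹ * y⁻¹) ≈⟨ solve 3 (λ d y z → (d :* (y :* y)) :* (z :* z) := d :* ((y :* z) :* (y :* z))) refl d y y⁻¹ ⟩
      d * ((y * y⁻¹) * (y * y⁻¹)) ≈⟨ *-congˡ (trans (*-cong (recipʳ y y≉0) (recipʳ y y≉0)) (*-identityˡ 1#)) ⟩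
      d * 1#                     ≈⟨ *-identityʳ d ⟩
      d                          ∎))
    where
    open SetoidReasoning setoid
    y⁻¹ = recip y y≉0

  abstract
    inverse² : ∀ z → ¬ z ≈² (0# , 0#) → ∃ λ w → (z *² w) ≈² (1# , 0#)
    inverse² z@(x , y) z≉0 =
        let n⁻¹ = recip (norm z) (norm-nonzero z z≉0) in
        (x * n⁻¹ , - (y * n⁻¹))
        , trans (solve 4 (λ d x y n → x :* (x :* n) :+ d :* (y :* :- (y :* n)) := (x :* x :- d :* (y :* y)) :* n) refl d x y n⁻¹)
                (recipʳ (norm z) (norm-nonzero z z≉0))
        , solve 3 (λ x y n → x :* :- (y :* n) :+ y :* (x :* n) := con (ℤ.+ 0)) refl x y n⁻¹

  field² : Field
  field² = record
    { commutativeRing = ring²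
    ; 1≉0 = λ (p , _) → 1≉0 p
    ; inverse = inverse²
    ; _≟_ = λ (x , y) (x′ , y′) → (x ≟ x′) ×-dec (y ≟ y′)
    }

  extension² : Extension F
  extension² = record
    { top = field²
    ; base = record
      { ⟦_⟧ = λ x → x , 0#
      ; isRingHomomorphism = record
        { isSemiringHomomorphism = record
          { isNearSemiringHomomorphism = record
            { +-isMonoidHomomorphism = record
              { isMagmaHomomorphism = record
                { isRelHomomorphism = record { cong = λ p → p , refl }
                ; homo = λ _ _ → refl , sym (+-identityˡ 0#) }
              ; ε-homo = refl , refl }
            ; *-homo = λ x y → trans (sym (+-identityʳ _)) (+-congˡ (sym (trans (*-congˡ (zeroˡ 0#)) (zeroʳ d))))
                             , sym (trans (+-cong (zeroʳ x) (zeroˡ y)) (+-identityˡ 0#)) }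
          ; 1#-homo = refl , refl }
        ; -‿homo = λ _ → refl , sym -0#≈0# } } }

  private
    module E = ExtensionProperties extension²

  √d : C²
  √d = 0# , 1#

  √d² : √d E.* √d E.≈ E.ι d
  √d² = trans (+-cong (zeroˡ 0#) (trans (*-congˡ (*-identityˡ 1#)) (*-identityʳ d))) (+-identityˡ d)
      , trans (+-cong (zeroˡ 1#) (zeroʳ 1#)) (+-identityˡ 0#)

  a+b√d : ∀ x y → (x , y) E.≈ E.ι x E.+ E.ι y E.* √d
  a+b√d x y = trans (sym (+-identityʳ x)) (+-congˡ (sym (trans (+-cong (zeroʳ y) (trans (*-congˡ (zeroˡ 1#)) (zeroʳ d))) (+-identityʳ 0#))))
            , trans (sym (+-identityˡ y)) (+-congˡ (sym (trans (+-cong (*-identityʳ y) (zeroˡ 0#)) (+-identityʳ y))))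

  degree-2 : HasDegree extension² 2
  degree-2 = record
    { vec = λ { zero → E.1# ; (suc _) → √d }
    ; coord = λ { (x , y) zero → x ; (x , y) (suc _) → y }
    ; expand = λ (x , y) → E.trans (a+b√d x y) (E.+-cong (E.sym (E.*-identityʳ (E.ι x))) (E.sym (E.+-identityʳ _)))
    ; independent = λ c p →
        let (q , r) = E.trans (a+b√d (c zero) (c (suc zero))) (E.trans (E.+-cong (E.sym (E.*-identityʳ _)) (E.sym (E.+-identityʳ _))) p)
        in λ { zero → q ; (suc zero) → r }
    }

nonsquare⇒quadraticExtension : (F : Field) (d : Field.Carrier F) → ¬ Square F d → Σ (Extension F) λ E → HasDegree E 2
nonsquare⇒quadraticExtension F d d-nonsquare = extension² , degree-2
  where open QuadraticExtension F d d-nonsquare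

-- Sums of squares and the decidability of squares

data SumOfSquares (F : Field) : Field.Carrier F → Set where
  none : ∀ {x} → Field._≈_ F x (Field.0# F) → SumOfSquares F x
  more : ∀ {x s} a → SumOfSquares F s →
         Field._≈_ F x (Field._+_ F (Field._*_ F a a) s) → SumOfSquares F x

-- For a discrete field this amounts to -1 not being a sum of squares, since a nonzero a could be
-- divided out. The distinguished square is the entry whose vanishing is to be concluded.
FormallyReal : Field → Set
FormallyReal F = ∀ a {s} → SumOfSquares F s → a * a + s ≈ 0# → a ≈ 0#
  where open Field F

module FormallyRealProperties (F : Field) (real : FormallyReal F) where
  open FieldProperties F

  2≉0 : ¬ 1# + 1# ≈ 0#
  2≉0 2≈0 = 1≉0 (real 1# (more 1# (none refl) (trans (sym (*-identityˡ 1#)) (sym (+-identityʳ _))))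
                  (trans (+-congʳ (*-identityˡ 1#)) 2≈0))

  -1-nonsquare : ¬ Square F (- 1#)
  -1-nonsquare (y , yy≈-1) = 1≉0 (real 1# (more y (none refl) (sym (+-identityʳ _)))
    (trans (+-cong (*-identityˡ 1#) yy≈-1) (-‿inverseʳ 1#)))

Square-cong : (F : Field) → ∀ {x y} → Field._≈_ F x y → Square F x → Square F y
Square-cong F x≈y (r , p) = r , Field.trans F p x≈y

module SquareDecision (F : Field) (d : Field.Carrier F) (d-nonsquare : ¬ Square F d)
  (2≉0 : ¬ Field._≈_ F (Field._+_ F (Field.1# F) (Field.1# F)) (Field.0# F))
  (square? : ∀ x → Dec (Square F x)) where
  open FieldProperties F
  open QuadraticExtension F d d-nonsquare
  private
    module E = FieldProperties field²
  open SetoidReasoning setoid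

  private
    ½ : Carrier
    ½ = recip (1# + 1#) 2≉0

    ½+½ : ∀ x → (x + x) * ½ ≈ x
    ½+½ x = begin
      (x + x) * ½             ≈⟨ *-congʳ (+-cong (sym (*-identityʳ x)) (sym (*-identityʳ x))) ⟩
      (x * 1# + x * 1#) * ½   ≈⟨ solve 3 (λ x o h → (x :* o :+ x :* o) :* h := x :* ((o :+ o) :* h)) refl x 1# ½ ⟩
      x * ((1# + 1#) * ½)     ≈⟨ *-congˡ (recipʳ (1# + 1#) 2≉0) ⟩
      x * 1#                  ≈⟨ *-identityʳ x ⟩
      x                       ∎

    d≉0 : ¬ d ≈ 0#
    d≉0 d≈0 = d-nonsquare (0# , trans (zeroˡ 0#) (sym d≈0))

    double-zero : ∀ {x} → x + x ≈ 0# → x ≈ 0#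
    double-zero {x} p = trans (sym (½+½ x)) (trans (*-congʳ p) (zeroˡ ½))

    -- If (u + v√d)² = x lies in F, then 2uv = 0. With v = 0 the element x is a square in F; with u
    -- = 0 it is d times a square, so that xd is one.
    square-rational : ∀ x → Dec (Square field² (x , 0#))
    square-rational x with square? x | square? (x * d)
    ... | yes (u , uu≈x) | _ = yes ((u , 0#) , trans (+-cong uu≈x (trans (*-congˡ (zeroˡ 0#)) (zeroʳ d))) (+-identityʳ x)
                                              , trans (+-cong (zeroʳ u) (zeroˡ u)) (+-identityˡ 0#))
    -- From s² = xd the root of x is s/√d = (s/d)√d.
    ... | no _ | yes (s , ss≈xd) = yes ((0# , s * d⁻¹) , (begin
          0# * 0# + d * ((s * d⁻¹) * (s * d⁻¹))   ≈⟨ +-congʳ (zeroˡ 0#) ⟩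
          0# + d * ((s * d⁻¹) * (s * d⁻¹))        ≈⟨ +-identityˡ _ ⟩
          d * ((s * d⁻¹) * (s * d⁻¹))             ≈⟨ solve 3 (λ d s e → d :* ((s :* e) :* (s :* e)) := (s :* s) :* (e :* (d :* e))) refl d s d⁻¹ ⟩
          (s * s) * (d⁻¹ * (d * d⁻¹))             ≈⟨ *-cong ss≈xd (trans (*-congˡ (recipʳ d d≉0)) (*-identityʳ _)) ⟩
          (x * d) * d⁻¹                           ≈⟨ trans (*-assoc x d d⁻¹) (trans (*-congˡ (recipʳ d d≉0)) (*-identityʳ x)) ⟩
          x                                       ∎)
        , trans (+-cong (zeroˡ _) (zeroʳ _)) (+-identityˡ 0#))
      where d⁻¹ = recip d d≉0
    ... | no ¬x | no ¬xd = no λ ((u , v) , p , q) → neither u v p (zero-product (double-zero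
            (trans (+-congˡ (*-comm u v)) q)))
      where
      neither : ∀ u v → u * u + d * (v * v) ≈ x → u ≈ 0# ⊎ v ≈ 0# → _
      neither u v p (inj₂ v≈0) = ¬x (u , (begin
        u * u                      ≈⟨ +-identityʳ _ ⟨
        u * u + 0#                 ≈⟨ +-congˡ (trans (*-congˡ (trans (*-congʳ v≈0) (zeroˡ v))) (zeroʳ d)) ⟨
        u * u + d * (v * v)        ≈⟨ p ⟩
        x                          ∎))
      neither u v p (inj₁ u≈0) = ¬xd (d * v , (begin
        (d * v) * (d * v)          ≈⟨ solve 2 (λ d v → (d :* v) :* (d :* v) := (d :* (v :* v)) :* d) refl d v ⟩
        (d * (v * v)) * d          ≈⟨ *-congʳ (+-identityˡ _) ⟨
        (0# + d * (v * v)) * d     ≈⟨ *-congʳ (+-congʳ (trans (*-congʳ u≈0) (zeroˡ u))) ⟨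
        (u * u + d * (v * v)) * d  ≈⟨ *-congʳ p ⟩
        x * d                      ∎))

    -- A root u + v√d of x + y√d satisfies u² = (x + n)/2 with n² = x² - dy² and then v = y/(2u).
    from-half : ∀ x y n → ¬ y ≈ 0# → n * n ≈ norm (x , y) →
      Square F ((x + n) * ½) → Square field² (x , y)
    from-half x y n y≉0 nn≈ (u , uu≈) = (u , v) , first , second
      where
      2uu≈ : u * u + u * u ≈ x + n
      2uu≈ = begin
        u * u + u * u                    ≈⟨ +-cong uu≈ uu≈ ⟩
        (x + n) * ½ + (x + n) * ½        ≈⟨ distribʳ ½ (x + n) (x + n) ⟨
        ((x + n) + (x + n)) * ½          ≈⟨ ½+½ (x + n) ⟩
        x + n                            ∎
      u≉0 : ¬ u ≈ 0#
      -- A vanishing u would give x + n = 0, hence dy² = (x + n)(x - n) = 0.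
      u≉0 u≈0 = *-nonzero d≉0 (y≉0 ∘ square-zero) (begin
        d * (y * y)                      ≈⟨ solve 3 (λ d x y → d :* (y :* y) := x :* x :- (x :* x :- d :* (y :* y))) refl d x y ⟩
        x * x - norm (x , y)             ≈⟨ +-congˡ (-‿cong nn≈) ⟨
        x * x - n * n                    ≈⟨ solve 2 (λ x n → x :* x :- n :* n := (x :+ n) :* (x :- n)) refl x n ⟩
        (x + n) * (x - n)                ≈⟨ *-congʳ (trans (sym 2uu≈) (trans (+-cong uu≈0 uu≈0) (+-identityˡ 0#))) ⟩
        0# * (x - n)                     ≈⟨ zeroˡ _ ⟩
        0#                               ∎)
        where
        uu≈0 : u * u ≈ 0#
        uu≈0 = trans (*-congʳ u≈0) (zeroˡ u)
      2u≉0 : ¬ u + u ≈ 0#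
      2u≉0 = u≉0 ∘ double-zero
      w = recip (u + u) 2u≉0
      v = y * w
      second : u * v + v * u ≈ y
      second = begin
        u * (y * w) + (y * w) * u        ≈⟨ solve 3 (λ u y w → u :* (y :* w) :+ (y :* w) :* u := y :* ((u :+ u) :* w)) refl u y w ⟩
        y * ((u + u) * w)                ≈⟨ *-congˡ (recipʳ (u + u) 2u≉0) ⟩
        y * 1#                           ≈⟨ *-identityʳ y ⟩
        y                                ∎
      dvv≈ : d * (v * v) + d * (v * v) ≈ x - n
      -- Multiplied by 2u² = x + n, the claim becomes d(2uv)² = dy² = x² - n².
      dvv≈ = *-cancelˡ (u≉0 ∘ square-zero ∘ double-zero) (begin
        (u * u + u * u) * (d * (v * v) + d * (v * v))   ≈⟨ solve 3 (λ u d v → (u :* u :+ u :* u) :* (d :* (v :* v) :+ d :* (v :* v)) := d :* ((u :* v :+ v :* u) :* (u :* v :+ v :* u))) refl u d v ⟩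
        d * ((u * v + v * u) * (u * v + v * u))         ≈⟨ *-congˡ (*-cong second second) ⟩
        d * (y * y)                                     ≈⟨ solve 3 (λ d x y → d :* (y :* y) := x :* x :- (x :* x :- d :* (y :* y))) refl d x y ⟩
        x * x - norm (x , y)                            ≈⟨ +-congˡ (-‿cong nn≈) ⟨
        x * x - n * n                                   ≈⟨ solve 2 (λ x n → x :* x :- n :* n := (x :+ n) :* (x :- n)) refl x n ⟩
        (x + n) * (x - n)                               ≈⟨ *-congʳ 2uu≈ ⟨
        (u * u + u * u) * (x - n)                       ∎)
      first : u * u + d * (v * v) ≈ x
      first = begin
        u * u + d * (v * v)                                               ≈⟨ ½+½ _ ⟨
        ((u * u + d * (v * v)) + (u * u + d * (v * v))) * ½               ≈⟨ *-congʳ (solve 2 (λ a b → (a :+ b) :+ (a :+ b) := (a :+ a) :+ (b :+ b)) refl (u * u) (d * (v * v))) ⟩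
        ((u * u + u * u) + (d * (v * v) + d * (v * v))) * ½               ≈⟨ *-congʳ (+-cong 2uu≈ dvv≈) ⟩
        ((x + n) + (x - n)) * ½                                           ≈⟨ *-congʳ (solve 2 (λ x n → (x :+ n) :+ (x :- n) := x :+ x) refl x n) ⟩
        (x + x) * ½                                                       ≈⟨ ½+½ x ⟩
        x                                                                 ∎

    -- The norm m of a root u + v√d satisfies m² = norm (x , y) = n², so n = ±m, while u² = (x +
    -- m)/2.
    to-half : ∀ x y n → n * n ≈ norm (x , y) → Square field² (x , y) →
      Square F ((x + n) * ½) ⊎ Square F ((x + - n) * ½)
    to-half x y n nn≈ ((u , v) , p , q) = [ (λ n-m≈0 → inj₁ (u , same n-m≈0)) , (λ n+m≈0 → inj₂ (u , opposite n+m≈0)) ]′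
      (zero-product {n - m} {n + m} (begin
        (n - m) * (n + m)                ≈⟨ solve 2 (λ n m → (n :- m) :* (n :+ m) := n :* n :- m :* m) refl n m ⟩
        n * n - m * m                    ≈⟨ +-cong nn≈ (-‿cong mm≈) ⟩
        norm (x , y) - norm (x , y)      ≈⟨ -‿inverseʳ _ ⟩
        0#                               ∎))
      where
      m = u * u - d * (v * v)
      mm≈ : m * m ≈ norm (x , y)
      mm≈ = begin
        m * m   ≈⟨ solve 3 (λ u d v → (u :* u :- d :* (v :* v)) :* (u :* u :- d :* (v :* v)) :=
                     (u :* u :+ d :* (v :* v)) :* (u :* u :+ d :* (v :* v)) :- d :* ((u :* v :+ v :* u) :* (u :* v :+ v :* u)))
                     refl u d v ⟩
        norm (u * u + d * (v * v) , u * v + v * u)   ≈⟨ +-cong (*-cong p p) (-‿cong (*-congˡ (*-cong q q))) ⟩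
        norm (x , y)                                 ∎
      uu≈ : u * u ≈ (x + m) * ½
      uu≈ = begin
        u * u                                        ≈⟨ ½+½ _ ⟨
        (u * u + u * u) * ½                          ≈⟨ *-congʳ (solve 2 (λ a b → a :+ a := (a :+ b) :+ (a :- b)) refl (u * u) (d * (v * v))) ⟩
        ((u * u + d * (v * v)) + m) * ½              ≈⟨ *-congʳ (+-congʳ p) ⟩
        (x + m) * ½                                  ∎
      same : n - m ≈ 0# → u * u ≈ (x + n) * ½
      same n-m≈0 = trans uu≈ (*-congʳ (+-congˡ (sym (x-y≈0⇒x≈y n-m≈0))))
      opposite : n + m ≈ 0# → u * u ≈ (x + - n) * ½
      opposite n+m≈0 = trans uu≈ (*-congʳ (+-congˡ (begin
        m                ≈⟨ solve 2 (λ n m → m := (n :+ m) :- n) refl n m ⟩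
        (n + m) - n      ≈⟨ trans (+-congʳ n+m≈0) (+-identityˡ _) ⟩
        - n              ∎)))

  -- The norm of a square is a square, so a nonsquare norm excludes a root. Otherwise the norm has
  -- the two roots ±n, and either sign may be the norm of the root sought; both halves are therefore
  -- tested.
  square²? : ∀ z → Dec (Square field² z)
  square²? (x , y) with y ≟ 0#
  ... | yes y≈0 = map′ (Square-cong field² (refl , sym y≈0)) (Square-cong field² (refl , y≈0)) (square-rational x)
  ... | no y≉0 with square? (norm (x , y))
  ...   | no ¬n = no λ ((u , v) , p , q) → ¬n (u * u - d * (v * v) , (begin
            (u * u - d * (v * v)) * (u * u - d * (v * v))
              ≈⟨ solve 3 (λ u d v → (u :* u :- d :* (v :* v)) :* (u :* u :- d :* (v :* v)) :=
                   (u :* u :+ d :* (v :* v)) :* (u :* u :+ d :* (v :* v)) :- d :* ((u :* v :+ v :* u) :* (u :* v :+ v :* u)))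
                   refl u d v ⟩
            norm (u * u + d * (v * v) , u * v + v * u)   ≈⟨ +-cong (*-cong p p) (-‿cong (*-congˡ (*-cong q q))) ⟩
            norm (x , y)                                 ∎))
  ...   | yes (n , nn≈) with square? ((x + n) * ½) | square? ((x + - n) * ½)
  ...     | yes s | _     = yes (from-half x y n y≉0 nn≈ s)
  ...     | no _  | yes s = yes (from-half x y (- n) y≉0
                              (trans (solve 1 (λ n → :- n :* :- n := n :* n) refl n) nn≈) s)
  ...     | no ¬s | no ¬t = no λ z → [ ¬s , ¬t ]′ (to-half x y n nn≈ z)

module PythagoreanStep (F : Field) (real : FormallyReal F) (c d : Field.Carrier F)
  (d≈1+c² : Field._≈_ F d (Field._+_ F (Field.1# F) (Field._*_ F c c))) (d-nonsquare : ¬ Square F d) where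
  open FieldProperties F
  open QuadraticExtension F d d-nonsquare
  open SetoidReasoning setoid

  private
    -- As d = 1 + c², the rational part u² + dv² of a square is a sum of three squares of F. This is
    -- why roots of elements of this shape can be adjoined without losing formal reality.
    expand-first : ∀ u v s → (u * u + d * (v * v)) + s ≈ u * u + (v * v + ((c * v) * (c * v) + s))
    expand-first u v s = begin
      (u * u + d * (v * v)) + s                   ≈⟨ +-congʳ (+-congˡ (*-congʳ d≈1+c²)) ⟩
      (u * u + (1# + c * c) * (v * v)) + s        ≈⟨ +-congʳ (+-congˡ (trans (distribʳ _ _ _) (+-congʳ (*-identityˡ _)))) ⟩
      (u * u + (v * v + (c * c) * (v * v))) + s   ≈⟨ solve 4 (λ u v c s → (u :* u :+ (v :* v :+ (c :* c) :* (v :* v))) :+ s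
                                                       := u :* u :+ (v :* v :+ ((c :* v) :* (c :* v) :+ s))) refl u v c s ⟩
      u * u + (v * v + ((c * v) * (c * v) + s))   ∎

    first-component : ∀ {z} → SumOfSquares field² z → SumOfSquares F (proj₁ z)
    first-component (none (p , _)) = none p
    first-component (more {s = s , _} (u , v) sos (p , _)) =
      more u (more v (more (c * v) (first-component sos) refl) refl) (trans p (expand-first u v s))

  -- The rational part of the relation reads u² + v² + (cv)² + s = 0 with s a sum of squares in F.
  -- Rearranging it puts either u or v in front.
  formallyReal² : FormallyReal field²
  formallyReal² (u , v) {s , _} sos (p , _) =
      real u (more v (more (c * v) s-sos refl) refl) sum≈0
    , real v (more (c * v) (more u s-sos refl) refl)
        (trans (solve 4 (λ u v w s → v :* v :+ (w :* w :+ (u :* u :+ s)) := u :* u :+ (v :* v :+ (w :* w :+ s))) refl u v (c * v) s) sum≈0)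
    where
    s-sos : SumOfSquares F s
    s-sos = first-component sos
    sum≈0 : u * u + (v * v + ((c * v) * (c * v) + s)) ≈ 0#
    sum≈0 = trans (sym (expand-first u v s)) p

-- The rational numbers

ℚ-square-nonneg : ∀ p → 0ℚ ℚ.≤ p ℚ.* p
ℚ-square-nonneg p with ℚₚ.≤-total 0ℚ p
... | inj₁ 0≤p = ≡.subst (ℚ._≤ p ℚ.* p) (ℚₚ.*-zeroˡ p) (ℚₚ.*-monoʳ-≤-nonNeg p {{ℚ.nonNegative 0≤p}} 0≤p)
... | inj₂ p≤0 = ≡.subst (ℚ._≤ p ℚ.* p) (ℚₚ.*-zeroˡ p) (ℚₚ.*-monoʳ-≤-nonPos p {{ℚ.nonPositive p≤0}} p≤0)

ℚ-sumOfSquares-nonneg : ∀ {s} → SumOfSquares ℚ-field s → 0ℚ ℚ.≤ s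
ℚ-sumOfSquares-nonneg (none ≡.refl)       = ℚₚ.≤-refl
ℚ-sumOfSquares-nonneg (more a sos ≡.refl) = ℚₚ.+-mono-≤ (ℚ-square-nonneg a) (ℚ-sumOfSquares-nonneg sos)

ℚ-formallyReal : FormallyReal ℚ-field
ℚ-formallyReal a {s} sos aa+s≡0 = FieldProperties.square-zero ℚ-field
  (ℚₚ.≤-antisym aa≤0 (ℚ-square-nonneg a))
  where
  aa≤0 : a ℚ.* a ℚ.≤ 0ℚ
  aa≤0 = ≡.subst₂ ℚ._≤_ (ℚₚ.+-identityʳ _) aa+s≡0 (ℚₚ.+-monoʳ-≤ (a ℚ.* a) (ℚ-sumOfSquares-nonneg sos))

cross-multiply : ∀ q {a b} → toℚᵘ q ℚᵘ.≃ mkℚᵘ a b → ↥ q ℤ.* + suc b ≡ a ℤ.* ↧ q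
cross-multiply (mkℚ _ _ _) (*≡* eq) = eq

-- u/v with coprime u, v is a root of n/D only if v ∣ D and u ∣ n, since n v² = u² D.
ℚ-square? : ∀ q → Dec (Square ℚ-field q)
ℚ-square? q with q ℚ.≟ 0ℚ
... | yes ≡.refl = yes (0ℚ , ≡.refl)
... | no q≢0 = map′ (λ (i , j , p) → candidate i j , p) bounded
    (Finₚ.any? (λ i → Finₚ.any? (λ j → candidate i j ℚ.* candidate i j ℚ.≟ q)))
  where
  n D : ℕ
  n = ℤ.∣ ↥ q ∣
  D = ↧ₙ q

  -- A rational number and its absolute value have the same square, so nonnegative numerators
  -- suffice. The index of a denominator is one less than the denominator, which therefore runs
  -- through 1, ..., D.
  candidate : Fin (suc n) → Fin D → ℚ
  candidate i j = (+ toℕ i) ℚ./ suc (toℕ j)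

  cross : ∀ r → r ℚ.* r ≡ q → n ℕ.* (↧ₙ r ℕ.* ↧ₙ r) ≡ (ℤ.∣ ↥ r ∣ ℕ.* ℤ.∣ ↥ r ∣) ℕ.* D
  cross r@(mkℚ u v _) rr≡q = ≡.trans (≡.sym (ℤₚ.abs-* (↥ q) (+ (suc v ℕ.* suc v))))
    (≡.trans (≡.cong ℤ.∣_∣ (cross-multiply q (ℚᵘₚ.≃-trans (ℚᵘₚ.≃-reflexive (≡.cong toℚᵘ (≡.sym rr≡q))) (ℚₚ.toℚᵘ-homo-* r r))))
    (≡.trans (ℤₚ.abs-* (u ℤ.* u) (↧ q)) (≡.cong (ℕ._* D) (ℤₚ.abs-* u u))))

  bounded : Square ℚ-field q → ∃ λ i → ∃ λ j → candidate i j ℚ.* candidate i j ≡ q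
  bounded (r@(mkℚ num v c) , rr≡q) = i , j , ≡.trans (≡.cong₂ ℚ._*_ candidate≡ candidate≡)
      (≡.trans (≡.sym (ℚₚ.∣p*q∣≡∣p∣*∣q∣ r r)) (≡.trans (ℚₚ.0≤p⇒∣p∣≡p (ℚ-square-nonneg r)) rr≡q))
    where
    u = ℤ.∣ num ∣
    u⊥v : Coprime u (suc v)
    u⊥v = Coprimality.recompute c
    eq : n ℕ.* (suc v ℕ.* suc v) ≡ (u ℕ.* u) ℕ.* D
    eq = cross r rr≡q
    v∣D : suc v ∣ D
    v∣D = Coprimality.coprime-divisor (Coprimality.sym u⊥v) (Coprimality.coprime-divisor (Coprimality.sym u⊥v)
      (divides (n ℕ.* suc v) (≡.trans (≡.sym (ℕₚ.*-assoc u u D)) (≡.trans (≡.sym eq) (≡.sym (ℕₚ.*-assoc n (suc v) (suc v)))))))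
    u∣n : u ∣ n
    u∣n = Coprimality.coprime-divisor u⊥v (Coprimality.coprime-divisor u⊥v
      (divides (u ℕ.* D) (≡.trans (≡.trans (≡.trans (≡.sym (ℕₚ.*-assoc (suc v) (suc v) n)) (ℕₚ.*-comm _ n)) eq)
        (≡.trans (ℕₚ.*-assoc u u D) (ℕₚ.*-comm u (u ℕ.* D))))))
    n≢0 : n ≢ 0
    n≢0 n≡0 = q≢0 (ℚₚ.↥p≡0⇒p≡0 q (ℤₚ.∣i∣≡0⇒i≡0 n≡0))
    u≤n : u ≤ n
    u≤n = ∣⇒≤ {{ℕ.≢-nonZero n≢0}} u∣n
    i : Fin (suc n)
    i = fromℕ< (s≤s u≤n)
    j : Fin D
    j = fromℕ< (∣⇒≤ v∣D)
    candidate≡ : candidate i j ≡ ℚ.∣ r ∣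
    candidate≡ = ≡.trans (≡.cong₂ (λ a b → (+ a) ℚ./ suc b) (Finₚ.toℕ-fromℕ< (s≤s u≤n)) (Finₚ.toℕ-fromℕ< (∣⇒≤ v∣D)))
      (ℚₚ.↥p/↧p≡p ℚ.∣ r ∣)

-- Exhausting a field by finite lists

-- These lists schedule the construction of the Pythagorean closure: step k treats the k-th list of
-- the k-th field. Having 0 in every list makes x ↦ (x , 0) carry the n-th list of a field into the
-- n-th list of pairs over it.
record Exhaustion (F : Field) : Set where
  open Field F using (Carrier; _≈_; 0#)
  field
    size      : ℕ → ℕ
    element   : ∀ n → Fin (size n) → Carrier

  infix 4 _∈ₙ_
  _∈ₙ_ : Carrier → ℕ → Set
  x ∈ₙ n = ∃ λ i → element n i ≈ x

  field
    contains-0 : ∀ n → 0# ∈ₙ n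
    exhausts   : ∀ x → ∃ λ m → ∀ n → m ≤ n → x ∈ₙ n

-- The n-th list consists of the fractions (a - b)/(d + 1) with a, b, d ≤ n; the difference reaches
-- both signs.
ℚ-exhaustion : Exhaustion ℚ-field
ℚ-exhaustion = record
  { size = λ n → suc n ℕ.* (suc n ℕ.* suc n)
  ; element = element
  ; contains-0 = λ n → index n 0 0 0 z≤n z≤n z≤n , ≡.trans (element-index n 0 0 0 z≤n z≤n z≤n) ≡.refl
  ; exhausts = λ { q@(mkℚ (+ a) d _) → a ℕ.+ d , λ n m≤n →
                     let a≤ = ℕₚ.≤-trans (ℕₚ.m≤m+n a d) m≤n ; d≤ = ℕₚ.≤-trans (ℕₚ.m≤n+m d a) m≤n in
                     index n a 0 d a≤ z≤n d≤ , ≡.trans (element-index n a 0 d a≤ z≤n d≤) (ℚₚ.↥p/↧p≡p q)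
                 ; q@(mkℚ -[1+ b ] d _) → suc b ℕ.+ d , λ n m≤n →
                     let b≤ = ℕₚ.≤-trans (ℕₚ.m≤m+n (suc b) d) m≤n ; d≤ = ℕₚ.≤-trans (ℕₚ.m≤n+m d (suc b)) m≤n in
                     index n 0 (suc b) d z≤n b≤ d≤ , ≡.trans (element-index n 0 (suc b) d z≤n b≤ d≤) (ℚₚ.↥p/↧p≡p q) }
  }
  where
  value : ℕ × ℕ × ℕ → ℚ
  value (a , b , d) = (a ℤ.⊖ b) ℚ./ suc d

  inner : ∀ n → Fin (suc n) → Fin (suc n) × Fin (suc n) → ℕ × ℕ × ℕ
  inner n a (b , d) = toℕ a , toℕ b , toℕ d

  outer : ∀ n → Fin (suc n) × Fin (suc n ℕ.* suc n) → ℕ × ℕ × ℕ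
  outer n (a , bd) = inner n a (remQuot {suc n} (suc n) bd)

  element : ∀ n → Fin (suc n ℕ.* (suc n ℕ.* suc n)) → ℚ
  element n i = value (outer n (remQuot {suc n} (suc n ℕ.* suc n) i))

  index : ∀ n a b d → a ≤ n → b ≤ n → d ≤ n → Fin (suc n ℕ.* (suc n ℕ.* suc n))
  index n a b d a≤n b≤n d≤n = combine (fromℕ< (s≤s a≤n)) (combine (fromℕ< (s≤s b≤n)) (fromℕ< (s≤s d≤n)))

  element-index : ∀ n a b d a≤n b≤n d≤n → element n (index n a b d a≤n b≤n d≤n) ≡ value (a , b , d)
  element-index n a b d a≤n b≤n d≤n = ≡.cong value
    (≡.trans (≡.cong (outer n) (Finₚ.remQuot-combine A (combine B D)))
    (≡.trans (≡.cong (inner n A) (Finₚ.remQuot-combine B D))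
      (≡.cong₂ _,_ (Finₚ.toℕ-fromℕ< (s≤s a≤n)) (≡.cong₂ _,_ (Finₚ.toℕ-fromℕ< (s≤s b≤n)) (Finₚ.toℕ-fromℕ< (s≤s d≤n))))))
    where
    A = fromℕ< (s≤s a≤n)
    B = fromℕ< (s≤s b≤n)
    D = fromℕ< (s≤s d≤n)

-- Spanning families and independence of characters

++-suc : ∀ {A : Set} {m n} (xs : Vector A (suc m)) (ys : Vector A n) i → (xs ++ ys) (suc i) ≡ (tail xs ++ ys) i
++-suc {m = m} xs ys i with splitAt m i
... | inj₁ _ = ≡.refl
... | inj₂ _ = ≡.refl

module SumProperties (F : Field) where
  open FieldProperties F

  sum-++ : ∀ {A : Set} (h : A → Carrier) {m n} (xs : Vector A m) (ys : Vector A n) →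
    sum (λ i → h ((xs ++ ys) i)) ≈ sum (λ i → h (xs i)) + sum (λ i → h (ys i))
  sum-++ h {zero}  xs ys = sym (+-identityˡ _)
  sum-++ h {suc m} xs ys = trans (+-congˡ (trans
      (sum-cong-≋ (λ i → reflexive (≡.cong h (++-suc xs ys i)))) (sum-++ h (tail xs) ys)))
    (sym (+-assoc _ _ _))

module _ {K : Field} where

  -- Weaker than a basis: coordinates need be neither unique nor compatible with equality. This
  -- passes easily to subspaces and quadratic extensions, and Gram-Schmidt recovers a basis where a
  -- degree is wanted.
  record Spanning (E : Extension K) : Set where
    open ExtensionProperties E
    field
      {size}  : ℕ
      vec     : Fin size → Carrier
      coord   : Carrier → Fin size → Field.Carrier K
      expand  : ∀ x → x ≈ sum (λ k → ι (coord x k) * vec k)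

  basis⇒spanning : ∀ {E : Extension K} → Finite E → Spanning E
  basis⇒spanning (_ , b) = record { vec = Basis.vec b ; coord = Basis.coord b ; expand = Basis.expand b }

  module _ {E F : Extension K} where
    private
      module F = ExtensionProperties F

    ≐-on-spanning : (s : Spanning E) (f g : Embedding E F) →
      (∀ k → f · Spanning.vec s k F.≈ g · Spanning.vec s k) → f ≐ g
    ≐-on-spanning s f g f≈g x = begin
      f · x                                             ≈⟨ f.cong (expand x) ⟩
      f · _                                             ≈⟨ f.combination-hom (coord x) vec ⟩
      F.sum (λ k → F.ι (coord x k) F.* f · vec k)       ≈⟨ F.sum-cong-≋ (λ k → F.*-congˡ (f≈g k)) ⟩
      F.sum (λ k → F.ι (coord x k) F.* g · vec k)       ≈⟨ g.combination-hom (coord x) vec ⟨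
      g · _                                             ≈⟨ g.cong (expand x) ⟨
      g · x                                             ∎
      where
      open Spanning s
      open SetoidReasoning F.setoid
      module f = EmbeddingProperties f
      module g = EmbeddingProperties g

    ≐-dec : Spanning E → (f g : Embedding E F) → Dec (f ≐ g)
    ≐-dec s f g = map′ (≐-on-spanning s f g) (λ f≐g k → f≐g (Spanning.vec s k))
      (Finₚ.all? (λ k → (f · Spanning.vec s k) F.≟ (g · Spanning.vec s k)))

  -- Dedekind's independence of characters, for families with repetitions:
  -- the coefficients of equal characters add up to zero.
  module Dedekind (E M : Extension K) where
    private
      module E = ExtensionProperties E
    open ExtensionProperties M
    open SetoidReasoning setoid

    independence : ∀ {n} (χ : Fin n → Embedding E M) (a b : Fin n → Carrier) →
      (∀ x → sum (λ j → a j * χ j · x) ≈ 0#) →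
      (∀ j k → χ j ≐ χ k → b j ≈ b k) →
      sum (λ j → a j * b j) ≈ 0#
    independence {zero}  χ a b relation b-resp = refl
    -- If the sum s were nonzero, `eigen` would make s χᵢ(y) independent of i. All characters would
    -- then coincide and b would be constant, so the relation at 1 would give s = 0 after all.
    independence {suc n} χ a b relation b-resp with sum (λ j → a j * b j) ≟ 0#
    ... | yes s≈0 = s≈0
    ... | no  s≉0 = begin
        s                                   ≈⟨ sum-cong-≋ (λ j → *-congˡ {x = a j} (b-resp j zero (equal j zero))) ⟩
        sum (λ j → a j * b zero)            ≈⟨ *-distribʳ-sum (b zero) a ⟨
        sum a * b zero                      ≈⟨ *-congʳ (sum-cong-≋ (λ j → trans (*-congˡ (Embedding.1#-homo (χ j))) (*-identityʳ (a j)))) ⟨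
        sum (λ j → a j * χ j · E.1#) * b zero   ≈⟨ trans (*-congʳ (relation E.1#)) (zeroˡ _) ⟩
        0#                                  ∎
      where
      s = sum (λ j → a j * b j)

      difference : ∀ (c : Fin (suc n) → Carrier) i y →
        sum (λ j → (a j * (χ j · y - χ i · y)) * c j) ≈
        sum (λ j → a j * (c j * χ j · y)) - χ i · y * sum (λ j → a j * c j)
      difference c i y = begin
        sum (λ j → (a j * (χ j · y - χ i · y)) * c j)
          ≈⟨ sum-cong-≋ (λ j → solve 4 (λ a x z c → (a :* (x :- z)) :* c := a :* (c :* x) :+ (:- z) :* (a :* c)) refl (a j) (χ j · y) (χ i · y) (c j)) ⟩
        sum (λ j → a j * (c j * χ j · y) + (- χ i · y) * (a j * c j))
          ≈⟨ ∑-distrib-+ (λ j → a j * (c j * χ j · y)) (λ j → (- χ i · y) * (a j * c j)) ⟩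
        sum (λ j → a j * (c j * χ j · y)) + sum (λ j → (- χ i · y) * (a j * c j))
          ≈⟨ +-congˡ (sym (*-distribˡ-sum (- χ i · y) (λ j → a j * c j))) ⟩
        sum (λ j → a j * (c j * χ j · y)) + (- χ i · y) * sum (λ j → a j * c j)
          ≈⟨ +-congˡ (solve 2 (λ z s → (:- z) :* s := :- (z :* s)) refl (χ i · y) _) ⟩
        sum (λ j → a j * (c j * χ j · y)) - χ i · y * sum (λ j → a j * c j) ∎

      -- The i-th coefficient of the relation Σ a_j (χ_j y - χ_i y) χ_j = 0 vanishes.
      remove : ∀ i (c : Fin (suc n) → Carrier) y →
        sum (λ j → (a j * (χ j · y - χ i · y)) * c j) ≈
        sum (λ j → (a (punchIn i j) * (χ (punchIn i j) · y - χ i · y)) * c (punchIn i j))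
      remove i c y = begin
        sum t                          ≈⟨ sum-remove {i = i} t ⟩
        t i + sum (removeAt t i)       ≈⟨ +-congʳ (trans (*-congʳ (trans (*-congˡ (-‿inverseʳ _)) (zeroʳ _))) (zeroˡ _)) ⟩
        0# + sum (removeAt t i)        ≈⟨ +-identityˡ _ ⟩
        sum (removeAt t i)             ∎
        where
        t : Fin (suc n) → Carrier
        t j = (a j * (χ j · y - χ i · y)) * c j

      -- Subtracting χᵢ(y) times the relation at x from the relation at xy removes χᵢ; the induction
      -- hypothesis applies to the n characters that remain.
      eigen : ∀ i y → sum (λ j → a j * (b j * χ j · y)) ≈ s * χ i · y
      eigen i y = trans (x-y≈0⇒x≈y (begin
        sum (λ j → a j * (b j * χ j · y)) - χ i · y * s    ≈⟨ difference b i y ⟨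
        sum (λ j → (a j * (χ j · y - χ i · y)) * b j)      ≈⟨ remove i b y ⟩
        sum (λ j → (a (punchIn i j) * (χ (punchIn i j) · y - χ i · y)) * b (punchIn i j))
          ≈⟨ independence (χ ∘ punchIn i) (λ j → a (punchIn i j) * (χ (punchIn i j) · y - χ i · y)) (b ∘ punchIn i)
               relation′ (λ j k → b-resp (punchIn i j) (punchIn i k)) ⟩
        0# ∎)) (*-comm _ _)
        where
        relation′ : ∀ x → sum (λ j → (a (punchIn i j) * (χ (punchIn i j) · y - χ i · y)) * χ (punchIn i j) · x) ≈ 0#
        relation′ x = begin
          sum (λ j → (a (punchIn i j) * (χ (punchIn i j) · y - χ i · y)) * χ (punchIn i j) · x) ≈⟨ remove i (λ j → χ j · x) y ⟨
          sum (λ j → (a j * (χ j · y - χ i · y)) * χ j · x)        ≈⟨ difference (λ j → χ j · x) i y ⟩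
          sum (λ j → a j * (χ j · x * χ j · y)) - χ i · y * sum (λ j → a j * χ j · x)
            ≈⟨ +-cong (sum-cong-≋ (λ j → *-congˡ {x = a j} (sym (Embedding.*-homo (χ j) x y)))) (-‿cong (*-congˡ (relation x))) ⟩
          sum (λ j → a j * χ j · (x E.* y)) - χ i · y * 0#         ≈⟨ +-cong (relation (x E.* y)) (trans (-‿cong (zeroʳ _)) -0#≈0#) ⟩
          0# + 0#                                                  ≈⟨ +-identityˡ 0# ⟩
          0#                                                       ∎

      equal : ∀ i j → χ i ≐ χ j
      equal i j y = *-cancelˡ s≉0 (trans (sym (eigen i y)) (eigen j y))

-- Trace forms of families of embeddings

-- A stand-in for the list of all embeddings, in which repetitions are allowed. The index set is
-- nonempty because anisotropy needs at least one injective member.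
record Family {K : Field} (P Ω : Extension K) : Set where
  private
    module P = ExtensionProperties P
    module Ω = ExtensionProperties Ω
  field
    size     : ℕ
    map      : Fin (suc size) → Embedding P Ω
    trace    : P.Carrier → Field.Carrier K
    sum-map  : ∀ x → Ω.sum (λ j → map j · x) Ω.≈ Ω.ι (trace x)

module FamilyProperties {K : Field} {P Ω : Extension K} (real : FormallyReal (Extension.top Ω)) (family : Family P Ω) where
  private
    module K = FieldProperties K
    module P = ExtensionProperties P
  open ExtensionProperties Ω
  open Family family
  open SetoidReasoning setoid

  trace-cong : ∀ {x y} → x P.≈ y → trace x K.≈ trace y
  trace-cong {x} {y} x≈y = ι-injective (begin
    ι (trace x)                ≈⟨ sum-map x ⟨
    sum (λ j → map j · x)      ≈⟨ sum-cong-≋ (λ j → Embedding.⟦⟧-cong (map j) x≈y) ⟩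
    sum (λ j → map j · y)      ≈⟨ sum-map y ⟩
    ι (trace y)                ∎)

  trace-+ : ∀ x y → trace (x P.+ y) K.≈ trace x K.+ trace y
  trace-+ x y = ι-injective (begin
    ι (trace (x P.+ y))                              ≈⟨ sum-map (x P.+ y) ⟨
    sum (λ j → map j · (x P.+ y))                    ≈⟨ sum-cong-≋ (λ j → Embedding.+-homo (map j) x y) ⟩
    sum (λ j → map j · x + map j · y)                ≈⟨ ∑-distrib-+ (λ j → map j · x) (λ j → map j · y) ⟩
    sum (λ j → map j · x) + sum (λ j → map j · y)    ≈⟨ +-cong (sum-map x) (sum-map y) ⟩
    ι (trace x) + ι (trace y)                        ≈⟨ ι-+ _ _ ⟨
    ι (trace x K.+ trace y)                          ∎)

  trace-scale : ∀ k x → trace (P.ι k P.* x) K.≈ k K.* trace x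
  trace-scale k x = ι-injective (begin
    ι (trace (P.ι k P.* x))                ≈⟨ sum-map (P.ι k P.* x) ⟨
    sum (λ j → map j · (P.ι k P.* x))      ≈⟨ sum-cong-≋ (λ j → EmbeddingProperties.scale-hom (map j) k x) ⟩
    sum (λ j → ι k * map j · x)            ≈⟨ *-distribˡ-sum (ι k) (λ j → map j · x) ⟨
    ι k * sum (λ j → map j · x)            ≈⟨ *-congˡ (sum-map x) ⟩
    ι k * ι (trace x)                      ≈⟨ ι-* _ _ ⟨
    ι (k K.* trace x)                      ∎)

  -- The trace of x² is Σ f_j(x)², a sum of squares in a formally real field, so f₀(x) = 0, and f₀
  -- is injective.
  trace-anisotropic : ∀ {x} → trace (x P.* x) K.≈ K.0# → x P.≈ P.0#
  trace-anisotropic {x} t≡0 = EmbeddingProperties.injective-0 (map zero) (real (map zero · x)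
    (squares (λ j → map (suc j) · x))
    (begin
      sum (λ j → map j · x * map j · x)    ≈⟨ sum-cong-≋ (λ j → sym (Embedding.*-homo (map j) x x)) ⟩
      sum (λ j → map j · (x P.* x))        ≈⟨ sum-map (x P.* x) ⟩
      ι (trace (x P.* x))                  ≈⟨ trans (ι-cong t≡0) ι-0 ⟩
      0#                                   ∎))
    where
    squares : ∀ {n} (v : Fin n → Carrier) → SumOfSquares (Extension.top Ω) (sum (λ j → v j * v j))
    squares {zero}  v = none refl
    squares {suc n} v = more (v zero) (squares (v ∘ suc)) refl

  module TraceForm {E : Extension K} (i : Embedding E P) where
    private
      module E = ExtensionProperties E
      module i = EmbeddingProperties i

    form : E.Carrier → E.Carrier → K.Carrier
    form x y = trace (i · x P.* i · y)

    form-cong : ∀ {x x′ y y′} → x E.≈ x′ → y E.≈ y′ → form x y K.≈ form x′ y′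
    form-cong p q = trace-cong (P.*-cong (i.cong p) (i.cong q))

    form-sym : ∀ x y → form x y K.≈ form y x
    form-sym x y = trace-cong (P.*-comm (i · x) (i · y))

    form-+ : ∀ x y z → form (x E.+ y) z K.≈ form x z K.+ form y z
    form-+ x y z = K.trans (trace-cong (P.trans (P.*-congʳ (i.+-hom x y)) (P.distribʳ _ _ _))) (trace-+ _ _)

    form-scale : ∀ k x y → form (E.ι k E.* x) y K.≈ k K.* form x y
    form-scale k x y = K.trans (trace-cong (P.trans (P.*-congʳ (i.scale-hom k x)) (P.*-assoc _ _ _))) (trace-scale k _)

    form-0 : ∀ y → form E.0# y K.≈ K.0#
    form-0 y = K.trans (form-cong (E.sym (E.trans (E.*-congʳ E.ι-0) (E.zeroˡ E.0#))) E.refl)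
      (K.trans (form-scale K.0# E.0# y) (K.zeroˡ _))

    form-sum : ∀ {n} (c : Fin n → K.Carrier) (v : Fin n → E.Carrier) y →
      form (E.sum (λ k → E.ι (c k) E.* v k)) y K.≈ K.sum (λ k → c k K.* form (v k) y)
    form-sum {zero}  c v y = form-0 y
    form-sum {suc n} c v y = K.trans (form-+ _ _ y) (K.+-cong (form-scale _ _ y) (form-sum (c ∘ suc) (v ∘ suc) y))

    form-anisotropic : ∀ {x} → form x x K.≈ K.0# → x E.≈ E.0#
    form-anisotropic = i.injective-0 ∘ trace-anisotropic

    project : ∀ {r} → (Fin r → E.Carrier) → (Fin r → K.Carrier) → E.Carrier → E.Carrier
    project u μ x = E.sum (λ k → E.ι (μ k K.* form x (u k)) E.* u k)

    -- An orthogonal family, with μ k the inverse of the norm of u k. Orthogonality is recorded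
    -- through its consequence `stable`: a vector and its projection have the same product with
    -- every u k.
    record Frame (r : ℕ) : Set where
      field
        u           : Fin r → E.Carrier
        μ           : Fin r → K.Carrier
        stable      : ∀ x k → form (project u μ x) (u k) K.≈ form x (u k)
        independent : ∀ (c : Fin r → K.Carrier) → E.sum (λ k → E.ι (c k) E.* u k) E.≈ E.0# → ∀ k → c k K.≈ K.0#

    module _ {r} (u : Fin r → E.Carrier) (μ : Fin r → K.Carrier) where

      project-cong : ∀ {x y} → x E.≈ y → project u μ x E.≈ project u μ y
      project-cong x≈y = E.sum-cong-≋ (λ k → E.*-congʳ (E.ι-cong (K.*-congˡ {x = μ k} (form-cong x≈y E.refl))))

      project-+ : ∀ x y → project u μ (x E.+ y) E.≈ project u μ x E.+ project u μ y
      project-+ x y = E.trans (E.sum-cong-≋ (λ k → E.trans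
          (E.*-congʳ (E.trans (E.ι-cong (K.trans (K.*-congˡ {x = μ k} (form-+ x y (u k))) (K.distribˡ (μ k) _ _))) (E.ι-+ _ _)))
          (E.distribʳ _ _ _)))
        (E.∑-distrib-+ (λ k → E.ι (μ k K.* form x (u k)) E.* u k) (λ k → E.ι (μ k K.* form y (u k)) E.* u k))

      project-scale : ∀ q x → project u μ (E.ι q E.* x) E.≈ E.ι q E.* project u μ x
      project-scale q x = E.trans (E.sum-cong-≋ (λ k → E.trans
          (E.*-congʳ (E.trans (E.ι-cong (K.trans (K.*-congˡ {x = μ k} (form-scale q x (u k)))
            (K.solve 3 (λ m q f → m K.:* (q K.:* f) K.:= q K.:* (m K.:* f)) K.refl (μ k) q _))) (E.ι-* _ _)))
          (E.*-assoc _ _ _)))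
        (E.sym (E.*-distribˡ-sum (E.ι q) (λ k → E.ι (μ k K.* form x (u k)) E.* u k)))

      project-sum : ∀ {n} (c : Fin n → K.Carrier) (v : Fin n → E.Carrier) →
        project u μ (E.sum (λ k → E.ι (c k) E.* v k)) E.≈ E.sum (λ k → E.ι (c k) E.* project u μ (v k))
      project-sum {zero}  c v = E.trans (E.sum-cong-≋ {x = λ k → E.ι (μ k K.* form E.0# (u k)) E.* u k} (λ k → E.trans
          (E.*-congʳ (E.trans (E.ι-cong (K.trans (K.*-congˡ {x = μ k} (form-0 (u k))) (K.zeroʳ (μ k)))) E.ι-0)) (E.zeroˡ _)))
        (E.sum-zero (λ (k : Fin r) → E.0#) (λ _ → E.refl))
      project-sum {suc n} c v = E.trans (project-+ _ _) (E.+-cong (project-scale _ _) (project-sum (c ∘ suc) (v ∘ suc)))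

    -- Decidable equality tells whether the residue z of a new vector vanishes. If it does, the
    -- vector is already reproduced by its projection; if not, anisotropy makes the norm of z
    -- invertible and z joins the frame.
    gramSchmidt : ∀ {m} (v : Fin m → E.Carrier) →
      ∃ λ r → Σ (Frame r) λ B → ∀ k → project (Frame.u B) (Frame.μ B) (v k) E.≈ v k
    gramSchmidt {zero} v = 0 , record { u = λ () ; μ = λ () ; stable = λ _ () ; independent = λ _ _ () } , λ ()
    gramSchmidt {suc m} v with gramSchmidt (v ∘ suc)
    ... | r , B , fixes with (v zero E.- project (Frame.u B) (Frame.μ B) (v zero)) E.≟ E.0#
    ... | yes z≈0 = r , B , λ { zero → E.sym (E.x-y≈0⇒x≈y z≈0) ; (suc k) → fixes k }
    ... | no  z≉0 = suc r , B′ , fixes′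
      where
      open Frame B
      p = project u μ
      z = v zero E.- p (v zero)

      form-z : ∀ k → form z (u k) K.≈ K.0#
      form-z k = K.trans (form-+ _ _ _) (K.trans (K.+-cong (K.sym (stable (v zero) k))
          (K.trans (form-cong (E.trans (E.sym (E.-1*x≈-x _)) (E.*-congʳ (E.trans (E.-‿cong (E.sym E.ι-1)) (E.sym (E.ι-neg _))))) E.refl)
            (K.trans (form-scale (K.- K.1#) _ _) (K.-1*x≈-x _))))
        (K.-‿inverseʳ _))

      form-project-z : ∀ x → form (p x) z K.≈ K.0#
      form-project-z x = K.trans (form-sum _ u z) (K.sum-zero _ (λ k →
        K.trans (K.*-congˡ {x = μ k K.* form x (u k)} (K.trans (form-sym (u k) z) (form-z k))) (K.zeroʳ _)))

      ν : K.Carrier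
      ν = K.recip (form z z) (z≉0 ∘ form-anisotropic)

      form-νz : ∀ q → form (E.ι (ν K.* q) E.* z) z K.≈ q
      form-νz q = K.trans (form-scale _ z z) (K.trans
        (K.solve 3 (λ n q f → (n K.:* q) K.:* f K.:= q K.:* (f K.:* n)) K.refl ν q (form z z))
        (K.trans (K.*-congˡ {x = q} (K.recipʳ (form z z) (z≉0 ∘ form-anisotropic))) (K.*-identityʳ q)))

      form-νz-u : ∀ q k → form (E.ι (ν K.* q) E.* z) (u k) K.≈ K.0#
      form-νz-u q k = K.trans (form-scale _ z _) (K.trans (K.*-congˡ {x = ν K.* q} (form-z k)) (K.zeroʳ _))

      B′ : Frame (suc r)
      B′ = record
        { u = z ∷ u
        ; μ = ν ∷ μ
        ; stable = λ
          { x zero → K.trans (form-+ _ _ z) (K.trans (K.+-cong (form-νz (form x z)) (form-project-z x)) (K.+-identityʳ _))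
          ; x (suc k) → K.trans (form-+ _ _ (u k)) (K.trans (K.+-cong (form-νz-u (form x z) k) (stable x k)) (K.+-identityˡ _)) }
        ; independent = λ c relation →
            let c₀≡0 : c zero K.≈ K.0#
                c₀≡0 = K.cancel (z≉0 ∘ form-anisotropic) (K.trans (K.*-comm _ _) (K.trans (K.sym (K.trans (form-sum c (z ∷ u) z)
                  (K.trans (K.+-congˡ {x = c zero K.* form z z} (K.sum-zero _ (λ k → K.trans (K.*-congˡ {x = c (suc k)} (K.trans (form-sym (u k) z) (form-z k))) (K.zeroʳ _))))
                    (K.+-identityʳ _)))) (K.trans (form-cong relation E.refl) (form-0 z))))
            in λ { zero → c₀≡0
                 ; (suc k) → independent (c ∘ suc) (E.trans (E.sym (E.+-identityˡ _))
                     (E.trans (E.+-congʳ (E.sym (E.trans (E.*-congʳ (E.trans (E.ι-cong c₀≡0) E.ι-0)) (E.zeroˡ z)))) relation)) k }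
        }

      fixes′ : ∀ k → project (z ∷ u) (ν ∷ μ) (v k) E.≈ v k
      fixes′ zero = E.trans (E.+-congʳ (E.trans (E.*-congʳ (E.ι-cong (K.trans (K.*-congˡ {x = ν} form-v₀) (K.trans (K.*-comm _ _) (K.recipʳ (form z z) (z≉0 ∘ form-anisotropic))))))
          (E.trans (E.*-congʳ E.ι-1) (E.*-identityˡ z))))
        (E.solve 2 (λ v q → (v E.:- q) E.:+ q E.:= v) E.refl (v zero) (p (v zero)))
        where
        form-v₀ : form (v zero) z K.≈ form z z
        form-v₀ = K.trans (form-cong (E.solve 2 (λ v q → v E.:= (v E.:- q) E.:+ q) E.refl (v zero) (p (v zero))) E.refl)
          (K.trans (form-+ _ _ z) (K.trans (K.+-congˡ {x = form z z} (form-project-z (v zero))) (K.+-identityʳ _)))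
      fixes′ (suc k) = E.trans (E.+-congʳ (E.trans (E.*-congʳ (E.trans (E.ι-cong (K.trans (K.*-congˡ {x = ν} form-v≡0) (K.zeroʳ ν))) E.ι-0)) (E.zeroˡ z)))
        (E.trans (E.+-identityˡ _) (fixes k))
        where
        form-v≡0 : form (v (suc k)) z K.≈ K.0#
        form-v≡0 = K.trans (form-cong (E.sym (fixes k)) E.refl) (form-project-z (v (suc k)))

    abstract
      orthogonalize : ∀ {m} (v : Fin m → E.Carrier) →
        ∃ λ r → Σ (Frame r) λ B → ∀ k → project (Frame.u B) (Frame.μ B) (v k) E.≈ v k
      orthogonalize = gramSchmidt

    module Reproducing (s : Spanning E) where
      private
        gs = orthogonalize (Spanning.vec s)
        B = proj₁ (proj₂ gs)
      rank : ℕ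
      rank = proj₁ gs
      open Frame B public

      reconstruct : ∀ x → project u μ x E.≈ x
      reconstruct x = E.trans (project-cong u μ (Spanning.expand s x)) (E.trans (project-sum u μ (coord x) vec)
        (E.trans (E.sum-cong-≋ (λ k → E.*-congˡ (proj₂ (proj₂ gs) k))) (E.sym (Spanning.expand s x))))
        where open Spanning s using (coord; vec)

      basis : HasDegree E rank
      basis = record
        { vec = u
        ; coord = λ x k → μ k K.* form x (u k)
        ; expand = λ x → E.sym (reconstruct x)
        ; independent = independent }

      -- The orthogonal projection of P onto E for the form trace (xy): the formula of `project`
      -- with an arbitrary y of P in place of i · x.
      extended : P.Carrier → E.Carrier
      extended y = E.sum (λ k → E.ι (μ k K.* trace (y P.* i · u k)) E.* u k)

      kernel : (g : Embedding E Ω) → Fin (suc size) → Carrier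
      kernel g j = sum (λ k → (ι (μ k) * map j · (i · u k)) * g · u k)

      -- Writing each trace as Σ f_j and exchanging the sums exhibits g ∘ extended as a combination
      -- of the f_j with coefficients independent of y. On the image of E, where `extended` inverts
      -- i, this expresses g through the f_j ∘ i and so prepares Dedekind's theorem.
      extended-kernel : (g : Embedding E Ω) → ∀ y → g · extended y ≈ sum (λ j → kernel g j * map j · y)
      extended-kernel g y = begin
        g · extended y
          ≈⟨ EmbeddingProperties.combination-hom g (λ k → μ k K.* trace (y P.* i · u k)) u ⟩
        sum (λ k → ι (μ k K.* trace (y P.* i · u k)) * g · u k)
          ≈⟨ sum-cong-≋ term ⟩
        sum (λ k → sum (λ j → ((ι (μ k) * map j · (i · u k)) * g · u k) * map j · y))
          ≈⟨ ∑-comm (λ k j → ((ι (μ k) * map j · (i · u k)) * g · u k) * map j · y) ⟩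
        sum (λ j → sum (λ k → ((ι (μ k) * map j · (i · u k)) * g · u k) * map j · y))
          ≈⟨ sum-cong-≋ (λ j → *-distribʳ-sum (map j · y) (λ k → (ι (μ k) * map j · (i · u k)) * g · u k)) ⟨
        sum (λ j → kernel g j * map j · y) ∎
        where
        term : ∀ k → ι (μ k K.* trace (y P.* i · u k)) * g · u k ≈
                     sum (λ j → ((ι (μ k) * map j · (i · u k)) * g · u k) * map j · y)
        term k = begin
          ι (μ k K.* trace (y P.* i · u k)) * g · u k
            ≈⟨ *-congʳ (trans (ι-* _ _) (*-congˡ (sym (sum-map _)))) ⟩
          (ι (μ k) * sum (λ j → map j · (y P.* i · u k))) * g · u k
            ≈⟨ *-congʳ (*-distribˡ-sum (ι (μ k)) (λ j → map j · (y P.* i · u k))) ⟩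
          sum (λ j → ι (μ k) * map j · (y P.* i · u k)) * g · u k
            ≈⟨ *-distribʳ-sum (g · u k) (λ j → ι (μ k) * map j · (y P.* i · u k)) ⟩
          sum (λ j → (ι (μ k) * map j · (y P.* i · u k)) * g · u k)
            ≈⟨ sum-cong-≋ (λ j → trans (*-congʳ (*-congˡ (Embedding.*-homo (map j) y (i · u k))))
                 (solve 4 (λ m y u g → (m :* (y :* u)) :* g := ((m :* u) :* g) :* y) refl (ι (μ k)) (map j · y) (map j · (i · u k)) (g · u k))) ⟩
          sum (λ j → ((ι (μ k) * map j · (i · u k)) * g · u k) * map j · y) ∎

      image-kernel : (g : Embedding E Ω) → ∀ x → g · x ≈ sum (λ j → kernel g j * map j · (i · x))
      image-kernel g x = trans (Embedding.⟦⟧-cong g (E.sym (reconstruct x))) (extended-kernel g (i · x))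

      kernel-relation : (g : Embedding E Ω) → ∀ x →
        sum (λ j → ((- 1#) ∷ kernel g) j * (g ∷ (λ j → map j ∘ₑ i)) j · x) ≈ 0#
      kernel-relation g x = trans (+-cong (-1*x≈-x _) (sym (image-kernel g x))) (-‿inverseˡ _)

    -- Otherwise Dedekind makes the coefficient -1 of g in the kernel relation vanish.
    extends′ : Spanning E → (g : Embedding E Ω) → ∃ λ j → g ≐ map j ∘ₑ i
    extends′ s g with Finₚ.any? (λ j → ≐-dec s g (map j ∘ₑ i))
    ... | yes found = found
    ... | no ¬found = contradiction
          (trans (sym (-‿involutive 1#)) (trans (-‿cong (begin
            - 1#                                                ≈⟨ *-identityʳ _ ⟨
            - 1# * 1#                                           ≈⟨ +-identityʳ _ ⟨
            - 1# * 1# + 0#                                      ≈⟨ +-congˡ (sum-zero _ (λ j → zeroʳ (kernel g j))) ⟨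
            - 1# * 1# + sum (λ j → kernel g j * 0#)             ≈⟨ Dedekind.independence E Ω (g ∷ (λ j → map j ∘ₑ i)) ((- 1#) ∷ kernel g)
                                                                     (1# ∷ (λ _ → 0#)) (kernel-relation g) respects ⟩
            0#                                                  ∎)) -0#≈0#)) 1≉0
      where
      open Reproducing s
      respects : ∀ j k → (g ∷ (λ j → map j ∘ₑ i)) j ≐ (g ∷ (λ j → map j ∘ₑ i)) k →
        (1# ∷ (λ _ → 0#)) j ≈ (1# ∷ (λ _ → 0#)) k
      respects zero    zero    _ = refl
      respects zero    (suc k) p = contradiction (k , p) ¬found
      respects (suc j) zero    p = contradiction (j , λ x → sym (p x)) ¬found
      respects (suc j) (suc k) _ = refl

    abstract
      extends : Spanning E → (g : Embedding E Ω) → ∃ λ j → g ≐ map j ∘ₑ i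
      extends = extends′

-- Subspaces cut out by linear conditions, and subfields

module SubSpaces {K : Field} (M : Extension K) where
  private
    module K = FieldProperties K
  open ExtensionProperties M
  open SetoidReasoning setoid

  record IsSubspace (P : Carrier → Set) : Set where
    field
      respects  : ∀ {x y} → x ≈ y → P x → P y
      add    : ∀ {x y} → P x → P y → P (x + y)
      scale  : ∀ k {x} → P x → P (ι k * x)

  record SpansSub (P : Carrier → Set) : Set where
    field
      isSubspace  : IsSubspace P
      {size}      : ℕ
      vec         : Fin size → Carrier
      vec∈        : ∀ k → P (vec k)
      coord       : ∀ x → P x → Fin size → K.Carrier
      expand      : ∀ x p → x ≈ sum (λ k → ι (coord x p k) * vec k)
    open IsSubspace isSubspace public

  spansSub-⇔ : ∀ {P P′} → (∀ x → P x → P′ x) → (∀ x → P′ x → P x) → SpansSub P → SpansSub P′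
  spansSub-⇔ to from s = record
    { isSubspace = record
      { respects = λ x≈y p → to _ (respects x≈y (from _ p))
      ; add   = λ p q → to _ (add (from _ p) (from _ q))
      ; scale = λ k p → to _ (scale k (from _ p)) }
    ; vec = vec
    ; vec∈ = λ k → to _ (vec∈ k)
    ; coord = λ x p → coord x (from x p)
    ; expand = λ x p → expand x (from x p) }
    where open SpansSub s

  record Functional : Set where
    field
      φ        : Carrier → K.Carrier
      φ-cong   : ∀ {x y} → x ≈ y → φ x K.≈ φ y
      φ-+      : ∀ x y → φ (x + y) K.≈ φ x K.+ φ y
      φ-scale  : ∀ k x → φ (ι k * x) K.≈ k K.* φ x

    φ-0 : φ 0# K.≈ K.0#
    φ-0 = K.trans (φ-cong (sym (trans (*-congʳ ι-0) (zeroˡ 0#)))) (K.trans (φ-scale K.0# 0#) (K.zeroˡ _))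

    φ-sum : ∀ {n} (c : Fin n → K.Carrier) (v : Fin n → Carrier) →
      φ (sum (λ k → ι (c k) * v k)) K.≈ K.sum (λ k → c k K.* φ (v k))
    φ-sum {zero}  c v = φ-0
    φ-sum {suc n} c v = K.trans (φ-+ _ _) (K.+-cong (φ-scale _ _) (φ-sum (c ∘ suc) (v ∘ suc)))

  -- A condition that can be imposed on any subspace with a known spanning family so that the result
  -- again has one. Quantifying over P lets finitely many conditions be imposed one after another.
  Cut : (Carrier → Set) → Set₁
  Cut R = ∀ {P} → SpansSub P → SpansSub (λ x → P x × R x)

  cut-⇔ : ∀ {R R′} → (∀ x → R x → R′ x) → (∀ x → R′ x → R x) → Cut R → Cut R′
  cut-⇔ to from cut s = spansSub-⇔ (λ x (p , r) → p , to x r) (λ x (p , r) → p , from x r) (cut s)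

  cut-trivial : ∀ {R} → (∀ x → R x) → Cut R
  cut-trivial r s = spansSub-⇔ (λ x p → p , r x) (λ x (p , _) → p) s

  cut-all : ∀ {n} {R : Fin n → Carrier → Set} → (∀ i → Cut (R i)) → Cut (λ x → ∀ i → R i x)
  cut-all {zero}  cuts s = cut-trivial (λ x ()) s
  cut-all {suc n} {R} cuts s = spansSub-⇔
    (λ x ((p , r₀) , r) → p , λ { zero → r₀ ; (suc i) → r i })
    (λ x (p , r) → (p , r zero) , r ∘ suc)
    (cut-all {R = λ i → R (suc i)} (cuts ∘ suc) (cuts zero s))

  module Kernel (f : Functional) {P : Carrier → Set} (s : SpansSub P) where
    open SpansSub s
    open Functional f

    subspace : IsSubspace (λ x → P x × φ x K.≈ K.0#)
    subspace = record
      { respects = λ x≈y (p , q) → respects x≈y p , K.trans (φ-cong (sym x≈y)) q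
      ; add   = λ (p , q) (p′ , q′) → add p p′ , K.trans (φ-+ _ _) (K.trans (K.+-cong q q′) (K.+-identityˡ _))
      ; scale = λ k (p , q) → scale k p , K.trans (φ-scale k _) (K.trans (K.*-congˡ q) (K.zeroʳ k)) }

  -- With a pivot p such that φ(p) ≠ 0, each v is replaced by v - (φ(v)/φ(p)) p; the pivot itself
  -- becomes 0 and the size does not change. A vector x of the kernel keeps its coordinates, because
  -- the corrections add up to -(φ(x)/φ(p)) p = 0.
  cut-functional : (f : Functional) → Cut (λ x → Functional.φ f x K.≈ K.0#)
  cut-functional f {P} s with Finₚ.any? (λ k → ¬? (Functional.φ f (SpansSub.vec s k) K.≟ K.0#))
  ... | no none-nonzero = record
    { isSubspace = subspace
    ; vec = vec
    ; vec∈ = λ k → vec∈ k , vanishes k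
    ; coord = λ x (p , _) → coord x p
    ; expand = λ x (p , _) → expand x p }
    where
    open SpansSub s
    open Functional f
    open Kernel f s using (subspace)
    vanishes : ∀ k → φ (vec k) K.≈ K.0#
    vanishes k with φ (vec k) K.≟ K.0#
    ... | yes p = p
    ... | no ¬p = contradiction (k , ¬p) none-nonzero
  ... | yes (pivot , φp≉0) = record
    { isSubspace = subspace
    ; vec = w
    ; vec∈ = λ k → add (vec∈ k) (scale _ (vec∈ pivot)) , φw k
    ; coord = λ x (p , _) → coord x p
    ; expand = λ x (p , φx≈0) → begin
        x                                                    ≈⟨ expand x p ⟩
        sum (λ k → ι (coord x p k) * vec k)                  ≈⟨ +-identityʳ _ ⟨
        sum (λ k → ι (coord x p k) * vec k) + 0#             ≈⟨ +-congˡ (trans (*-congʳ (trans (ι-cong (correction x p φx≈0)) ι-0)) (zeroˡ _)) ⟨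
        sum (λ k → ι (coord x p k) * vec k) + ι (K.sum (λ k → coord x p k K.* ratio k)) * vec pivot
          ≈⟨ +-congˡ (trans (*-congʳ (trans (ι-sum (λ k → coord x p k K.* ratio k)) (sum-cong-≋ (λ k → ι-* (coord x p k) (ratio k)))))
               (*-distribʳ-sum (vec pivot) (λ k → ι (coord x p k) * ι (ratio k)))) ⟩
        sum (λ k → ι (coord x p k) * vec k) + sum (λ k → (ι (coord x p k) * ι (ratio k)) * vec pivot)
          ≈⟨ ∑-distrib-+ (λ k → ι (coord x p k) * vec k) (λ k → (ι (coord x p k) * ι (ratio k)) * vec pivot) ⟨
        sum (λ k → ι (coord x p k) * vec k + (ι (coord x p k) * ι (ratio k)) * vec pivot)
          ≈⟨ sum-cong-≋ (λ k → solve 4 (λ c v r p → c :* v :+ (c :* r) :* p := c :* (v :+ r :* p)) refl (ι (coord x p k)) (vec k) (ι (ratio k)) (vec pivot)) ⟩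
        sum (λ k → ι (coord x p k) * w k)                    ∎ }
    where
    open SpansSub s
    open Functional f
    open Kernel f s using (subspace)
    π⁻¹ = K.recip (φ (vec pivot)) φp≉0
    ratio : Fin size → K.Carrier
    ratio k = K.- (φ (vec k) K.* π⁻¹)
    w : Fin size → Carrier
    w k = vec k + ι (ratio k) * vec pivot
    φw : ∀ k → φ (w k) K.≈ K.0#
    φw k = K.trans (φ-+ _ _) (K.trans (K.+-congˡ (K.trans (φ-scale _ _)
        (K.trans (K.solve 3 (λ a b c → (K.:- (a K.:* b)) K.:* c K.:= K.:- (a K.:* (c K.:* b))) K.refl (φ (vec k)) π⁻¹ (φ (vec pivot)))
          (K.-‿cong (K.trans (K.*-congˡ (K.recipʳ _ φp≉0)) (K.*-identityʳ _))))))
      (K.-‿inverseʳ _))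
    correction : ∀ x p → φ x K.≈ K.0# → K.sum (λ k → coord x p k K.* ratio k) K.≈ K.0#
    correction x p φx≈0 = K.trans (K.sum-cong-≋ (λ k → K.solve 3 (λ c a b → c K.:* (K.:- (a K.:* b)) K.:= (c K.:* a) K.:* (K.:- b)) K.refl (coord x p k) (φ (vec k)) π⁻¹))
      (K.trans (K.sym (K.*-distribʳ-sum (K.- π⁻¹) (λ k → coord x p k K.* φ (vec k))))
        (K.trans (K.*-congʳ (K.trans (K.sym (φ-sum (coord x p) vec)) (K.trans (φ-cong (sym (expand x p))) φx≈0))) (K.zeroˡ _)))

  everything : Spanning M → SpansSub (λ _ → ⊤)
  everything s = record
    { isSubspace = record { respects = λ _ _ → tt ; add = λ _ _ → tt ; scale = λ _ _ → tt }
    ; vec = vec ; vec∈ = λ _ → tt ; coord = λ x _ → coord x ; expand = λ x _ → expand x }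
    where open Spanning s

module Subfield {K : Field} (M : Extension K) (P : Extension.Carrier M → Set)
  (P-resp : ∀ {x y} → Extension._≈_ M x y → P x → P y)
  (P-+ : ∀ {x y} → P x → P y → P (Extension._+_ M x y))
  (P-* : ∀ {x y} → P x → P y → P (Extension._*_ M x y))
  (P-recip : ∀ {x y} → Extension._≈_ M (Extension._*_ M x y) (Extension.1# M) → P x → P y)
  (P-ι : ∀ k → P (Extension.ι M k)) where
  private
    module K = Field K
  open ExtensionProperties M

  P-neg : ∀ {x} → P x → P (- x)
  P-neg p = P-resp (trans (*-congʳ (trans (ι-neg K.1#) (-‿cong ι-1))) (-1*x≈-x _)) (P-* (P-ι (K.- K.1#)) p)

  private
    _≈ₚ_ : Σ Carrier P → Σ Carrier P → Set
    (x , _) ≈ₚ (y , _) = x ≈ y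

    _+ₚ_ _*ₚ_ : Σ Carrier P → Σ Carrier P → Σ Carrier P
    (x , p) +ₚ (y , q) = x + y , P-+ p q
    (x , p) *ₚ (y , q) = x * y , P-* p q

    -ₚ_ : Σ Carrier P → Σ Carrier P
    -ₚ (x , p) = - x , P-neg p

    0ₚ 1ₚ : Σ Carrier P
    0ₚ = 0# , P-resp ι-0 (P-ι K.0#)
    1ₚ = 1# , P-resp ι-1 (P-ι K.1#)

  abstract
    isCommutativeSubring : IsCommutativeRing _≈ₚ_ _+ₚ_ _*ₚ_ -ₚ_ 0ₚ 1ₚ
    isCommutativeSubring = record
        { isRing = record
          { +-isAbelianGroup = record
            { isGroup = record
              { isMonoid = record
                { isSemigroup = record
                  { isMagma = record
                    { isEquivalence = record { refl = refl ; sym = sym ; trans = trans }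
                    ; ∙-cong = +-cong }
                  ; assoc = λ _ _ _ → +-assoc _ _ _ }
                ; identity = (λ _ → +-identityˡ _) , (λ _ → +-identityʳ _) }
              ; inverse = (λ _ → -‿inverseˡ _) , (λ _ → -‿inverseʳ _)
              ; ⁻¹-cong = -‿cong }
            ; comm = λ _ _ → +-comm _ _ }
          ; *-cong = *-cong
          ; *-assoc = λ _ _ _ → *-assoc _ _ _
          ; *-identity = (λ _ → *-identityˡ _) , (λ _ → *-identityʳ _)
          ; distrib = (λ _ _ _ → distribˡ _ _ _) , (λ _ _ _ → distribʳ _ _ _) }
        ; *-comm = λ _ _ → *-comm _ _ }

  subring : CommutativeRing 0ℓ 0ℓ
  subring = record { isCommutativeRing = isCommutativeSubring }

  subfield : Extension K
  subfield = record
    { top = record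
      { commutativeRing = subring
      ; 1≉0 = 1≉0
      ; inverse = λ (x , p) x≉0 → (recip x x≉0 , P-recip (recipʳ x x≉0) p) , recipʳ x x≉0
      ; _≟_ = λ (x , _) (y , _) → x ≟ y }
    ; base = record
      { ⟦_⟧ = λ k → ι k , P-ι k
      ; isRingHomomorphism = record
        { isSemiringHomomorphism = record
          { isNearSemiringHomomorphism = record
            { +-isMonoidHomomorphism = record
              { isMagmaHomomorphism = record { isRelHomomorphism = record { cong = ι-cong } ; homo = ι-+ }
              ; ε-homo = ι-0 }
            ; *-homo = ι-* }
          ; 1#-homo = ι-1 }
        ; -‿homo = ι-neg } } }

  inclusion : Embedding subfield M
  inclusion = mkEmbedding subfield M proj₁ (λ p → p) (λ _ _ → refl) (λ _ _ → refl) (λ _ → refl)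

  module _ (s : SubSpaces.SpansSub M P) where
    open SubSpaces.SpansSub s

    subfield-spanning : Spanning subfield
    subfield-spanning = record
      { vec = λ k → vec k , vec∈ k
      ; coord = λ (x , p) → coord x p
      ; expand = λ (x , p) → trans (expand x p) (sym (EmbeddingProperties.combination-hom inclusion (coord x p) (λ k → vec k , vec∈ k))) }

-- Galois theory of formally real fields

module GaloisTheory {K : Field} (M : Extension K) (real : FormallyReal (Extension.top M))
  (spanning : Spanning M) (family : Family M M) where
  private
    module K = FieldProperties K
  open ExtensionProperties M
  open Family family
  open FamilyProperties real family
  open SetoidReasoning setoid

  listed : (g : Embedding M M) → ∃ λ j → g ≐ map j
  listed = TraceForm.extends idₑ spanning

  spanning⇒finite : ∀ {E} → Embedding E M → Spanning E → Finite E
  spanning⇒finite i s = TraceForm.Reproducing.rank i s , TraceForm.Reproducing.basis i s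

  record Inverse (g : Embedding M M) : Set where
    field
      from      : Embedding M M
      from∘to   : ∀ x → from · (g · x) ≈ x
      to∘from   : ∀ x → g · (from · x) ≈ x

  -- Regarding g as an embedding of M into M, the identity extends along it to some f_j = h, so h g
  -- = id. In the same way h has a left inverse h′, and h′ = h′ h g = g.
  inverseOf : (g : Embedding M M) → Inverse g
  inverseOf g = record
    { from = h
    ; from∘to = λ x → sym (id≐hg x)
    ; to∘from = λ y → trans (sym (h′≐g (h · y))) (sym (id≐h′h y)) }
    where
    left = TraceForm.extends g spanning idₑ
    h = map (proj₁ left)
    id≐hg = proj₂ left
    left′ = TraceForm.extends h spanning idₑ
    h′ = map (proj₁ left′)
    id≐h′h = proj₂ left′
    h′≐g : h′ ≐ g
    h′≐g x = trans (Embedding.⟦⟧-cong h′ (id≐hg x)) (sym (id≐h′h (g · x)))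

  -- If every f_j fixes x, then trace x = Σ f_j(x) = x · trace 1, and trace 1 is nonzero by
  -- anisotropy, 1 being a square.
  fixed : ∀ x → (∀ j → map j · x ≈ x) → ∃ λ k → x ≈ ι k
  fixed x x-fixed = trace x K.* K.recip (trace 1#) trace1≉0 , (begin
      x                                          ≈⟨ *-identityʳ x ⟨
      x * 1#                                     ≈⟨ *-congˡ (trans (ι-cong (K.recipʳ (trace 1#) trace1≉0)) ι-1) ⟨
      x * ι (trace 1# K.* r)                     ≈⟨ *-congˡ (ι-* _ _) ⟩
      x * (ι (trace 1#) * ι r)                   ≈⟨ *-assoc _ _ _ ⟨
      (x * ι (trace 1#)) * ι r                   ≈⟨ *-congʳ (*-congˡ (sum-map 1#)) ⟨
      (x * sum (λ j → map j · 1#)) * ι r         ≈⟨ *-congʳ (*-distribˡ-sum x (λ j → map j · 1#)) ⟩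
      sum (λ j → x * map j · 1#) * ι r           ≈⟨ *-congʳ (sum-cong-≋ (λ j → trans (*-congˡ (Embedding.1#-homo (map j))) (trans (*-identityʳ x) (sym (x-fixed j))))) ⟩
      sum (λ j → map j · x) * ι r                ≈⟨ *-congʳ (sum-map x) ⟩
      ι (trace x) * ι r                          ≈⟨ ι-* _ _ ⟨
      ι (trace x K.* r)                          ∎)
    where
    trace1≉0 : ¬ trace 1# K.≈ K.0#
    trace1≉0 p = 1≉0 (trace-anisotropic (K.trans (trace-cong (*-identityˡ 1#)) p))
    r = K.recip (trace 1#) trace1≉0

  -- The coefficients of the projection onto E, grouped by the restrictions
  -- of the endomorphisms to E, are 1 for the inclusion and 0 otherwise.
  correspondence : ∀ {E} (i : Embedding E M) → Spanning E → ∀ y →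
    (∀ p → map p ∘ₑ i ≐ i → map p · y ≈ y) → ∃ λ z → i · z ≈ y
  correspondence {E} i s y y-fixed = extended y , trans (extended-kernel i y)
    (sym (x-y≈0⇒x≈y (begin
      y - sum (λ j → kernel i j * map j · y)
        ≈⟨ solve 2 (λ y s → y :- s := :- (:- y :+ s)) refl y _ ⟩
      - (- y + sum (λ j → kernel i j * map j · y))
        ≈⟨ -‿cong (trans (+-congʳ (sym (-1*x≈-x y))) (Dedekind.independence E M (i ∷ (λ j → map j ∘ₑ i))
             ((- 1#) ∷ kernel i) (y ∷ (λ j → map j · y)) (kernel-relation i) respects)) ⟩
      - 0#
        ≈⟨ -0#≈0# ⟩
      0# ∎)))
    where
    open TraceForm i using (module Reproducing)
    open Reproducing s
    -- The composite of f_j with the inverse of f_k is again listed and fixes E, hence fixes y by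
    -- hypothesis.
    equal : ∀ j k → map j ∘ₑ i ≐ map k ∘ₑ i → map j · y ≈ map k · y
    equal j k ji≐ki = begin
      map j · y                          ≈⟨ to∘from _ ⟨
      map k · (from · (map j · y))       ≈⟨ Embedding.⟦⟧-cong (map k) (proj₂ (listed (from ∘ₑ map j)) y) ⟩
      map k · (map p · y)                ≈⟨ Embedding.⟦⟧-cong (map k) (y-fixed p (λ x → trans (sym (proj₂ (listed (from ∘ₑ map j)) (i · x)))
                                              (trans (Embedding.⟦⟧-cong from (ji≐ki x)) (from∘to _)))) ⟩
      map k · y                          ∎
      where
      open Inverse (inverseOf (map k))
      p = proj₁ (listed (from ∘ₑ map j))
    respects : ∀ j k → (i ∷ (λ j → map j ∘ₑ i)) j ≐ (i ∷ (λ j → map j ∘ₑ i)) k →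
      (y ∷ (λ j → map j · y)) j ≈ (y ∷ (λ j → map j · y)) k
    respects zero    zero    _ = refl
    respects zero    (suc k) p = sym (y-fixed k (λ x → sym (p x)))
    respects (suc j) zero    p = y-fixed j p
    respects (suc j) (suc k) p = equal j k p

  -- g permutes the family up to multiplicities, because Σ g f_j = Σ f_j.
  reindex : (g : Embedding M M) (b : Embedding M M → Carrier) → (∀ f h → f ≐ h → b f ≈ b h) →
    sum (λ j → b (g ∘ₑ map j)) ≈ sum (λ j → b (map j))
  reindex g b b-resp = x-y≈0⇒x≈y (begin
    sum (λ j → b (g ∘ₑ map j)) - sum (λ j → b (map j))
      ≈⟨ +-cong (sum-cong-≋ (λ j → *-identityˡ (b (g ∘ₑ map j)))) (trans (sum-cong-≋ (λ j → -1*x≈-x (b (map j)))) (sum-neg (λ j → b (map j)))) ⟨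
    sum (λ j → 1# * b (g ∘ₑ map j)) + sum (λ j → (- 1#) * b (map j))
      ≈⟨ SumProperties.sum-++ (Extension.top M) (λ (a , χ) → a * b χ) left right ⟨
    sum (λ j → proj₁ ((left ++ right) j) * b (proj₂ ((left ++ right) j)))
      ≈⟨ Dedekind.independence M M (λ j → proj₂ ((left ++ right) j)) (λ j → proj₁ ((left ++ right) j)) (λ j → b (proj₂ ((left ++ right) j)))
           relation (λ j k → b-resp _ _) ⟩
    0# ∎)
    where
    left right : Fin (suc size) → Carrier × Embedding M M
    left  j = 1# , g ∘ₑ map j
    right j = - 1# , map j
    relation : ∀ x → sum (λ j → proj₁ ((left ++ right) j) * proj₂ ((left ++ right) j) · x) ≈ 0#
    relation x = begin
      sum (λ j → proj₁ ((left ++ right) j) * proj₂ ((left ++ right) j) · x)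
        ≈⟨ SumProperties.sum-++ (Extension.top M) (λ (a , χ) → a * χ · x) left right ⟩
      sum (λ j → 1# * g · (map j · x)) + sum (λ j → (- 1#) * map j · x)
        ≈⟨ +-cong (sum-cong-≋ (λ j → *-identityˡ (g · (map j · x)))) (trans (sum-cong-≋ (λ j → -1*x≈-x (map j · x))) (sum-neg (λ j → map j · x))) ⟩
      sum (λ j → g · (map j · x)) - sum (λ j → map j · x)
        ≈⟨ +-cong (trans (sym (EmbeddingProperties.sum-hom g (λ j → map j · x))) (trans (Embedding.⟦⟧-cong g (sum-map x)) (Embedding.fixes g _))) (-‿cong (sum-map x)) ⟩
      ι (trace x) - ι (trace x)
        ≈⟨ -‿inverseʳ _ ⟩
      0# ∎

-- Galois closures

-- For M = E and the identity this says that the n-th derived group of Gal E is trivial. Letting M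
-- vary lets the bound grow along a tower whose intermediate fields need not be stable under
-- automorphisms.
FixedByDerived : ∀ {K} → Extension K → ℕ → Set₁
FixedByDerived {K} E n = ∀ {M : Extension K} (i : Embedding E M) (σ : Automorphism M) →
  DerivedSeries (Gal M) n σ → ∀ x → Extension._≈_ M (Automorphism.⟦_⟧ σ (i · x)) (i · x)

module Closure {K : Field} (M : Extension K) (real : FormallyReal (Extension.top M))
  (spanning : Spanning M) (family : Family M M) where
  private
    module K = FieldProperties K
  open ExtensionProperties M
  open Family family
  open FamilyProperties real family
  open GaloisTheory M real spanning family
  open SetoidReasoning setoid

  sum-of-squares-zero : ∀ {n} (v : Fin n → Carrier) → sum (λ j → v j * v j) ≈ 0# → ∀ j → v j ≈ 0#
  sum-of-squares-zero {suc n} v v≈0 j = real (v j) (squares (λ k → v (punchIn j k)))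
    (trans (sym (sum-remove {i = j} (λ k → v k * v k))) v≈0)
    where
    squares : ∀ {n} (v : Fin n → Carrier) → SumOfSquares (Extension.top M) (sum (λ j → v j * v j))
    squares {zero}  v = none refl
    squares {suc n} v = more (v zero) (squares (v ∘ suc)) refl

  module Normality {E : Extension K} (i : Embedding E M) (galois : IsFiniteGalois E) where
    private
      module E = ExtensionProperties E
      module i = EmbeddingProperties i
      module G = Group (Gal E)
    E-spanning : Spanning E
    E-spanning = basis⇒spanning (IsFiniteGalois.finite galois)
    open Spanning E-spanning using (vec; coord; expand)
    open TraceForm i using (module Reproducing)
    open Reproducing E-spanning using (extended; reconstruct; u; μ)

    infixl 9 _⟪_⟫
    _⟪_⟫ : Automorphism E → E.Carrier → E.Carrier
    σ ⟪ x ⟫ = Automorphism.⟦_⟧ σ x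

    Restricts : Embedding E M → Set
    Restricts χ = Σ (Automorphism E) λ σ → ∀ x → χ · x ≈ i · (σ ⟪ x ⟫)

    -- Membership in the image of E, encoded as a decidable equation: the orthogonal projection onto
    -- E leaves y in place.
    record In (y : Carrier) : Set where
      constructor in-image
      field
        eq : i · extended y ≈ y
    open In

    image⇒In : ∀ {y} x → y ≈ i · x → In y
    image⇒In {y} x y≈ix = in-image (trans (i.cong (E.trans (extended-cong {y} {i · x} y≈ix) (reconstruct x))) (sym y≈ix))
      where
      extended-cong : ∀ {y z} → y ≈ z → extended y E.≈ extended z
      extended-cong {y} {z} y≈z = E.sum-cong-≋ (λ k → E.*-congʳ {x = u k} (E.ι-cong (K.*-congˡ {x = μ k} (trace-cong (*-congʳ {x = i · u k} y≈z)))))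

    In-all : (χ : Embedding E M) → (∀ k → In (χ · vec k)) → ∀ x → In (χ · x)
    In-all χ χ-In x = image⇒In (E.sum (λ k → E.ι (coord x k) E.* extended (χ · vec k))) (begin
      χ · x                                                        ≈⟨ Embedding.⟦⟧-cong χ (expand x) ⟩
      χ · E.sum (λ k → E.ι (coord x k) E.* vec k)                  ≈⟨ EmbeddingProperties.combination-hom χ (coord x) vec ⟩
      sum (λ k → ι (coord x k) * χ · vec k)                        ≈⟨ sum-cong-≋ {x = λ k → ι (coord x k) * χ · vec k} (λ k → *-congˡ {x = ι (coord x k)} (sym (eq (χ-In k)))) ⟩
      sum (λ k → ι (coord x k) * i · extended (χ · vec k))         ≈⟨ i.combination-hom (coord x) (λ k → extended (χ · vec k)) ⟨
      i · E.sum (λ k → E.ι (coord x k) E.* extended (χ · vec k))   ∎)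

    pullback : (χ : Embedding E M) → (∀ x → In (χ · x)) → Embedding E E
    pullback χ χ-In = mkEmbedding E E (λ x → extended (χ · x))
      (λ {x} {y} x≈y → i.injective (trans (eq (χ-In x)) (trans (χ.cong x≈y) (sym (eq (χ-In y))))))
      (λ x y → i.injective (trans (eq (χ-In (x E.+ y))) (trans (χ.+-hom x y) (sym (trans (i.+-hom _ _) (+-cong (eq (χ-In x)) (eq (χ-In y))))))))
      (λ x y → i.injective (trans (eq (χ-In (x E.* y))) (trans (χ.*-hom x y) (sym (trans (i.*-hom _ _) (*-cong (eq (χ-In x)) (eq (χ-In y))))))))
      (λ k → i.injective (trans (eq (χ-In (E.ι k))) (trans (χ.fixes k) (sym (i.fixes k)))))
      where module χ = EmbeddingProperties χ

    in? : ∀ y → Dec (In y)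
    in? y = map′ in-image eq ((i · extended y) ≟ y)

    -- An automorphism carries its inverse as data, so both g and its inverse are tested on the
    -- spanning family of E.
    restricts?-map : (g : Embedding M M) → Dec (Restricts (g ∘ₑ i))
    restricts?-map g = map′ to-restricts from-restricts
        (Finₚ.all? (λ k → in? (g · (i · vec k))) ×-dec Finₚ.all? (λ k → in? (h · (i · vec k))))
      where
      open Inverse (inverseOf g) renaming (from to h)
      to-restricts : (∀ k → In (g · (i · vec k))) × (∀ k → In (h · (i · vec k))) → Restricts (g ∘ₑ i)
      to-restricts (p , q) = record
        { to = pullback (g ∘ₑ i) gi-In
        ; from = pullback (h ∘ₑ i) hi-In
        ; to∘from = λ x → i.injective (trans (eq (gi-In _)) (trans (Embedding.⟦⟧-cong g (eq (hi-In x))) (to∘from _)))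
        ; from∘to = λ x → i.injective (trans (eq (hi-In _)) (trans (Embedding.⟦⟧-cong h (eq (gi-In x))) (from∘to _))) }
        , λ x → sym (eq (gi-In x))
        where
        gi-In = In-all (g ∘ₑ i) p
        hi-In = In-all (h ∘ₑ i) q
      from-restricts : Restricts (g ∘ₑ i) → (∀ k → In (g · (i · vec k))) × (∀ k → In (h · (i · vec k)))
      from-restricts (σ , gi≐iσ) = (λ k → image⇒In (σ ⟪ vec k ⟫) (gi≐iσ (vec k))) , (λ k → image⇒In (Embedding.⟦_⟧ (Automorphism.from σ) (vec k)) (begin
        h · (i · vec k)                                                    ≈⟨ Embedding.⟦⟧-cong h (i.cong (Automorphism.to∘from σ (vec k))) ⟨
        h · (i · (σ ⟪ Embedding.⟦_⟧ (Automorphism.from σ) (vec k) ⟫))      ≈⟨ Embedding.⟦⟧-cong h (gi≐iσ _) ⟨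
        h · (g · (i · Embedding.⟦_⟧ (Automorphism.from σ) (vec k)))        ≈⟨ from∘to _ ⟩
        i · Embedding.⟦_⟧ (Automorphism.from σ) (vec k)                    ∎))

    restricts-resp : ∀ {χ ψ : Embedding E M} → χ ≐ ψ → Restricts χ → Restricts ψ
    restricts-resp χ≐ψ (σ , p) = σ , λ x → trans (sym (χ≐ψ x)) (p x)

    abstract
      restricts? : ∀ χ → Dec (Restricts χ)
      restricts? χ = let (j , χ≐) = TraceForm.extends i E-spanning χ in
        map′ (restricts-resp {map j ∘ₑ i} {χ} (λ x → sym (χ≐ x))) (restricts-resp {χ} {map j ∘ₑ i} χ≐) (restricts?-map (map j))

    if : ∀ {A : Set} → Dec A → Carrier → Carrier
    if (yes _) y = y
    if (no  _) y = 0#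

    if-cong : ∀ {A B : Set} (A? : Dec A) (B? : Dec B) {y z} → (A → B) → (B → A) → (A → y ≈ z) → if A? y ≈ if B? z
    if-cong (yes a) (yes b) f g e = e a
    if-cong (yes a) (no ¬b) f g e = contradiction (f a) ¬b
    if-cong (no ¬a) (yes b) f g e = contradiction (g b) ¬a
    if-cong (no ¬a) (no ¬b) f g e = refl

    compose-restricts : ∀ (g f : Embedding M M) → Restricts (g ∘ₑ i) → Restricts (f ∘ₑ i) → Restricts (g ∘ₑ (f ∘ₑ i))
    compose-restricts g f (σ , p) (τ , q) = σ G.∙ τ , λ x → trans (Embedding.⟦⟧-cong g (q x)) (p _)

    cancel-restricts : ∀ (g f : Embedding M M) → Restricts (g ∘ₑ i) → Restricts (g ∘ₑ (f ∘ₑ i)) → Restricts (f ∘ₑ i)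
    cancel-restricts g f (σ , p) (τ , q) = (σ G.⁻¹) G.∙ τ , λ x → EmbeddingProperties.injective g
      (trans (q x) (sym (trans (p _) (i.cong (Automorphism.to∘from σ _)))))

    cancel-restrictsʳ : ∀ (g f : Embedding M M) → Restricts (f ∘ₑ i) → Restricts (g ∘ₑ (f ∘ₑ i)) → Restricts (g ∘ₑ i)
    cancel-restrictsʳ g f (σ , p) (τ , q) = τ G.∙ (σ G.⁻¹) , λ x → trans (Embedding.⟦⟧-cong g (trans (i.cong (E.sym (Automorphism.to∘from σ x))) (sym (p _))))
      (q _)

    -- The sum over the f_j that restrict to automorphisms of E, hence up to multiplicities the sum
    -- over Gal E.
    partialTrace : E.Carrier → Carrier
    partialTrace z = sum (λ j → if (restricts? (map j ∘ₑ i)) (map j · (i · z)))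

    partialTrace-image : ∀ z → ∃ λ w → i · w ≈ partialTrace z
    partialTrace-image z = E.sum w , trans (i.sum-hom w) (sum-cong-≋ {x = λ j → i · w j} image)
      where
      preimage : ∀ {χ} → Dec (Restricts χ) → E.Carrier
      preimage (yes (σ , _)) = σ ⟪ z ⟫
      preimage (no  _)       = E.0#
      w : Fin (suc size) → E.Carrier
      w j = preimage (restricts? (map j ∘ₑ i))
      image′ : (χ : Embedding E M) (d : Dec (Restricts χ)) → i · preimage {χ} d ≈ if d (χ · z)
      image′ χ (yes (σ , p)) = sym (p z)
      image′ χ (no  _)       = i.0-hom
      image : ∀ j → i · w j ≈ if (restricts? (map j ∘ₑ i)) (map j · (i · z))
      image j = image′ (map j ∘ₑ i) (restricts? (map j ∘ₑ i))

    -- The partial trace lies in E. An automorphism σ of E extends to some g in the family, and f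
    -- restricts to E exactly when g f does, so `reindex` shows that σ fixes the partial trace. The
    -- fixed field of Gal E being K, the value lies in K.
    partialTrace-base : ∀ z → ∃ λ k → partialTrace z ≈ ι k
    partialTrace-base z = proj₁ base , trans (sym iw≈) (trans (i.cong (proj₂ base)) (i.fixes _))
      where
      w = proj₁ (partialTrace-image z)
      iw≈ : i · w ≈ partialTrace z
      iw≈ = proj₂ (partialTrace-image z)
      b : Embedding M M → Carrier
      b g = if (restricts? (g ∘ₑ i)) (g · (i · z))
      b-resp : ∀ f h → f ≐ h → b f ≈ b h
      b-resp f h f≐h = if-cong (restricts? (f ∘ₑ i)) (restricts? (h ∘ₑ i))
        (restricts-resp {f ∘ₑ i} {h ∘ₑ i} (λ x → f≐h (i · x))) (restricts-resp {h ∘ₑ i} {f ∘ₑ i} (λ x → sym (f≐h (i · x)))) (λ _ → f≐h (i · z))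
      w-fixed : ∀ (σ : Automorphism E) → σ ⟪ w ⟫ E.≈ w
      w-fixed σ = i.injective (begin
        i · (σ ⟪ w ⟫)                                   ≈⟨ iσ≐gi w ⟩
        g · (i · w)                                     ≈⟨ Embedding.⟦⟧-cong g iw≈ ⟩
        g · partialTrace z                              ≈⟨ EmbeddingProperties.sum-hom g (λ j → b (map j)) ⟩
        sum (λ j → g · b (map j))                       ≈⟨ sum-cong-≋ pull ⟩
        sum (λ j → b (g ∘ₑ map j))                      ≈⟨ reindex g b b-resp ⟩
        partialTrace z                                  ≈⟨ iw≈ ⟨
        i · w                                           ∎)
        where
        ext = TraceForm.extends i E-spanning (i ∘ₑ Automorphism.to σ)
        g = map (proj₁ ext)
        iσ≐gi = proj₂ ext
        g-restricts : Restricts (g ∘ₑ i)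
        g-restricts = σ , λ x → sym (iσ≐gi x)
        g-if : ∀ {A : Set} (d : Dec A) y → g · if d y ≈ if d (g · y)
        g-if (yes _) y = refl
        g-if (no  _) y = Embedding.0#-homo g
        pull : ∀ j → g · b (map j) ≈ b (g ∘ₑ map j)
        pull j = trans (g-if (restricts? (map j ∘ₑ i)) _) (if-cong (restricts? (map j ∘ₑ i)) (restricts? ((g ∘ₑ map j) ∘ₑ i))
          (compose-restricts g (map j) g-restricts) (cancel-restricts g (map j) g-restricts) (λ _ → refl))
      base = IsFiniteGalois.fixedField galois w w-fixed

    private
      if-* : ∀ {A : Set} (d : Dec A) a y → if d a * y ≈ if d (a * y)
      if-* (yes _) a y = refl
      if-* (no  _) a y = zeroˡ y

    -- If g E is not contained in E, then the sum of the g σ over the σ that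
    -- restrict to E is the sum of these σ, but the two sums have no
    -- character in common, contradicting their independence.
    normal : ∀ (g : Embedding M M) → Restricts (g ∘ₑ i)
    normal g with restricts? (g ∘ₑ i)
    ... | yes r = r
    ... | no ¬r = contradiction (trans (sym (if-yes (restricts? (map j₀ ∘ₑ i)) id-restricts)) (sum-of-squares-zero c squares≈0 j₀)) 1≉0
      where
      c : Fin (suc size) → Carrier
      c j = if (restricts? (map j ∘ₑ i)) 1#
      j₀ = proj₁ (listed idₑ)
      id-restricts : Restricts (map j₀ ∘ₑ i)
      id-restricts = G.ε , λ x → sym (proj₂ (listed idₑ) (i · x))
      if-yes : ∀ {A : Set} (d : Dec A) → A → if d 1# ≈ 1#
      if-yes (yes _) a = refl
      if-yes (no ¬a) a = contradiction a ¬a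
      left right : Fin (suc size) → Carrier × Embedding E M
      left  j = c j , g ∘ₑ (map j ∘ₑ i)
      right j = - c j , map j ∘ₑ i
      all : Fin (suc size ℕ.+ suc size) → Carrier × Embedding E M
      all = left ++ right
      scaled : ∀ x j → c j * map j · (i · x) ≈ if (restricts? (map j ∘ₑ i)) (map j · (i · x))
      scaled x j = trans (if-* (restricts? (map j ∘ₑ i)) 1# _) (if-cong (restricts? (map j ∘ₑ i)) (restricts? (map j ∘ₑ i)) (λ r → r) (λ r → r) (λ _ → *-identityˡ _))
      relation : ∀ x → sum (λ j → proj₁ (all j) * proj₂ (all j) · x) ≈ 0#
      relation x = begin
        sum (λ j → proj₁ (all j) * proj₂ (all j) · x)
          ≈⟨ SumProperties.sum-++ (Extension.top M) (λ (a , χ) → a * χ · x) left right ⟩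
        sum (λ j → c j * g · (map j · (i · x))) + sum (λ j → (- c j) * map j · (i · x))
          ≈⟨ +-cong (sum-cong-≋ (λ j → trans (g-c j (map j · (i · x))) (Embedding.⟦⟧-cong g (scaled x j))))
               (trans (sum-cong-≋ (λ j → trans (solve 2 (λ c y → (:- c) :* y := :- (c :* y)) refl (c j) _) (-‿cong (scaled x j))))
                 (sum-neg (λ j → if (restricts? (map j ∘ₑ i)) (map j · (i · x))))) ⟩
        sum (λ j → g · if (restricts? (map j ∘ₑ i)) (map j · (i · x))) - partialTrace x
          ≈⟨ +-congʳ (EmbeddingProperties.sum-hom g (λ j → if (restricts? (map j ∘ₑ i)) (map j · (i · x)))) ⟨
        g · partialTrace x - partialTrace x
          ≈⟨ +-cong (trans (Embedding.⟦⟧-cong g (proj₂ (partialTrace-base x))) (Embedding.fixes g _)) (-‿cong (proj₂ (partialTrace-base x))) ⟩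
        ι _ - ι _
          ≈⟨ -‿inverseʳ _ ⟩
        0# ∎
        where
        g-if : ∀ {A : Set} (d : Dec A) y → if d 1# * g · y ≈ g · (if d 1# * y)
        g-if (yes _) y = trans (*-identityˡ _) (Embedding.⟦⟧-cong g (sym (*-identityˡ y)))
        g-if (no  _) y = trans (zeroˡ _) (trans (sym (Embedding.0#-homo g)) (Embedding.⟦⟧-cong g (sym (zeroˡ y))))
        g-c : ∀ j y → c j * g · y ≈ g · (c j * y)
        g-c j y = g-if (restricts? (map j ∘ₑ i)) y
      b : Embedding E M → Carrier
      b χ = if (restricts? χ) 1#
      b-resp : ∀ j k → proj₂ (all j) ≐ proj₂ (all k) → b (proj₂ (all j)) ≈ b (proj₂ (all k))
      b-resp j k p = if-cong (restricts? _) (restricts? _) (restricts-resp {proj₂ (all j)} {proj₂ (all k)} p)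
        (restricts-resp {proj₂ (all k)} {proj₂ (all j)} (λ x → sym (p x))) (λ _ → refl)
      -- If f_j and g f_j both restricted to automorphisms of E, then so would g, against the
      -- assumption.
      left-term : ∀ j → c j * b (g ∘ₑ (map j ∘ₑ i)) ≈ 0#
      left-term j with restricts? (map j ∘ₑ i) | restricts? (g ∘ₑ (map j ∘ₑ i))
      ... | yes p | yes q = contradiction (cancel-restrictsʳ g (map j) p q) ¬r
      ... | yes p | no  _ = zeroʳ 1#
      ... | no  _ | yes _ = zeroˡ 1#
      ... | no  _ | no  _ = zeroˡ 0#
      -- Dedekind's theorem is paired with the indicator b of the characters that restrict to E: the
      -- half belonging to g contributes 0, and the other half -Σ c_j². Since the identity is
      -- listed, some c_j is 1, which formal reality excludes.
      squares≈0 : sum (λ j → c j * c j) ≈ 0#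
      squares≈0 = begin
        sum (λ j → c j * c j)
          ≈⟨ -‿involutive _ ⟨
        - (- sum (λ j → c j * c j))
          ≈⟨ -‿cong (sym (trans (+-cong (sum-zero _ left-term) (trans (sum-cong-≋ (λ j → solve 1 (λ c → (:- c) :* c := :- (c :* c)) refl (c j))) (sum-neg (λ j → c j * c j)))) (+-identityˡ _))) ⟩
        - (sum (λ j → c j * b (g ∘ₑ (map j ∘ₑ i))) + sum (λ j → (- c j) * b (map j ∘ₑ i)))
          ≈⟨ -‿cong (SumProperties.sum-++ (Extension.top M) (λ (a , χ) → a * b χ) left right) ⟨
        - sum (λ j → proj₁ (all j) * b (proj₂ (all j)))
          ≈⟨ -‿cong (Dedekind.independence E M (λ j → proj₂ (all j)) (λ j → proj₁ (all j)) (λ j → b (proj₂ (all j))) relation b-resp) ⟩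
        - 0#
          ≈⟨ -0#≈0# ⟩
        0# ∎

  module _ (L : Extension K) (L-spanning : Spanning L) (l : Embedding L M) where

    FixesConjugates : Embedding M M → Set
    FixesConjugates g = ∀ k → g ∘ₑ (map k ∘ₑ l) ≐ map k ∘ₑ l

    fixesConjugates? : ∀ g → Dec (FixesConjugates g)
    fixesConjugates? g = Finₚ.all? (λ k → ≐-dec L-spanning (g ∘ₑ (map k ∘ₑ l)) (map k ∘ₑ l))

    InClosure : Carrier → Set
    InClosure x = ∀ g → FixesConjugates g → g · x ≈ x

    fixes-conjugate : ∀ g → FixesConjugates g → ∀ f → g ∘ₑ (f ∘ₑ l) ≐ f ∘ₑ l
    fixes-conjugate g g-fixes f x = let (j , f≐) = listed f in
      trans (Embedding.⟦⟧-cong g (f≐ (l · x))) (trans (g-fixes j x) (sym (f≐ (l · x))))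

    conjugate∈ : ∀ (f : Embedding M M) x → InClosure (f · (l · x))
    conjugate∈ f x g g-fixes = fixes-conjugate g g-fixes f x

    private
      resp∈ : ∀ {x y} → x ≈ y → InClosure x → InClosure y
      resp∈ x≈y p g h = trans (Embedding.⟦⟧-cong g (sym x≈y)) (trans (p g h) x≈y)

      +∈ : ∀ {x y} → InClosure x → InClosure y → InClosure (x + y)
      +∈ p q g h = trans (Embedding.+-homo g _ _) (+-cong (p g h) (q g h))

      *∈ : ∀ {x y} → InClosure x → InClosure y → InClosure (x * y)
      *∈ p q g h = trans (Embedding.*-homo g _ _) (*-cong (p g h) (q g h))

      recip∈ : ∀ {x y} → x * y ≈ 1# → InClosure x → InClosure y
      recip∈ {x} {y} xy≈1 p g h = *-cancelˡ {x = x} (λ x≈0 → 1≉0 (trans (sym xy≈1) (trans (*-congʳ x≈0) (zeroˡ y))))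
        (trans (*-congʳ (sym (p g h))) (trans (sym (Embedding.*-homo g x y))
          (trans (Embedding.⟦⟧-cong g xy≈1) (trans (Embedding.1#-homo g) (sym xy≈1)))))

      ι∈ : ∀ k → InClosure (ι k)
      ι∈ k g h = Embedding.fixes g k

    open Subfield M InClosure resp∈ +∈ *∈ recip∈ ι∈ renaming (subfield to N; inclusion to incl)

    open SubSpaces M

    -- x is fixed by g when the trace form vanishes on g x - x and a spanning family.
    fixed-cut : (g : Embedding M M) → Cut (λ x → g · x ≈ x)
    fixed-cut g = cut-⇔ to from (cut-all (λ k → cut-functional (functional k)))
      where
      open TraceForm (idₑ {E = M})
      module g = EmbeddingProperties g
      open Spanning spanning using (vec; coord; expand)
      functional : Fin (Spanning.size spanning) → Functional
      functional k = record
        { φ = λ x → form (g · x - x) (vec k)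
        ; φ-cong = λ {x} {y} x≈y → form-cong {g · x - x} {g · y - y} (+-cong (g.cong x≈y) (-‿cong x≈y)) refl
        ; φ-+ = λ x y → K.trans (form-cong {g · (x + y) - (x + y)} {(g · x - x) + (g · y - y)} (trans (+-congʳ (g.+-hom x y))
            (solve 4 (λ a b x y → (a :+ b) :- (x :+ y) := (a :- x) :+ (b :- y)) refl (g · x) (g · y) x y)) refl)
            (form-+ (g · x - x) (g · y - y) (vec k))
        ; φ-scale = λ q x → K.trans (form-cong {g · (ι q * x) - ι q * x} {ι q * (g · x - x)} (trans (+-congʳ (g.scale-hom q x))
            (solve 3 (λ q a x → q :* a :- q :* x := q :* (a :- x)) refl (ι q) (g · x) x)) refl)
            (form-scale q (g · x - x) (vec k)) }
      to : ∀ x → (∀ k → form (g · x - x) (vec k) K.≈ K.0#) → g · x ≈ x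
      to x orthogonal = x-y≈0⇒x≈y (form-anisotropic (K.trans (form-cong {z} {_} {z} (expand z) refl)
        (K.trans (form-sum (coord z) vec z) (K.sum-zero (λ k → coord z k K.* form (vec k) z)
          (λ k → K.trans (K.*-congˡ {x = coord z k} (K.trans (form-sym (vec k) z) (orthogonal k))) (K.zeroʳ (coord z k)))))))
        where z = g · x - x
      from : ∀ x → g · x ≈ x → ∀ k → form (g · x - x) (vec k) K.≈ K.0#
      from x gx≈x k = K.trans (form-cong {g · x - x} {0#} {vec k} (x≈y⇒x-y≈0 gx≈x) refl) (form-0 (vec k))

    conditional-cut : ∀ {A : Set} {R} → Dec A → Cut R → Cut (λ x → A → R x)
    conditional-cut (yes a) cut = cut-⇔ (λ x r _ → r) (λ x r → r a) cut
    conditional-cut (no ¬a) cut = cut-trivial (λ x a → contradiction a ¬a)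

    -- Every endomorphism is listed, so finitely many conditions describe the fixed field. Whether
    -- f_j contributes one is decided on the spanning family of L.
    closure-spans : SpansSub InClosure
    closure-spans = spansSub-⇔
      (λ x (_ , p) g g-fixes → let (j , g≐) = listed g in
        trans (g≐ x) (p j (λ k y → trans (sym (g≐ (map k · (l · y)))) (g-fixes k y))))
      (λ x p → tt , λ j → p (map j))
      (cut-all (λ j → conditional-cut (fixesConjugates? (map j)) (fixed-cut (map j))) (everything spanning))

    N-spanning : Spanning N
    N-spanning = subfield-spanning closure-spans

    N-finite : Finite N
    N-finite = spanning⇒finite {N} incl N-spanning

    private
      module N = ExtensionProperties N

    -- The subgroup fixing all conjugates of L is normal: if h belongs to it, then so does g⁻¹ h g,
    -- because g maps conjugates to conjugates.
    closure-stable : ∀ (g : Embedding M M) x → InClosure x → InClosure (g · x)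
    closure-stable g x x∈ h h-fixes = begin
      h · (g · x)                       ≈⟨ to∘from _ ⟨
      g · (from · (h · (g · x)))        ≈⟨ Embedding.⟦⟧-cong g (x∈ (from ∘ₑ (h ∘ₑ g)) (λ k y →
                                             trans (Embedding.⟦⟧-cong from (fixes-conjugate h h-fixes (g ∘ₑ map k) y)) (from∘to _))) ⟩
      g · x                             ∎
      where open Inverse (inverseOf g)

    restrict : Embedding M M → Embedding N N
    restrict g = mkEmbedding N N (λ (x , x∈) → g · x , closure-stable g x x∈)
      (Embedding.⟦⟧-cong g) (λ _ _ → Embedding.+-homo g _ _) (λ _ _ → Embedding.*-homo g _ _) (Embedding.fixes g)

    restrictAut : Embedding M M → Automorphism N
    restrictAut g = record
      { to = restrict g ; from = restrict from ; to∘from = λ (x , _) → to∘from x ; from∘to = λ (x , _) → from∘to x }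
      where open Inverse (inverseOf g)

    N-galois : IsFiniteGalois N
    N-galois = record
      { finite = N-finite
      ; fixedField = λ (x , _) x-fixed → fixed x (λ j → x-fixed (restrictAut (map j))) }

    embed : Embedding L N
    embed = mkEmbedding L N (λ x → l · x , conjugate∈ idₑ x)
      (Embedding.⟦⟧-cong l) (Embedding.+-homo l) (Embedding.*-homo l) (Embedding.fixes l)

    galoisClosure : GaloisClosure L
    galoisClosure = record
      { closure = N
      ; isFiniteGalois = N-galois
      ; embed = embed
      -- As E is normal in M, each conjugate f_k(L) equals the image of σ(j(L)) for some σ in Gal E,
      -- and so lies in E. An f_p that fixes E therefore fixes all conjugates of L, hence y, and
      -- `correspondence` places y in E.
      ; smallest = λ E j i ij≐embed E-galois (y , y∈) →
          let i′ = incl ∘ₑ i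
              open Normality i′ E-galois
              (z , iz≈y) = correspondence i′ E-spanning y (λ p p-fixes → y∈ (map p) (λ k x →
                let (σ , ki≐iσ) = normal (map k)
                    conj : map k · (l · x) ≈ i′ · (σ ⟪ j · x ⟫)
                    conj = trans (Embedding.⟦⟧-cong (map k) (sym (ij≐embed x))) (ki≐iσ (j · x))
                in trans (Embedding.⟦⟧-cong (map p) conj) (trans (p-fixes _) (sym conj))))
          in z , λ z′≈z → trans (Embedding.⟦⟧-cong i′ z′≈z) iz≈y }

    liftAut : Automorphism N → Automorphism M
    liftAut σ = record { to = g ; from = from ; to∘from = to∘from ; from∘to = from∘to }
      where
      g = map (proj₁ (TraceForm.extends incl N-spanning (incl ∘ₑ Automorphism.to σ)))
      open Inverse (inverseOf g)

    private
      module GM = Group (Gal M)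
      module GN = Group (Gal N)

      Lifts : Automorphism M → Automorphism N → Set
      Lifts τ σ = ∀ x → Automorphism.⟦_⟧ τ (proj₁ x) ≈ proj₁ (Automorphism.⟦_⟧ σ x)

      lifts-∙ : ∀ {τ τ′ σ σ′} → Lifts τ σ → Lifts τ′ σ′ → Lifts (τ GM.∙ τ′) (σ GN.∙ σ′)
      lifts-∙ {τ} p q x = trans (Embedding.⟦⟧-cong (Automorphism.to τ) (q x)) (p _)

      lifts-⁻¹ : ∀ {τ σ} → Lifts τ σ → Lifts (τ GM.⁻¹) (σ GN.⁻¹)
      lifts-⁻¹ {τ} {σ} p x = trans (Embedding.⟦⟧-cong (Automorphism.from τ) (trans (sym (Automorphism.to∘from σ x)) (sym (p _))))
        (Automorphism.from∘to τ _)

      -- Restriction from Gal M to Gal N is surjective, hence surjective on each derived subgroup.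
      -- The relation `Lifts` expresses this without naming the restriction homomorphism.
      lift-derived : ∀ {n σ} → DerivedSeries (Gal N) n σ → Σ (Automorphism M) λ τ → DerivedSeries (Gal M) n τ × Lifts τ σ
      lift-derived (whole σ) = liftAut σ , whole _ , λ x → sym (proj₂ (TraceForm.extends incl N-spanning (incl ∘ₑ Automorphism.to σ)) x)
      lift-derived (commutator {g = σ} {σ′} d d′) =
        let (τ , e , p) = lift-derived d ; (τ′ , e′ , p′) = lift-derived d′ in
        _ , commutator e e′ , lifts-∙ {((τ GM.∙ τ′) GM.∙ (τ GM.⁻¹))} {τ′ GM.⁻¹} {((σ GN.∙ σ′) GN.∙ (σ GN.⁻¹))} {σ′ GN.⁻¹}
          (lifts-∙ {τ GM.∙ τ′} {τ GM.⁻¹} {σ GN.∙ σ′} {σ GN.⁻¹} (lifts-∙ {τ} {τ′} {σ} {σ′} p p′) (lifts-⁻¹ {τ} {σ} p)) (lifts-⁻¹ {τ′} {σ′} p′)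
      lift-derived unit = GM.ε , unit , λ _ → refl
      lift-derived (product {g = σ} {σ′} d d′) =
        let (τ , e , p) = lift-derived d ; (τ′ , e′ , p′) = lift-derived d′ in
        _ , product e e′ , lifts-∙ {τ} {τ′} {σ} {σ′} p p′
      lift-derived (inv {g = σ} d) = let (τ , e , p) = lift-derived d in _ , inv e , lifts-⁻¹ {τ} {σ} p
      lift-derived (resp σ≈σ′ d) = let (τ , e , p) = lift-derived d in τ , e , λ x → trans (p x) (σ≈σ′ x)

    solvable : ∀ {n} → FixedByDerived M n → Solvable (Gal N)
    solvable {n} fixed-by-derived = n , λ σ d x → let (τ , e , p) = lift-derived d in
      trans (sym (p x)) (fixed-by-derived idₑ τ e (proj₁ x))

-- Adjoining a square root to an extension of K

sum-++₂ : ∀ (F : Field) {A B : Set} (h : A → B → Field.Carrier F) {m n}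
  (xs : Vector A m) (xs′ : Vector B m) (ys : Vector A n) (ys′ : Vector B n) → let open FieldProperties F in
  sum (λ i → h ((xs ++ ys) i) ((xs′ ++ ys′) i)) ≈ sum (λ i → h (xs i) (xs′ i)) + sum (λ i → h (ys i) (ys′ i))
sum-++₂ F h {zero}  xs xs′ ys ys′ = sym (+-identityˡ _)
  where open FieldProperties F
sum-++₂ F h {suc m} xs xs′ ys ys′ = trans (+-congˡ (trans
    (sum-cong-≋ (λ i → reflexive (≡.cong₂ h (++-suc xs ys i) (++-suc xs′ ys′ i)))) (sum-++₂ F h (tail xs) (tail xs′) ys ys′)))
  (sym (+-assoc _ _ _))
  where open FieldProperties F

++-all : ∀ {A : Set} (P : A → Set) {m n} (xs : Vector A m) (ys : Vector A n) →
  (∀ i → P (xs i)) → (∀ j → P (ys j)) → ∀ k → P ((xs ++ ys) k)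
++-all P {m} xs ys p q k with splitAt m k
... | inj₁ i = p i
... | inj₂ j = q j

module QuadraticStep {K : Field} (E : Extension K) (d : Extension.Carrier E)
  (d-nonsquare : ¬ Square (Extension.top E) d) where
  private
    module K = FieldProperties K
    module E = ExtensionProperties E
    module Q = QuadraticExtension (Extension.top E) d d-nonsquare
    module E² = ExtensionProperties Q.extension²

  E√d : Extension K
  E√d = record
    { top = Q.field²
    ; base = Compose.ringHomomorphism {M₁ = Field.ring K} {M₂ = Extension.ring E} {M₃ = Field.ring Q.field²}
               (Extension.base E) (Extension.base Q.extension²) }

  inject : Embedding E E√d
  inject = record { hom = Extension.base Q.extension² ; fixes = λ _ → E².refl }

  spanning² : Spanning E → Spanning E√d
  spanning² s = record
    { vec = (λ k → E².ι (vec k)) ++ (λ k → E².ι (vec k) E².* Q.√d)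
    ; coord = λ (x , y) → coord x ++ coord y
    ; expand = λ (x , y) → begin
        x , y                                             ≈⟨ Q.a+b√d x y ⟩
        E².ι x E².+ E².ι y E².* Q.√d                      ≈⟨ E².+-cong (component x) (E².trans (E².*-congʳ {x = Q.√d} (component y))
                                                               (E².trans (E².*-distribʳ-sum Q.√d (λ k → ι (coord y k) E².* E².ι (vec k)))
                                                                 (E².sum-cong-≋ {x = λ k → (ι (coord y k) E².* E².ι (vec k)) E².* Q.√d} (λ k → E².*-assoc (ι (coord y k)) (E².ι (vec k)) Q.√d)))) ⟩
        E².sum (λ k → ι (coord x k) E².* E².ι (vec k)) E².+ E².sum (λ k → ι (coord y k) E².* (E².ι (vec k) E².* Q.√d))
          ≈⟨ sum-++₂ Q.field² (λ c v → ι c E².* v) (coord x) (λ k → E².ι (vec k)) (coord y) (λ k → E².ι (vec k) E².* Q.√d) ⟨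
        E².sum (λ k → ι ((coord x ++ coord y) k) E².* ((λ k → E².ι (vec k)) ++ (λ k → E².ι (vec k) E².* Q.√d)) k) ∎ }
    where
    open Spanning s
    open SetoidReasoning E².setoid
    open Extension E√d using (ι)
    component : ∀ x → E².ι x E².≈ E².sum (λ k → ι (coord x k) E².* E².ι (vec k))
    component x = E².trans (E².ι-cong (expand x)) (EmbeddingProperties.combination-hom inject (coord x) vec)

  module _ {Ω : Extension K} where
    private
      module Ω = ExtensionProperties Ω

    extend : (f : Embedding E Ω) (s : Ω.Carrier) → s Ω.* s Ω.≈ f · d → Embedding E√d Ω
    extend f s ss≈fd = mkEmbedding E√d Ω (λ (x , y) → f · x Ω.+ f · y Ω.* s)
      (λ (p , q) → Ω.+-cong (f.cong p) (Ω.*-congʳ (f.cong q)))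
      (λ (x , y) (x′ , y′) → Ω.trans (Ω.+-cong (f.+-hom x x′) (Ω.*-congʳ (f.+-hom y y′)))
        (Ω.solve 5 (λ x y x′ y′ s → (x Ω.:+ x′) Ω.:+ (y Ω.:+ y′) Ω.:* s Ω.:= (x Ω.:+ y Ω.:* s) Ω.:+ (x′ Ω.:+ y′ Ω.:* s))
          Ω.refl (f · x) (f · y) (f · x′) (f · y′) s))
      (λ (x , y) (x′ , y′) → Ω.trans (Ω.+-cong
            (Ω.trans (f.+-hom _ _) (Ω.+-cong (f.*-hom x x′) (Ω.trans (f.*-hom d (y E.* y′)) (Ω.*-cong (Ω.sym ss≈fd) (f.*-hom y y′)))))
            (Ω.*-congʳ (Ω.trans (f.+-hom _ _) (Ω.+-cong (f.*-hom x y′) (f.*-hom y x′)))))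
        (Ω.solve 5 (λ x y x′ y′ s → (x Ω.:* x′ Ω.:+ (s Ω.:* s) Ω.:* (y Ω.:* y′)) Ω.:+ (x Ω.:* y′ Ω.:+ y Ω.:* x′) Ω.:* s
                      Ω.:= (x Ω.:+ y Ω.:* s) Ω.:* (x′ Ω.:+ y′ Ω.:* s))
          Ω.refl (f · x) (f · y) (f · x′) (f · y′) s))
      (λ k → Ω.trans (Ω.+-cong (f.fixes k) (Ω.trans (Ω.*-congʳ f.0-hom) (Ω.zeroˡ s))) (Ω.+-identityʳ _))
      where module f = EmbeddingProperties f

    extend-inject : ∀ (f : Embedding E Ω) s (p : s Ω.* s Ω.≈ f · d) x → extend f s p · (inject · x) Ω.≈ f · x
    extend-inject f s p x = Ω.trans (Ω.+-congˡ (Ω.trans (Ω.*-congʳ (EmbeddingProperties.0-hom f)) (Ω.zeroˡ s))) (Ω.+-identityʳ _)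

    module _ (family : Family E Ω) where
      open Family family

      Extends : Family E√d Ω → Set
      Extends family′ = ∀ k → ∃ λ j → Family.map family′ k ∘ₑ inject ≐ map j

      -- Each f_j is extended by both choices of the root of f_j(d). In the sum the terms with √d
      -- cancel and the others double, so it again has values in K.
      extend-family : (∀ j → Square (Extension.top Ω) (map j · d)) → Σ (Family E√d Ω) Extends
      extend-family squares = record
        { size = size ℕ.+ suc size
        ; map = both
        ; trace = λ (x , y) → trace x K.+ trace x
        ; sum-map = λ z@(x , y) → begin
            Ω.sum (λ k → both k · z)
              ≈⟨ SumProperties.sum-++ (Extension.top Ω) (λ g → g · z) plus minus ⟩
            Ω.sum (λ j → map j · x Ω.+ map j · y Ω.* root j) Ω.+ Ω.sum (λ j → map j · x Ω.+ map j · y Ω.* (Ω.- root j))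
              ≈⟨ Ω.∑-distrib-+ (λ j → map j · x Ω.+ map j · y Ω.* root j) (λ j → map j · x Ω.+ map j · y Ω.* (Ω.- root j)) ⟨
            Ω.sum (λ j → (map j · x Ω.+ map j · y Ω.* root j) Ω.+ (map j · x Ω.+ map j · y Ω.* (Ω.- root j)))
              ≈⟨ Ω.sum-cong-≋ (λ j → Ω.solve 3 (λ x y s → (x Ω.:+ y Ω.:* s) Ω.:+ (x Ω.:+ y Ω.:* (Ω.:- s)) Ω.:= x Ω.:+ x) Ω.refl (map j · x) (map j · y) (root j)) ⟩
            Ω.sum (λ j → map j · x Ω.+ map j · x)
              ≈⟨ Ω.∑-distrib-+ (λ j → map j · x) (λ j → map j · x) ⟩
            Ω.sum (λ j → map j · x) Ω.+ Ω.sum (λ j → map j · x)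
              ≈⟨ Ω.+-cong (sum-map x) (sum-map x) ⟩
            Ω.ι (trace x) Ω.+ Ω.ι (trace x)
              ≈⟨ Ω.ι-+ _ _ ⟨
            Ω.ι (trace x K.+ trace x) ∎ }
        , extends-both
        where
        open SetoidReasoning Ω.setoid
        root : Fin (suc size) → Ω.Carrier
        root j = proj₁ (squares j)
        negated-root : ∀ j → (Ω.- root j) Ω.* (Ω.- root j) Ω.≈ map j · d
        negated-root j = Ω.trans (Ω.solve 1 (λ s → (Ω.:- s) Ω.:* (Ω.:- s) Ω.:= s Ω.:* s) Ω.refl (root j)) (proj₂ (squares j))
        plus minus : Fin (suc size) → Embedding E√d Ω
        plus j = extend (map j) (root j) (proj₂ (squares j))
        minus j = extend (map j) (Ω.- root j) (negated-root j)
        both : Fin (suc size ℕ.+ suc size) → Embedding E√d Ω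
        both = plus ++ minus
        Restricted : Embedding E√d Ω → Set
        Restricted g = ∃ λ j → g ∘ₑ inject ≐ map j
        extends-both : ∀ k → Restricted (both k)
        extends-both = ++-all Restricted plus minus
          (λ j → j , extend-inject (map j) (root j) (proj₂ (squares j)))
          (λ j → j , extend-inject (map j) (Ω.- root j) (negated-root j))

  -- Automorphisms fixing E send √d to ±√d, so their commutators fix E(√d).
  fixedByDerived² : ∀ {n} → FixedByDerived E n → FixedByDerived E√d (suc n)
  fixedByDerived² {n} E-fixed {M} i σ σ∈ = fixes σ∈
    where
    open ExtensionProperties M
    open SetoidReasoning setoid
    module i = EmbeddingProperties i
    module G = Group (Gal M)
    infixl 9 _⟪_⟫
    _⟪_⟫ : Automorphism M → Carrier → Carrier
    σ ⟪ x ⟫ = Automorphism.⟦_⟧ σ x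
    cong-⟪⟫ : ∀ (σ : Automorphism M) {x y} → x ≈ y → σ ⟪ x ⟫ ≈ σ ⟪ y ⟫
    cong-⟪⟫ σ = Embedding.⟦⟧-cong (Automorphism.to σ)

    r : Carrier
    r = i · Q.√d

    sgn : Bool → Carrier
    sgn true  = r
    sgn false = - r

    _⊙_ : Bool → Bool → Bool
    true  ⊙ b = b
    false ⊙ true = false
    false ⊙ false = true

    Acts : Automorphism M → Bool → Set
    Acts σ b = σ ⟪ r ⟫ ≈ sgn b

    acts-∙ : ∀ {σ τ b c} → Acts σ b → Acts τ c → Acts (σ G.∙ τ) (b ⊙ c)
    acts-∙ {σ} {τ} {true}  {true}  p q = trans (cong-⟪⟫ σ q) p
    acts-∙ {σ} {τ} {true}  {false} p q = trans (cong-⟪⟫ σ q) (trans (Embedding.-‿homo (Automorphism.to σ) r) (-‿cong p))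
    acts-∙ {σ} {τ} {false} {true}  p q = trans (cong-⟪⟫ σ q) p
    acts-∙ {σ} {τ} {false} {false} p q = trans (cong-⟪⟫ σ q) (trans (Embedding.-‿homo (Automorphism.to σ) r) (trans (-‿cong p) (-‿involutive r)))

    acts-⁻¹ : ∀ {σ b} → Acts σ b → Acts (σ G.⁻¹) b
    acts-⁻¹ {σ} {true}  p = trans (cong-⟪⟫ (σ G.⁻¹) (sym p)) (Automorphism.from∘to σ r)
    acts-⁻¹ {σ} {false} p = trans (cong-⟪⟫ (σ G.⁻¹) (sym (trans (Embedding.-‿homo (Automorphism.to σ) r) (trans (-‿cong p) (-‿involutive r)))))
      (Automorphism.from∘to σ (- r))

    acts : ∀ {σ} → DerivedSeries (Gal M) n σ → ∃ (Acts σ)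
    acts {σ} σ∈ = [ (λ p → true , x-y≈0⇒x≈y p) , (λ p → false , x-y≈0⇒x≈y (trans (+-congˡ (-‿involutive r)) p)) ]′
      (zero-product {σ ⟪ r ⟫ - r} {σ ⟪ r ⟫ + r} (begin
        (σ ⟪ r ⟫ - r) * (σ ⟪ r ⟫ + r)      ≈⟨ solve 2 (λ s r → (s :- r) :* (s :+ r) := s :* s :- r :* r) refl (σ ⟪ r ⟫) r ⟩
        σ ⟪ r ⟫ * σ ⟪ r ⟫ - r * r          ≈⟨ +-cong (Embedding.*-homo (Automorphism.to σ) r r) (-‿cong rr≈) ⟨
        σ ⟪ r * r ⟫ - i · (inject · d)     ≈⟨ +-congʳ (trans (cong-⟪⟫ σ (sym rr≈)) (E-fixed (i ∘ₑ inject) σ σ∈ d)) ⟩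
        i · (inject · d) - i · (inject · d)   ≈⟨ -‿inverseʳ _ ⟩
        0#                                 ∎))
      where
      rr≈ : i · (inject · d) ≈ r * r
      rr≈ = trans (i.cong (E².sym Q.√d²)) (i.*-hom Q.√d Q.√d)

    Fixes : Automorphism M → Set
    Fixes σ = ∀ z → σ ⟪ i · z ⟫ ≈ i · z

    fixes-∙ : ∀ {x} σ τ → σ ⟪ x ⟫ ≈ x → τ ⟪ x ⟫ ≈ x → (σ G.∙ τ) ⟪ x ⟫ ≈ x
    fixes-∙ σ τ p q = trans (cong-⟪⟫ σ q) p

    fixes-⁻¹ : ∀ {x} σ → σ ⟪ x ⟫ ≈ x → (σ G.⁻¹) ⟪ x ⟫ ≈ x
    fixes-⁻¹ {x} σ p = trans (cong-⟪⟫ (σ G.⁻¹) (sym p)) (Automorphism.from∘to σ x)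

    generated : ∀ σ → (∀ x → σ ⟪ i · (inject · x) ⟫ ≈ i · (inject · x)) → σ ⟪ r ⟫ ≈ r → Fixes σ
    generated σ p q (x , y) = begin
      σ ⟪ i · (x , y) ⟫                                             ≈⟨ cong-⟪⟫ σ split ⟩
      σ ⟪ i · (inject · x) + i · (inject · y) * r ⟫                 ≈⟨ trans (Embedding.+-homo s _ _) (+-congˡ (Embedding.*-homo s _ _)) ⟩
      σ ⟪ i · (inject · x) ⟫ + σ ⟪ i · (inject · y) ⟫ * σ ⟪ r ⟫     ≈⟨ +-cong (p x) (*-cong (p y) q) ⟩
      i · (inject · x) + i · (inject · y) * r                       ≈⟨ split ⟨
      i · (x , y)                                                   ∎
      where
      s = Automorphism.to σ
      split : i · (x , y) ≈ i · (inject · x) + i · (inject · y) * r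
      split = trans (i.cong (Q.a+b√d x y)) (trans (i.+-hom _ _) (+-congˡ (i.*-hom _ _)))

    square-sign : ∀ b c → ((b ⊙ c) ⊙ b) ⊙ c ≡ true
    square-sign true  true  = ≡.refl
    square-sign true  false = ≡.refl
    square-sign false true  = ≡.refl
    square-sign false false = ≡.refl

    fixes : ∀ {σ} → DerivedSeries (Gal M) (suc n) σ → Fixes σ
    fixes (commutator {g = σ} {τ} σ∈ τ∈) = generated (((σ G.∙ τ) G.∙ σ G.⁻¹) G.∙ τ G.⁻¹)
      (λ x → let p = E-fixed (i ∘ₑ inject) σ σ∈ x ; q = E-fixed (i ∘ₑ inject) τ τ∈ x in
        fixes-∙ ((σ G.∙ τ) G.∙ σ G.⁻¹) (τ G.⁻¹) (fixes-∙ (σ G.∙ τ) (σ G.⁻¹) (fixes-∙ σ τ p q) (fixes-⁻¹ σ p)) (fixes-⁻¹ τ q))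
      (let (b , p) = acts σ∈ ; (c , q) = acts τ∈ in
        trans (acts-∙ {(σ G.∙ τ) G.∙ σ G.⁻¹} {τ G.⁻¹} {(b ⊙ c) ⊙ b} {c} (acts-∙ {σ G.∙ τ} {σ G.⁻¹} {b ⊙ c} {b} (acts-∙ {σ} {τ} {b} {c} p q) (acts-⁻¹ {σ} {b} p)) (acts-⁻¹ {τ} {c} q))
          (reflexive (≡.cong sgn (square-sign b c))))
    fixes unit = λ _ → refl
    fixes (product {g = σ} {τ} p q) = λ z → fixes-∙ σ τ (fixes p z) (fixes q z)
    fixes (inv {g = σ} p) = λ z → fixes-⁻¹ σ (fixes p z)
    fixes (resp σ≈τ p) = λ z → trans (sym (σ≈τ _)) (fixes p z)

  exhaustion² : Exhaustion (Extension.top E) → Exhaustion (Extension.top E√d)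
  exhaustion² ex = record
    { size = λ n → size n ℕ.* size n
    ; element = λ n k → pair n (remQuot {size n} (size n) k)
    ; contains-0 = λ n → pair-∈ n (contains-0 n) (contains-0 n)
    ; exhausts = λ (x , y) → let (m , p) = exhausts x ; (m′ , p′) = exhausts y in
        m ℕ.+ m′ , λ n m≤n → pair-∈ n (p n (ℕₚ.≤-trans (ℕₚ.m≤m+n m m′) m≤n)) (p′ n (ℕₚ.≤-trans (ℕₚ.m≤n+m m′ m) m≤n)) }
    where
    open Exhaustion ex
    pair : ∀ n → Fin (size n) × Fin (size n) → E².Carrier
    pair n (j , k) = element n j , element n k
    pair-∈ : ∀ n {x y} → x ∈ₙ n → y ∈ₙ n → ∃ λ k → pair n (remQuot {size n} (size n) k) E².≈ (x , y)
    pair-∈ n (j , p) (k , q) = combine j k , E².trans (E².reflexive (≡.cong (pair n) (Finₚ.remQuot-combine j k))) (p , q)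

  exhaustion²-inject : ∀ (ex : Exhaustion (Extension.top E)) n {x} → Exhaustion._∈ₙ_ ex x n → Exhaustion._∈ₙ_ (exhaustion² ex) (inject · x) n
  exhaustion²-inject ex n (j , p) = let (k , q) = Exhaustion.contains-0 ex n in
    combine j k , E².trans (E².reflexive (≡.cong (λ (a , b) → Exhaustion.element ex n a , Exhaustion.element ex n b)
      (Finₚ.remQuot-combine {Exhaustion.size ex n} j k))) (p , q)

-- Towers of quadratic extensions and Galois stages

module _ {K : Field} where

  1+_² : {E : Extension K} → Extension.Carrier E → Extension.Carrier E
  1+_² {E} x = 1# + x * x
    where open Extension E

  IsSquare : (E : Extension K) → Extension.Carrier E → Set
  IsSquare E = Square (Extension.top E)

  module _ {E F : Extension K} (f : Embedding E F) where
    private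
      module E = ExtensionProperties E
      module F = ExtensionProperties F
      module f = EmbeddingProperties f

    isSquare-hom : ∀ {x} → IsSquare E x → IsSquare F (f · x)
    isSquare-hom (y , yy≈x) = f · y , F.trans (F.sym (f.*-hom y y)) (f.cong yy≈x)

    1+²-hom : ∀ x → f · (1+_² {E} x) F.≈ 1+_² {F} (f · x)
    1+²-hom x = F.trans (f.+-hom _ _) (F.+-cong f.1-hom (f.*-hom x x))

  1+²-cong : (E : Extension K) → ∀ {x y} → Extension._≈_ E x y → Extension._≈_ E (1+_² {E} x) (1+_² {E} y)
  1+²-cong E x≈y = +-congˡ (*-cong x≈y x≈y)
    where open Extension E

  -- What survives the adjunction of a single square root. A family of endomorphisms is missing
  -- because the field is in general not stable until the roots of all conjugates are present.
  record Tower : Set₁ where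
    field
      extension       : Extension K
      square?         : ∀ x → Dec (IsSquare extension x)
      formallyReal    : FormallyReal (Extension.top extension)
      spanning        : Spanning extension
      derivedLength   : ℕ
      fixedByDerived  : FixedByDerived extension derivedLength
      exhaustion      : Exhaustion (Extension.top extension)
    open Extension extension public using (Carrier)
    open Exhaustion exhaustion public using (_∈ₙ_)

  record _⊑_ (S T : Tower) : Set where
    private
      module S = Tower S
      module T = Tower T
    field
      embed       : Embedding S.extension T.extension
      embed-∈ₙ    : ∀ n {x} → x S.∈ₙ n → embed · x T.∈ₙ n

  ⊑-refl : ∀ {S} → S ⊑ S
  ⊑-refl = record { embed = idₑ ; embed-∈ₙ = λ _ p → p }

  ⊑-trans : ∀ {S T U} → S ⊑ T → T ⊑ U → S ⊑ U
  ⊑-trans p q = record { embed = _⊑_.embed q ∘ₑ _⊑_.embed p ; embed-∈ₙ = λ n → _⊑_.embed-∈ₙ q n ∘ _⊑_.embed-∈ₙ p n }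

  FamilyOver : {E F Ω : Extension K} → Embedding E F → Family E Ω → Family F Ω → Set
  FamilyOver e family family′ = ∀ k → ∃ λ j → Family.map family′ k ∘ₑ e ≐ Family.map family j

  -- The target Ω in `lift` is arbitrary since the required roots exist only once every element has
  -- been treated: the domain grows one root at a time while Ω is already the final field.
  record Adjunction (S : Tower) {n} (c : Fin n → Tower.Carrier S) : Set₁ where
    field
      tower    : Tower
      below    : S ⊑ tower
    open _⊑_ below public
    field
      squares  : ∀ i → IsSquare (Tower.extension tower) (embed · (1+_² {Tower.extension S} (c i)))
      lift     : ∀ {Ω : Extension K} (family : Family (Tower.extension S) Ω) →
                 (∀ i j → IsSquare Ω (Family.map family j · (1+_² {Tower.extension S} (c i)))) →
                 Σ (Family (Tower.extension tower) Ω) (FamilyOver embed family)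

  private
    module AdjoinOne (S : Tower) (c : Tower.Carrier S) where
      open Tower S
      module E = ExtensionProperties extension
      d = 1+_² {extension} c

      adjoin : Adjunction S {1} (λ _ → c)
      adjoin with square? d
      ... | yes s = record
        { tower = S
        ; below = ⊑-refl
        ; squares = λ _ → s
        ; lift = λ {Ω} family _ → family , λ k → k , λ _ → Extension.refl Ω }
      ... | no d-nonsquare = record
        { tower = record
          { extension = E√d
          ; square? = SquareDecision.square²? (Extension.top extension) d d-nonsquare
              (FormallyRealProperties.2≉0 (Extension.top extension) formallyReal) square?
          ; formallyReal = PythagoreanStep.formallyReal² (Extension.top extension) formallyReal c d E.refl d-nonsquare
          ; spanning = spanning² spanning
          ; derivedLength = suc derivedLength
          ; fixedByDerived = fixedByDerived² fixedByDerived
          ; exhaustion = exhaustion² exhaustion }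
        ; below = record { embed = inject ; embed-∈ₙ = exhaustion²-inject exhaustion }
        ; squares = λ _ → Q.√d , Q.√d²
        ; lift = λ family squares → extend-family family (squares zero) }
        where
        open QuadraticStep extension d d-nonsquare
        module Q = QuadraticExtension (Extension.top extension) d d-nonsquare

  adjoinAll : (S : Tower) → ∀ {n} (c : Fin n → Tower.Carrier S) → Adjunction S c
  adjoinAll S {zero} c = record
    { tower = S ; below = ⊑-refl ; squares = λ () ; lift = λ {Ω} family _ → family , λ k → k , λ _ → Extension.refl Ω }
  adjoinAll S {suc n} c = record
    { tower = T.tower
    ; below = ⊑-trans A.below T.below
    ; squares = λ
      { zero → isSquare-hom T.embed (A.squares zero)
      ; (suc i) → Square-cong (Extension.top (Tower.extension T.tower))
          (Embedding.⟦⟧-cong T.embed (Extension.sym (Tower.extension A.tower) (1+²-hom A.embed (c (suc i))))) (T.squares i) }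
    ; lift = lift }
    where
    module A = Adjunction (AdjoinOne.adjoin S (c zero))
    module T = Adjunction (adjoinAll A.tower (λ i → A.embed · c (suc i)))
    lift : ∀ {Ω : Extension K} (family : Family (Tower.extension S) Ω) →
      (∀ i j → IsSquare Ω (Family.map family j · (1+_² {Tower.extension S} (c i)))) →
      Σ (Family (Tower.extension T.tower) Ω) (FamilyOver (T.embed ∘ₑ A.embed) family)
    lift {Ω} family family-squares = proj₁ second , λ k →
        let (j , p) = proj₂ second k ; (j′ , p′) = proj₂ first j in
        j′ , λ x → Extension.trans Ω (p (A.embed · x)) (p′ x)
      where
      first : Σ (Family (Tower.extension A.tower) Ω) (FamilyOver A.embed family)
      first = A.lift family (λ _ → family-squares zero)
      second : Σ (Family (Tower.extension T.tower) Ω) (FamilyOver T.embed (proj₁ first))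
      -- A member of the first lifted family restricts on S to a member of the given one, so the
      -- remaining squares come from the hypothesis.
      second = T.lift (proj₁ first) (λ i j → let (j′ , p′) = proj₂ first j in
        Square-cong (Extension.top Ω) (Extension.trans Ω (Extension.sym Ω (p′ _)) (Embedding.⟦⟧-cong (Family.map (proj₁ first) j) (1+²-hom A.embed (c (suc i)))))
          (family-squares (suc i) j′))

  record Stage : Set₁ where
    field
      tower   : Tower
      family  : Family (Tower.extension tower) (Tower.extension tower)
    open Tower tower public

  postcompose : {E F G : Extension K} → Embedding F G → Family E F → Family E G
  postcompose {G = G} g family = record
    { size = size
    ; map = λ j → g ∘ₑ map j
    ; trace = trace
    ; sum-map = λ x → G.trans (G.sym (EmbeddingProperties.sum-hom g (λ j → map j · x)))
        (G.trans (Embedding.⟦⟧-cong g (sum-map x)) (Embedding.fixes g _)) }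
    where
    open Family family
    module G = ExtensionProperties G

  record Enlargement (S : Stage) {n} (a : Fin n → Stage.Carrier S) : Set₁ where
    field
      stage    : Stage
      below    : Stage.tower S ⊑ Stage.tower stage
    open _⊑_ below public
    field
      squares  : ∀ i → IsSquare (Stage.extension stage) (embed · (1+_² {Stage.extension S} (a i)))

  -- The conjugates of 1 + a² are adjoined together, so that every
  -- endomorphism extends.
  enlargeOne : (S : Stage) (a : Stage.Carrier S) → Enlargement S {1} (λ _ → a)
  enlargeOne S a = record
    { stage = record { tower = tower ; family = proj₁ lifted }
    ; below = below
    -- The identity is among the f_j, so a is one of the conjugates treated.
    ; squares = λ _ → let (j , id≐) = listed idₑ in
        Square-cong (Extension.top (Tower.extension tower))
          (Embedding.⟦⟧-cong embed (1+²-cong (Stage.extension S) (Extension.sym (Stage.extension S) (id≐ a)))) (squares j) }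
    where
    open Stage S using (extension; formallyReal; spanning; family)
    open Family family using (size; map)
    open GaloisTheory extension formallyReal spanning family using (listed)
    A : Adjunction (Stage.tower S) (λ j → map j · a)
    A = adjoinAll (Stage.tower S) (λ j → map j · a)
    open Adjunction A using (tower; below; embed; squares; lift)
    Ω = Tower.extension tower
    lifted : Σ (Family Ω Ω) (FamilyOver embed (postcompose embed family))
    -- The composite f_j f_i is listed as some f_l, so f_j sends 1 + f_i(a)² to 1 + f_l(a)², whose
    -- root has been adjoined too.
    lifted = lift (postcompose embed family) (λ i j → let (l , ji≐) = listed (map j ∘ₑ map i) in
      Square-cong (Extension.top Ω)
        (Embedding.⟦⟧-cong embed (Extension.sym extension (Extension.trans extension (1+²-hom (map j) (map i · a)) (1+²-cong extension (ji≐ a)))))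
        (squares l))

  enlarge : (S : Stage) → ∀ {n} (a : Fin n → Stage.Carrier S) → Enlargement S a
  enlarge S {zero} a = record { stage = S ; below = ⊑-refl ; squares = λ () }
  enlarge S {suc n} a = record
    { stage = T.stage
    ; below = ⊑-trans A.below T.below
    ; squares = λ
      { zero → isSquare-hom T.embed (A.squares zero)
      ; (suc i) → Square-cong (Extension.top (Stage.extension T.stage))
          (Embedding.⟦⟧-cong T.embed (Extension.sym (Stage.extension A.stage) (1+²-hom A.embed (a (suc i))))) (T.squares i) } }
    where
    module A = Enlargement (enlargeOne S (a zero))
    module T = Enlargement (enlarge A.stage (λ i → A.embed · a (suc i)))

  module Sequence (square? : ∀ x → Dec (Square K x)) (real : FormallyReal K) (exhaustion : Exhaustion K) where
    private
      module K = FieldProperties K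

    base : Stage
    base = record
      { tower = record
        { extension = trivial
        ; square? = square?
        ; formallyReal = real
        ; spanning = record
          { vec = λ (_ : Fin 1) → K.1#
          ; coord = λ x _ → x
          ; expand = λ x → K.sym (K.trans (K.+-identityʳ _) (K.*-identityʳ x)) }
        ; derivedLength = 0
        ; fixedByDerived = λ {M} i σ _ x → Extension.trans M (Embedding.⟦⟧-cong (Automorphism.to σ) (Embedding.fixes i x))
            (Extension.trans M (Embedding.fixes (Automorphism.to σ) x) (Extension.sym M (Embedding.fixes i x)))
        ; exhaustion = exhaustion }
      ; family = record
        { size = 0 ; map = λ _ → idₑ ; trace = λ x → x ; sum-map = K.+-identityʳ } }
      where
      trivial : Extension K
      trivial = record { top = K ; base = Identity.ringHomomorphism (Field.ring K) }

    -- One index counts both the stages and the lists. An element that lies in all lists from m on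
    -- is thus reached at any stage k ≥ m in which it is present.
    stage : ℕ → Stage
    next : ∀ k → Enlargement (stage k) (Exhaustion.element (Stage.exhaustion (stage k)) k)
    stage zero    = base
    stage (suc k) = Enlargement.stage (next k)
    next k = enlarge (stage k) (Exhaustion.element (Stage.exhaustion (stage k)) k)

-- The union of a chain of fields

-- Elements of the union of a chain of fields are eventually coherent sequences up to
-- eventual equality; the values before the sequence becomes coherent are junk.
module Union {K : Field} (E : ℕ → Extension K) (step : ∀ k → Embedding (E k) (E (suc k))) where
  private
    module K = Field K
    module E k = ExtensionProperties (E k)
    module step k = EmbeddingProperties (step k)

  Sequence : Set
  Sequence = ∀ k → E.Carrier k

  CoherentFrom : ℕ → Sequence → Set
  CoherentFrom n f = ∀ k → n ≤ k → E._≈_ (suc k) (step k · f k) (f (suc k))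

  AgreeFrom : ℕ → Sequence → Sequence → Set
  AgreeFrom n f g = ∀ k → n ≤ k → E._≈_ k (f k) (g k)

  coherent-later : ∀ {m n f} → m ≤ n → CoherentFrom m f → CoherentFrom n f
  coherent-later m≤n c k n≤k = c k (ℕₚ.≤-trans m≤n n≤k)

  agree-forward : ∀ {n f g} → CoherentFrom n f → CoherentFrom n g → E._≈_ n (f n) (g n) → AgreeFrom n f g
  agree-forward {n} {f} {g} cf cg fn≈gn k n≤k = go (ℕₚ.≤⇒≤′ n≤k)
    where
    go : ∀ {k} → n ≤′ k → E._≈_ k (f k) (g k)
    go (≤′-reflexive ≡.refl) = fn≈gn
    go (≤′-step {k} n≤′k) = E.trans (suc k) (E.sym (suc k) (cf k n≤k′)) (E.trans (suc k) (step.cong k (go n≤′k)) (cg k n≤k′))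
      where n≤k′ = ℕₚ.≤′⇒≤ n≤′k

  -- The steps are injective, so an agreement reached late can be pulled back to any index from
  -- which both sequences are coherent.
  agree-backward : ∀ {m n f g} → CoherentFrom m f → CoherentFrom m g → AgreeFrom n f g → E._≈_ m (f m) (g m)
  agree-backward {m} {n} {f} {g} cf cg f≈g = go (ℕₚ.≤⇒≤′ (ℕₚ.m≤m+n m n)) (f≈g (m ℕ.+ n) (ℕₚ.m≤n+m n m))
    where
    go : ∀ {k} → m ≤′ k → E._≈_ k (f k) (g k) → E._≈_ m (f m) (g m)
    go (≤′-reflexive ≡.refl) p = p
    go (≤′-step {k} m≤′k) p = go m≤′k (step.injective k
      (E.trans (suc k) (cf k m≤k) (E.trans (suc k) p (E.sym (suc k) (cg k m≤k)))))
      where m≤k = ℕₚ.≤′⇒≤ m≤′k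

  record Thread : Set where
    field
      value     : Sequence
      from      : ℕ
      coherent  : CoherentFrom from value
  open Thread

  coherent-both : ∀ x y → CoherentFrom (from x ℕ.+ from y) (value x) × CoherentFrom (from x ℕ.+ from y) (value y)
  coherent-both x y = coherent-later (ℕₚ.m≤m+n (from x) (from y)) (coherent x) , coherent-later (ℕₚ.m≤n+m (from y) (from x)) (coherent y)

  coherent-+ : ∀ {n f g} → CoherentFrom n f → CoherentFrom n g → CoherentFrom n (λ k → E._+_ k (f k) (g k))
  coherent-+ cf cg k n≤k = E.trans (suc k) (step.+-hom k _ _) (E.+-cong (suc k) (cf k n≤k) (cg k n≤k))

  coherent-* : ∀ {n f g} → CoherentFrom n f → CoherentFrom n g → CoherentFrom n (λ k → E._*_ k (f k) (g k))
  coherent-* cf cg k n≤k = E.trans (suc k) (step.*-hom k _ _) (E.*-cong (suc k) (cf k n≤k) (cg k n≤k))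

  coherent-ι : ∀ {n} q → CoherentFrom n (λ k → E.ι k q)
  coherent-ι q k _ = step.fixes k q

  infix 4 _≈ₜ_
  record _≈ₜ_ (x y : Thread) : Set where
    constructor _,_
    field
      since  : ℕ
      agree  : AgreeFrom since (value x) (value y)

  _+ₜ_ _*ₜ_ : Thread → Thread → Thread
  x +ₜ y = record
    { value = λ k → E._+_ k (value x k) (value y k) ; from = from x ℕ.+ from y
    ; coherent = coherent-+ (proj₁ (coherent-both x y)) (proj₂ (coherent-both x y)) }
  x *ₜ y = record
    { value = λ k → E._*_ k (value x k) (value y k) ; from = from x ℕ.+ from y
    ; coherent = coherent-* (proj₁ (coherent-both x y)) (proj₂ (coherent-both x y)) }

  -ₜ_ : Thread → Thread
  -ₜ x = record
    { value = λ k → E.-_ k (value x k) ; from = from x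
    ; coherent = λ k n≤k → E.trans (suc k) (step.neg-hom k _) (E.-‿cong (suc k) (coherent x k n≤k)) }

  constant : K.Carrier → Thread
  constant q = record { value = λ k → E.ι k q ; from = 0 ; coherent = coherent-ι q }

  0ₜ 1ₜ : Thread
  0ₜ = record { value = λ k → E.0# k ; from = 0 ; coherent = λ k _ → step.0-hom k }
  1ₜ = record { value = λ k → E.1# k ; from = 0 ; coherent = λ k _ → step.1-hom k }

  always : ∀ {x y} → (∀ k → E._≈_ k (value x k) (value y k)) → x ≈ₜ y
  always p = 0 , λ k _ → p k

  agree-both : ∀ {x x′ y y′} (p : x ≈ₜ x′) (q : y ≈ₜ y′) →
    ∃ λ n → AgreeFrom n (value x) (value x′) × AgreeFrom n (value y) (value y′)
  agree-both (m , p) (n , q) = m ℕ.+ n , (λ k m+n≤k → p k (ℕₚ.≤-trans (ℕₚ.m≤m+n m n) m+n≤k))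
                                       , (λ k m+n≤k → q k (ℕₚ.≤-trans (ℕₚ.m≤n+m n m) m+n≤k))

  abstract
    isCommutativeRingₜ : IsCommutativeRing _≈ₜ_ _+ₜ_ _*ₜ_ -ₜ_ 0ₜ 1ₜ
    isCommutativeRingₜ = record
      { isRing = record
        { +-isAbelianGroup = record
          { isGroup = record
            { isMonoid = record
              { isSemigroup = record
                { isMagma = record
                  { isEquivalence = record
                    { refl = 0 , λ k _ → E.refl k
                    ; sym = λ (n , p) → n , λ k n≤k → E.sym k (p k n≤k)
                    ; trans = λ p q → let (n , p′ , q′) = agree-both p q in n , λ k n≤k → E.trans k (p′ k n≤k) (q′ k n≤k) }
                  ; ∙-cong = λ p q → let (n , p′ , q′) = agree-both p q in n , λ k n≤k → E.+-cong k (p′ k n≤k) (q′ k n≤k) }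
                ; assoc = λ _ _ _ → 0 , λ k _ → E.+-assoc k _ _ _ }
              ; identity = (λ _ → 0 , λ k _ → E.+-identityˡ k _) , (λ _ → 0 , λ k _ → E.+-identityʳ k _) }
            ; inverse = (λ _ → 0 , λ k _ → E.-‿inverseˡ k _) , (λ _ → 0 , λ k _ → E.-‿inverseʳ k _)
            ; ⁻¹-cong = λ (n , p) → n , λ k n≤k → E.-‿cong k (p k n≤k) }
          ; comm = λ _ _ → 0 , λ k _ → E.+-comm k _ _ }
        ; *-cong = λ p q → let (n , p′ , q′) = agree-both p q in n , λ k n≤k → E.*-cong k (p′ k n≤k) (q′ k n≤k)
        ; *-assoc = λ _ _ _ → 0 , λ k _ → E.*-assoc k _ _ _
        ; *-identity = (λ _ → 0 , λ k _ → E.*-identityˡ k _) , (λ _ → 0 , λ k _ → E.*-identityʳ k _)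
        ; distrib = (λ _ _ _ → 0 , λ k _ → E.distribˡ k _ _ _) , (λ _ _ _ → 0 , λ k _ → E.distribʳ k _ _ _) }
      ; *-comm = λ _ _ → 0 , λ k _ → E.*-comm k _ _ }

  ringₜ : CommutativeRing 0ℓ 0ℓ
  ringₜ = record { isCommutativeRing = isCommutativeRingₜ }

  -- Agreement propagates forwards along the chain and, by injectivity, backwards; one comparison at
  -- a common index of coherence decides eventual equality.
  _≟ₜ_ : ∀ x y → Dec (x ≈ₜ y)
  x ≟ₜ y = map′
    (λ p → m , agree-forward (proj₁ (coherent-both x y)) (proj₂ (coherent-both x y)) p)
    (λ (n , p) → agree-backward (proj₁ (coherent-both x y)) (proj₂ (coherent-both x y)) p)
    (E._≟_ m (value x m) (value y m))
    where m = from x ℕ.+ from y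

  private
    -- 1/0 = 0
    recip₀ : ∀ k → E.Carrier k → E.Carrier k
    recip₀ k x with E._≟_ k x (E.0# k)
    ... | yes _   = E.0# k
    ... | no x≉0  = E.recip k x x≉0

    recip₀ʳ : ∀ k x → ¬ E._≈_ k x (E.0# k) → E._≈_ k (E._*_ k x (recip₀ k x)) (E.1# k)
    recip₀ʳ k x x≉0 with E._≟_ k x (E.0# k)
    ... | yes x≈0 = contradiction x≈0 x≉0
    ... | no x≉0′ = E.recipʳ k x x≉0′

  -- A zero value at a coherent index would persist and make x equal to 0. All values from `from x`
  -- on are therefore invertible, and the convention 1/0 = 0 affects junk values only.
  inverseₜ : ∀ x → ¬ x ≈ₜ 0ₜ → ∃ λ y → (x *ₜ y) ≈ₜ 1ₜ
  inverseₜ x x≉0 = record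
      { value = λ k → recip₀ k (value x k)
      ; from = from x
      ; coherent = λ k n≤k → E.*-cancelˡ (suc k) {value x (suc k)} (nonzero (suc k) (ℕₚ.m≤n⇒m≤1+n n≤k))
          (E.trans (suc k) (E.*-congʳ (suc k) (E.sym (suc k) (coherent x k n≤k)))
          (E.trans (suc k) (E.sym (suc k) (step.*-hom k _ _))
          (E.trans (suc k) (step.cong k (recip₀ʳ k (value x k) (nonzero k n≤k)))
          (E.trans (suc k) (step.1-hom k) (E.sym (suc k) (recip₀ʳ (suc k) _ (nonzero (suc k) (ℕₚ.m≤n⇒m≤1+n n≤k)))))))) }
    , from x , λ k n≤k → recip₀ʳ k (value x k) (nonzero k n≤k)
    where
    nonzero : ∀ k → from x ≤ k → ¬ E._≈_ k (value x k) (E.0# k)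
    nonzero k n≤k p = x≉0 (k , agree-forward (coherent-later n≤k (coherent x)) (λ j _ → step.0-hom j) p)

  union : Extension K
  union = record
    { top = record
      { commutativeRing = ringₜ
      ; 1≉0 = λ (n , p) → E.1≉0 n (p n ℕₚ.≤-refl)
      ; inverse = inverseₜ
      ; _≟_ = _≟ₜ_ }
    ; base = record
      { ⟦_⟧ = constant
      ; isRingHomomorphism = record
        { isSemiringHomomorphism = record
          { isNearSemiringHomomorphism = record
            { +-isMonoidHomomorphism = record
              { isMagmaHomomorphism = record
                { isRelHomomorphism = record { cong = λ p → 0 , λ k _ → E.ι-cong k p }
                ; homo = λ x y → 0 , λ k _ → E.ι-+ k x y }
              ; ε-homo = 0 , λ k _ → E.ι-0 k }
            ; *-homo = λ x y → 0 , λ k _ → E.ι-* k x y }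
          ; 1#-homo = 0 , λ k _ → E.ι-1 k }
        ; -‿homo = λ x → 0 , λ k _ → E.ι-neg k x } } }

  push : ∀ {i k} → i ≤′ k → E.Carrier i → E.Carrier k
  push (≤′-reflexive ≡.refl) x = x
  push (≤′-step {k} p)       x = step k · push p x

  push-irrelevant : ∀ {i k} (p q : i ≤′ k) x → push p x ≡ push q x
  push-irrelevant (≤′-reflexive ≡.refl) (≤′-reflexive ≡.refl) x = ≡.refl
  push-irrelevant (≤′-reflexive ≡.refl) (≤′-step q)           x = contradiction (ℕₚ.≤′⇒≤ q) ℕₚ.1+n≰n
  push-irrelevant (≤′-step p)           (≤′-reflexive ≡.refl) x = contradiction (ℕₚ.≤′⇒≤ p) ℕₚ.1+n≰n
  push-irrelevant (≤′-step {k} p)       (≤′-step q)           x = ≡.cong (step k ·_) (push-irrelevant p q x)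

  private
    -- The junk value below i is 0.
    pushed : ∀ {i k} → Dec (i ≤′ k) → E.Carrier i → E.Carrier k
    pushed         (yes p) x = push p x
    pushed {k = k} (no  _) x = E.0# k

    _≤′?_ : ∀ i k → Dec (i ≤′ k)
    i ≤′? k = map′ ℕₚ.≤⇒≤′ ℕₚ.≤′⇒≤ (i ℕₚ.≤? k)

    pushed≡push : ∀ {i k} (d : Dec (i ≤′ k)) (p : i ≤′ k) x → pushed d x ≡ push p x
    pushed≡push (yes q) p x = push-irrelevant q p x
    pushed≡push (no ¬p) p x = contradiction p ¬p

  include : ∀ i → E.Carrier i → Thread
  include i x = record
    { value = λ k → pushed (i ≤′? k) x
    ; from = i
    ; coherent = λ k i≤k → E.reflexive (suc k) (≡.trans
        (≡.cong (step k ·_) (pushed≡push (i ≤′? k) (ℕₚ.≤⇒≤′ i≤k) x))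
        (≡.sym (pushed≡push (i ≤′? suc k) (≤′-step (ℕₚ.≤⇒≤′ i≤k)) x))) }

  include-value : ∀ i x → value (include i x) i ≡ x
  include-value i x = pushed≡push (i ≤′? i) (≤′-reflexive ≡.refl) x

  private
    module U = ExtensionProperties union

  inject : ∀ i → Embedding (E i) union
  inject i = mkEmbedding (E i) union (include i)
    (λ {x} {y} x≈y → agree-at (include-coherent x) (include-coherent y) (E.trans i (at x) (E.trans i x≈y (E.sym i (at y)))))
    (λ x y → agree-at (include-coherent (E._+_ i x y)) (coherent-+ (include-coherent x) (include-coherent y))
      (E.trans i (at _) (E.sym i (E.+-cong i (at x) (at y)))))
    (λ x y → agree-at (include-coherent (E._*_ i x y)) (coherent-* (include-coherent x) (include-coherent y))
      (E.trans i (at _) (E.sym i (E.*-cong i (at x) (at y)))))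
    (λ q → agree-at (include-coherent (E.ι i q)) (coherent-ι q) (at _))
    where
    at : ∀ x → E._≈_ i (value (include i x) i) x
    at x = E.reflexive i (include-value i x)
    include-coherent : ∀ x → CoherentFrom i (value (include i x))
    include-coherent x = coherent (include i x)
    agree-at : ∀ {x y} → CoherentFrom i (value x) → CoherentFrom i (value y) → E._≈_ i (value x i) (value y i) → x ≈ₜ y
    agree-at cx cy p = i , agree-forward cx cy p

  represented : ∀ x {i} → from x ≤ i → x U.≈ inject i · value x i
  represented x {i} from≤i = i , agree-forward (coherent-later from≤i (coherent x)) (coherent (include i (value x i)))
    (E.sym i (E.reflexive i (include-value i (value x i))))

  bound : ∀ {n} → (Fin n → ℕ) → ℕ
  bound {zero}  f = 0
  bound {suc n} f = f zero ℕ.+ bound (f ∘ suc)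

  ≤-bound : ∀ {n} (f : Fin n → ℕ) j → f j ≤ bound f
  ≤-bound f zero    = ℕₚ.m≤m+n (f zero) (bound (f ∘ suc))
  ≤-bound f (suc j) = ℕₚ.≤-trans (≤-bound (f ∘ suc) j) (ℕₚ.m≤n+m (bound (f ∘ suc)) (f zero))

  module Landing {L : Extension K} (spanning : Spanning L) (g : Embedding L union) where
    open Spanning spanning
    private
      module L = ExtensionProperties L
      module g = EmbeddingProperties g

    stage : ℕ
    stage = bound (λ j → from (g · vec j))

    -- The images of the finitely many spanning vectors are all coherent from `stage` on, so g is
    -- computed there from the coordinates of x.
    image : ∀ k → L.Carrier → E.Carrier k
    image k x = E.sum k (λ j → E._*_ k (E.ι k (coord x j)) (value (g · vec j) k))

    image-coherent : ∀ x → CoherentFrom stage (λ k → image k x)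
    image-coherent x k stage≤k = E.trans (suc k) (step.combination-hom k (coord x) (λ j → value (g · vec j) k))
      (E.sum-cong-≋ (suc k) (λ j → E.*-congˡ (suc k) {E.ι (suc k) (coord x j)}
        (coherent (g · vec j) k (ℕₚ.≤-trans (≤-bound (λ j → from (g · vec j)) j) stage≤k))))

    imageThread : L.Carrier → Thread
    imageThread x = record { value = λ k → image k x ; from = stage ; coherent = image-coherent x }

    value-sum : ∀ {n} (v : Fin n → Thread) k → value (U.sum v) k ≡ E.sum k (λ j → value (v j) k)
    value-sum {zero}  v k = ≡.refl
    value-sum {suc n} v k = ≡.cong (E._+_ k (value (v zero) k)) (value-sum (v ∘ suc) k)

    imageThread≈ : ∀ x → imageThread x U.≈ g · x
    imageThread≈ x = U.trans
      (always {imageThread x} {U.sum (λ j → U.ι (coord x j) U.* g · vec j)}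
        (λ k → E.sym k (E.reflexive k (value-sum (λ j → U.ι (coord x j) U.* g · vec j) k))))
      (U.sym (U.trans (g.cong (expand x)) (g.combination-hom (coord x) vec)))

    -- The coordinates carry no linearity law, so the homomorphism laws are read off from g in the
    -- union and pulled back to `stage` by injectivity of the steps.
    land : Embedding L (E stage)
    land = mkEmbedding L (E stage) (image stage)
      (λ {x} {y} x≈y → at-stage {imageThread x} {imageThread y} (image-coherent x) (image-coherent y)
        (U.trans (imageThread≈ x) (U.trans (g.cong x≈y) (U.sym (imageThread≈ y)))))
      (λ x y → at-stage {imageThread (x L.+ y)} {imageThread x U.+ imageThread y} (image-coherent (x L.+ y)) (coherent-+ (image-coherent x) (image-coherent y))
        (U.trans (imageThread≈ (x L.+ y)) (U.trans (g.+-hom x y) (U.sym (U.+-cong (imageThread≈ x) (imageThread≈ y))))))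
      (λ x y → at-stage {imageThread (x L.* y)} {imageThread x U.* imageThread y} (image-coherent (x L.* y)) (coherent-* (image-coherent x) (image-coherent y))
        (U.trans (imageThread≈ (x L.* y)) (U.trans (g.*-hom x y) (U.sym (U.*-cong (imageThread≈ x) (imageThread≈ y))))))
      (λ q → at-stage {imageThread (L.ι q)} {U.ι q} (image-coherent (L.ι q)) (coherent-ι q)
        (U.trans (imageThread≈ (L.ι q)) (g.fixes q)))
      where
      at-stage : ∀ {x y} → CoherentFrom stage (value x) → CoherentFrom stage (value y) → x U.≈ y → E._≈_ stage (value x stage) (value y stage)
      at-stage {x} {y} cx cy (n , p) = agree-backward {f = value x} {g = value y} cx cy p

-- Algebraic elements

module LinearSystem (F : Field) where
  open FieldProperties F
  open SetoidReasoning setoid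

  Nontrivial : ∀ {n} → (Fin n → Carrier) → Set
  Nontrivial c = ∃ λ i → ¬ c i ≈ 0#

  Solves : ∀ {m n} → (Fin m → Fin n → Carrier) → (Fin n → Carrier) → Set
  Solves A c = ∀ k → sum (λ i → c i * A k i) ≈ 0#

  -- Gaussian elimination: each round removes one equation and one unknown, keeping one unknown in
  -- excess.
  solution : ∀ m (A : Fin m → Fin (suc m) → Carrier) → ∃ λ c → Nontrivial c × Solves A c
  solution zero    A = (λ _ → 1#) , (zero , 1≉0) , λ ()
  solution (suc m) A with Finₚ.any? (λ i → ¬? (A zero i ≟ 0#))
  -- The first row is zero. Setting the first unknown to 0 keeps the count right for the remaining
  -- rows.
  ... | no none-nonzero = 0# ∷ c , (suc (proj₁ c≉0) , proj₂ c≉0) , λ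
        { zero    → sum-zero (λ i → (0# ∷ c) i * A zero i) (λ i → trans (*-congˡ (vanishes i)) (zeroʳ _))
        ; (suc k) → trans (+-cong (zeroˡ _) (solves k)) (+-identityˡ 0#) }
    where
    rest = solution m (λ k i → A (suc k) (suc i))
    c = proj₁ rest
    c≉0 = proj₁ (proj₂ rest)
    solves = proj₂ (proj₂ rest)
    vanishes : ∀ i → A zero i ≈ 0#
    vanishes i with A zero i ≟ 0#
    ... | yes p = p
    ... | no ¬p = contradiction (i , ¬p) none-nonzero
  ... | yes (p , pivot≉0) = c , (punchIn p (proj₁ c′≉0) , λ c≈0 → proj₂ c′≉0 (trans (sym (c-rest _)) c≈0)) , λ
        { zero → begin
            sum (λ i → c i * A zero i)                                        ≈⟨ split (A zero) ⟩
            c p * A zero p + sum (λ i → c′ i * A zero (punchIn p i))          ≈⟨ +-congʳ pivot-term ⟩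
            - s + s                                                           ≈⟨ -‿inverseˡ s ⟩
            0#                                                                ∎
        ; (suc k) → begin
            sum (λ i → c i * A (suc k) i)                                     ≈⟨ split (A (suc k)) ⟩
            c p * A (suc k) p + sum (λ i → c′ i * A (suc k) (punchIn p i))    ≈⟨ +-congʳ (trans (*-congʳ c-pivot) (solve 3 (λ s π a → (:- (s :* π)) :* a := s :* (:- (π :* a))) refl s π⁻¹ (A (suc k) p))) ⟩
            s * (- (π⁻¹ * A (suc k) p)) + sum (λ i → c′ i * A (suc k) (punchIn p i))
              ≈⟨ +-congʳ (*-distribʳ-sum (- (π⁻¹ * A (suc k) p)) (λ i → c′ i * A zero (punchIn p i))) ⟩
            sum (λ i → (c′ i * A zero (punchIn p i)) * (- (π⁻¹ * A (suc k) p))) + sum (λ i → c′ i * A (suc k) (punchIn p i))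
              ≈⟨ ∑-distrib-+ (λ i → (c′ i * A zero (punchIn p i)) * (- (π⁻¹ * A (suc k) p))) (λ i → c′ i * A (suc k) (punchIn p i)) ⟨
            sum (λ i → (c′ i * A zero (punchIn p i)) * (- (π⁻¹ * A (suc k) p)) + c′ i * A (suc k) (punchIn p i))
              ≈⟨ sum-cong-≋ (λ i → solve 5 (λ c a π b d → (c :* a) :* (:- (π :* b)) :+ c :* d := c :* (d :- b :* (a :* π))) refl
                   (c′ i) (A zero (punchIn p i)) π⁻¹ (A (suc k) p) (A (suc k) (punchIn p i))) ⟩
            sum (λ i → c′ i * A′ k i)                                         ≈⟨ solves k ⟩
            0#                                                                ∎ }
    where
    π⁻¹ = recip (A zero p) pivot≉0
    A′ : Fin m → Fin (suc m) → Carrier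
    A′ k i = A (suc k) (punchIn p i) - A (suc k) p * (A zero (punchIn p i) * π⁻¹)
    rest = solution m A′
    c′ = proj₁ rest
    c′≉0 = proj₁ (proj₂ rest)
    solves = proj₂ (proj₂ rest)
    s = sum (λ i → c′ i * A zero (punchIn p i))
    -- The value that the first equation forces on the pivot unknown.
    c = insertAt c′ p (- (s * π⁻¹))
    c-pivot : c p ≈ - (s * π⁻¹)
    c-pivot = reflexive (Vecₚ.insertAt-lookup c′ p _)
    c-rest : ∀ i → c (punchIn p i) ≈ c′ i
    c-rest i = reflexive (Vecₚ.insertAt-punchIn c′ p _ i)
    split : ∀ (B : Fin (suc (suc m)) → Carrier) → sum (λ i → c i * B i) ≈ c p * B p + sum (λ i → c′ i * B (punchIn p i))
    split B = trans (sum-remove {i = p} (λ i → c i * B i)) (+-congˡ (sum-cong-≋ (λ i → *-congʳ {x = B (punchIn p i)} (c-rest i))))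
    pivot-term : c p * A zero p ≈ - s
    pivot-term = trans (*-congʳ c-pivot) (trans (solve 3 (λ s π a → (:- (s :* π)) :* a := :- (s :* (a :* π))) refl s π⁻¹ (A zero p))
      (-‿cong (trans (*-congˡ (recipʳ (A zero p) pivot≉0)) (*-identityʳ s))))

module _ {K : Field} where
  private
    module K = FieldProperties K

  -- One more power of x than there are spanning vectors: the coordinates of the powers form a
  -- homogeneous system with a nontrivial solution, whose entries are the coefficients of the
  -- polynomial.
  finite⇒algebraic : {E : Extension K} → Spanning E → Algebraic E
  finite⇒algebraic {E} spanning x = suc size , c , c≉0 , (begin
      sum (λ i → ι (c i) * x ^ toℕ i)
        ≈⟨ sum-cong-≋ (λ i → trans (*-congˡ {x = ι (c i)} (expand (x ^ toℕ i))) (*-distribˡ-sum (ι (c i)) (λ k → ι (coord (x ^ toℕ i) k) * vec k))) ⟩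
      sum (λ i → sum (λ k → ι (c i) * (ι (coord (x ^ toℕ i) k) * vec k)))
        ≈⟨ ∑-comm (λ i k → ι (c i) * (ι (coord (x ^ toℕ i) k) * vec k)) ⟩
      sum (λ k → sum (λ i → ι (c i) * (ι (coord (x ^ toℕ i) k) * vec k)))
        ≈⟨ sum-cong-≋ (λ k → trans (sum-cong-≋ (λ i → trans (sym (*-assoc _ _ _)) (*-congʳ {x = vec k} (sym (ι-* (c i) (coord (x ^ toℕ i) k))))))
             (sym (*-distribʳ-sum (vec k) (λ i → ι (c i K.* coord (x ^ toℕ i) k))))) ⟩
      sum (λ k → sum (λ i → ι (c i K.* coord (x ^ toℕ i) k)) * vec k)
        ≈⟨ sum-zero _ (λ k → trans (*-congʳ {x = vec k} (trans (sym (ι-sum (λ i → c i K.* coord (x ^ toℕ i) k))) (trans (ι-cong (solves k)) ι-0))) (zeroˡ (vec k))) ⟩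
      0# ∎)
    where
    open ExtensionProperties E
    open Spanning spanning
    open Exp semiring using (_^_)
    open SetoidReasoning setoid
    relation = LinearSystem.solution K size (λ k i → coord (x ^ toℕ i) k)
    c = proj₁ relation
    c≉0 = proj₁ (proj₂ relation)
    solves = proj₂ (proj₂ relation)

  module _ {E F : Extension K} (f : Embedding E F) where
    private
      module E = ExtensionProperties E
      module F = ExtensionProperties F
      module f = EmbeddingProperties f
      module ^E = Exp E.semiring
      module ^F = Exp F.semiring

    ^-hom : ∀ x n → f · (x ^E.^ n) F.≈ (f · x) ^F.^ n
    ^-hom x zero    = f.1-hom
    ^-hom x (suc n) = F.trans (f.*-hom x (x ^E.^ n)) (F.*-congˡ (^-hom x n))

    eval-hom : ∀ {n} (c : Fin n → K.Carrier) x → f · eval E c x F.≈ eval F c (f · x)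
    eval-hom c x = F.trans (f.combination-hom c (λ i → x ^E.^ toℕ i)) (F.sum-cong-≋ (λ i → F.*-congˡ {F.ι (c i)} (^-hom x (toℕ i))))

  eval-cong : (E : Extension K) → ∀ {n} (c : Fin n → K.Carrier) {x y} → Extension._≈_ E x y → Extension._≈_ E (eval E c x) (eval E c y)
  eval-cong E c x≈y = sum-cong-≋ (λ i → *-congˡ {x = ι (c i)} (^-congˡ (toℕ i) x≈y))
    where
    open ExtensionProperties E
    open Exp semiring using (^-congˡ)

-- The form ⟨1,1⟩

module SumOfTwoSquares (K : Field)
  (2≉0 : ¬ Field._≈_ K (Field._+_ K (Field.1# K) (Field.1# K)) (Field.0# K)) where
  private
    module K = FieldProperties K

  half : K.Carrier
  half = K.recip (K.1# K.+ K.1#) 2≉0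

  half+half : half K.+ half K.≈ K.1#
  half+half = K.trans (K.sym (K.+-cong (K.*-identityˡ half) (K.*-identityˡ half)))
    (K.trans (K.sym (K.distribʳ half K.1# K.1#)) (K.recipʳ (K.1# K.+ K.1#) 2≉0))

  double-zero : ∀ {x} → x K.+ x K.≈ K.0# → x K.≈ K.0#
  double-zero {x} p = K.cancel 2≉0 (K.trans (K.distribʳ x K.1# K.1#) (K.trans (K.+-cong (K.*-identityˡ x) (K.*-identityˡ x)) p))

  nonDegenerate : NonDegenerate K (⟨1,1⟩ K)
  nonDegenerate (x , y) orthogonal =
      -- Pairing (x , y) with the two unit vectors gives 2x and 2y, since the polar form is twice
      -- the bilinear form.
      double-zero (K.trans (K.sym (K.trans
        (K.solve 3 (λ x y o → ((((x K.:+ o) K.:* (x K.:+ o) K.:+ (y K.:+ K.con (+ 0)) K.:* (y K.:+ K.con (+ 0))) K.:- (x K.:* x K.:+ y K.:* y)) K.:- (o K.:* o K.:+ K.con (+ 0) K.:* K.con (+ 0)))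
          K.:= x K.:* o K.:+ x K.:* o) K.refl x y K.1#)
        (K.+-cong (K.*-identityʳ x) (K.*-identityʳ x)))) (orthogonal (K.1# , K.0#)))
    , double-zero (K.trans (K.sym (K.trans
        (K.solve 3 (λ x y o → ((((x K.:+ K.con (+ 0)) K.:* (x K.:+ K.con (+ 0)) K.:+ (y K.:+ o) K.:* (y K.:+ o)) K.:- (x K.:* x K.:+ y K.:* y)) K.:- (K.con (+ 0) K.:* K.con (+ 0) K.:+ o K.:* o))
          K.:= y K.:* o K.:+ y K.:* o) K.refl x y K.1#)
        (K.+-cong (K.*-identityʳ y) (K.*-identityʳ y)))) (orthogonal (K.0# , K.1#)))

  module _ (pythagorean : ∀ x → Square K (K.1# K.+ x K.* x)) where

    no-scaledTraceForm : ¬ IsScaledTraceForm K (⟨1,1⟩ K)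
    no-scaledTraceForm (F , fin , _ , α , _ , f , iso , isometry) = K.1≉0 1≈0
      where
      open ExtensionProperties F
      open SetoidReasoning setoid
      open ModuleMorphism.LeftModuleMorphisms (LeftModule.rawLeftModule (plane K)) (LeftModule.rawLeftModule (vectorSpace F))
        using (module IsLeftModuleIsomorphism)
      open IsLeftModuleIsomorphism iso using (+ᴹ-homo; *ₗ-homo; injective; surjective; ⟦⟧-cong)

      -- The scaled trace form is z ↦ ℓ(z²). For its bilinear form ℓ(yz) every multiplication is
      -- self-adjoint.
      ℓ : Carrier → K.Carrier
      ℓ z = Tr F fin (α * z)

      ℓ-cong : ∀ {y z} → y ≈ z → ℓ y K.≈ ℓ z
      ℓ-cong y≈z = Tr-cong F fin (*-congˡ y≈z)

      ℓ-+ : ∀ y z → ℓ (y + z) K.≈ ℓ y K.+ ℓ z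
      ℓ-+ y z = K.trans (Tr-cong F fin (distribˡ α y z)) (Tr-+ F fin (α * y) (α * z))

      ℓ-* : ∀ k z → ℓ (ι k * z) K.≈ k K.* ℓ z
      ℓ-* k z = K.trans (Tr-cong F fin (solve 3 (λ a k z → a :* (k :* z) := k :* (a :* z)) refl α (ι k) z)) (Tr-* F fin k (α * z))

      e₁ e₂ : Carrier
      e₁ = f (K.1# , K.0#)
      e₂ = f (K.0# , K.1#)

      f≈ : ∀ x y → f (x , y) ≈ ι x * e₁ + ι y * e₂
      f≈ x y = begin
        f (x , y)
          ≈⟨ ⟦⟧-cong ( K.sym (K.trans (K.+-cong (K.*-identityʳ x) (K.zeroʳ y)) (K.+-identityʳ x))
                     , K.sym (K.trans (K.+-cong (K.zeroʳ x) (K.*-identityʳ y)) (K.+-identityˡ y))) ⟩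
        f (x K.* K.1# K.+ y K.* K.0# , x K.* K.0# K.+ y K.* K.1#)
          ≈⟨ +ᴹ-homo (x K.* K.1# , x K.* K.0#) (y K.* K.0# , y K.* K.1#) ⟩
        f (x K.* K.1# , x K.* K.0#) + f (y K.* K.0# , y K.* K.1#)
          ≈⟨ +-cong (*ₗ-homo x (K.1# , K.0#)) (*ₗ-homo y (K.0# , K.1#)) ⟩
        ι x * e₁ + ι y * e₂ ∎

      ℓe₁e₁ : ℓ (e₁ * e₁) K.≈ K.1#
      ℓe₁e₁ = K.trans (isometry (K.1# , K.0#)) (K.trans (K.+-cong (K.*-identityˡ K.1#) (K.zeroˡ K.0#)) (K.+-identityʳ K.1#))

      ℓe₂e₂ : ℓ (e₂ * e₂) K.≈ K.1#
      ℓe₂e₂ = K.trans (isometry (K.0# , K.1#)) (K.trans (K.+-cong (K.zeroˡ K.0#) (K.*-identityˡ K.1#)) (K.+-identityˡ K.1#))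

      -- The isometry speaks of the quadratic forms, so orthogonality is obtained by polarising at
      -- (1 , 1) and dividing by 2.
      ℓe₁e₂ : ℓ (e₁ * e₂) K.≈ K.0#
      ℓe₁e₂ = double-zero (K.trans (K.solve 3 (λ a b c → c K.:+ c K.:= ((a K.:+ (c K.:+ c)) K.:+ b) K.:- (a K.:+ b)) K.refl (ℓ (e₁ * e₁)) (ℓ (e₂ * e₂)) (ℓ (e₁ * e₂)))
        (K.x≈y⇒x-y≈0 (K.trans (K.sym expanded) (K.trans (isometry (K.1# , K.1#))
          (K.+-cong (K.trans (K.*-identityˡ K.1#) (K.sym ℓe₁e₁)) (K.trans (K.*-identityˡ K.1#) (K.sym ℓe₂e₂)))))))
        where
        f11≈ : f (K.1# , K.1#) ≈ e₁ + e₂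
        f11≈ = trans (f≈ K.1# K.1#) (+-cong (trans (*-congʳ ι-1) (*-identityˡ e₁)) (trans (*-congʳ ι-1) (*-identityˡ e₂)))
        expanded : ℓ (f (K.1# , K.1#) * f (K.1# , K.1#)) K.≈ (ℓ (e₁ * e₁) K.+ (ℓ (e₁ * e₂) K.+ ℓ (e₁ * e₂))) K.+ ℓ (e₂ * e₂)
        expanded = K.trans (ℓ-cong (trans (*-cong f11≈ f11≈)
            (solve 2 (λ a b → (a :+ b) :* (a :+ b) := (a :* a :+ (a :* b :+ a :* b)) :+ b :* b) refl e₁ e₂)))
          (K.trans (ℓ-+ _ _) (K.+-congʳ (K.trans (ℓ-+ _ _) (K.+-congˡ (ℓ-+ _ _)))))

      e₁≉0 : ¬ e₁ ≈ 0#
      e₁≉0 e₁≈0 = K.1≉0 (proj₁ (injective (trans e₁≈0 (sym (trans (f≈ K.0# K.0#)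
        (trans (+-cong (trans (*-congʳ ι-0) (zeroˡ e₁)) (trans (*-congʳ ι-0) (zeroˡ e₂))) (+-identityˡ 0#)))))))

      x : Carrier
      x = e₂ * recip e₁ e₁≉0

      xe₁ : x * e₁ ≈ e₂
      xe₁ = trans (solve 3 (λ a b r → (b :* r) :* a := b :* (a :* r)) refl e₁ e₂ (recip e₁ e₁≉0))
        (trans (*-congˡ (recipʳ e₁ e₁≉0)) (*-identityʳ e₂))

      b c : K.Carrier
      b = proj₁ (proj₁ (surjective (x * e₂)))
      c = proj₂ (proj₁ (surjective (x * e₂)))

      xe₂ : x * e₂ ≈ ι b * e₁ + ι c * e₂
      xe₂ = trans (sym (proj₂ (surjective (x * e₂)) (K.refl , K.refl))) (f≈ b c)

      -- By orthonormality b is the product of x e₂ with e₁, and this equals ℓ((x e₁) e₂) = ℓ(e₂²) =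
      -- 1.
      b≈1 : b K.≈ K.1#
      b≈1 = K.sym (K.trans (K.sym ℓe₂e₂) (K.trans (ℓ-cong (begin
          e₂ * e₂                                       ≈⟨ *-congʳ xe₁ ⟨
          (x * e₁) * e₂                                 ≈⟨ solve 3 (λ x a b → (x :* a) :* b := (x :* b) :* a) refl x e₁ e₂ ⟩
          (x * e₂) * e₁                                 ≈⟨ *-congʳ xe₂ ⟩
          (ι b * e₁ + ι c * e₂) * e₁                    ≈⟨ solve 4 (λ b c e d → (b :* e :+ c :* d) :* e := b :* (e :* e) :+ c :* (e :* d)) refl (ι b) (ι c) e₁ e₂ ⟩
          ι b * (e₁ * e₁) + ι c * (e₁ * e₂)             ∎))
        (K.trans (ℓ-+ _ _) (K.trans (K.+-cong (K.trans (ℓ-* b _) (K.trans (K.*-congˡ ℓe₁e₁) (K.*-identityʳ b)))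
          (K.trans (ℓ-* c _) (K.trans (K.*-congˡ ℓe₁e₂) (K.zeroʳ c)))) (K.+-identityʳ b)))))

      -- Completing the square in x² = 1 + c x: with h = c/2 it becomes (x - h)² = 1 + h² = s².
      h s : K.Carrier
      h = half K.* c
      s = proj₁ (pythagorean h)

      xx : x * x ≈ 1# + (ι h + ι h) * x
      xx = *-cancelˡ e₁≉0 (begin
        e₁ * (x * x)                          ≈⟨ solve 2 (λ e x → e :* (x :* x) := x :* (x :* e)) refl e₁ x ⟩
        x * (x * e₁)                          ≈⟨ *-congˡ xe₁ ⟩
        x * e₂                                ≈⟨ xe₂ ⟩
        ι b * e₁ + ι c * e₂                   ≈⟨ +-cong (*-congʳ (trans (ι-cong b≈1) ι-1)) (*-cong ιc≈ (sym xe₁)) ⟩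
        1# * e₁ + (ι h + ι h) * (x * e₁)      ≈⟨ solve 4 (λ o e h x → o :* e :+ (h :+ h) :* (x :* e) := e :* (o :+ (h :+ h) :* x)) refl 1# e₁ (ι h) x ⟩
        e₁ * (1# + (ι h + ι h) * x)           ∎)
        where
        ιc≈ : ι c ≈ ι h + ι h
        ιc≈ = trans (ι-cong (K.sym (K.trans (K.sym (K.distribʳ c half half)) (K.trans (K.*-congʳ half+half) (K.*-identityˡ c))))) (ι-+ h h)

      factored : ((x - ι h) - ι s) * ((x - ι h) + ι s) ≈ 0#
      factored = begin
        ((x - ι h) - ι s) * ((x - ι h) + ι s)
          ≈⟨ solve 3 (λ x h s → ((x :- h) :- s) :* ((x :- h) :+ s) := (x :* x :- (h :+ h) :* x) :+ (h :* h :- s :* s)) refl x (ι h) (ι s) ⟩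
        (x * x - (ι h + ι h) * x) + (ι h * ι h - ι s * ι s)
          ≈⟨ +-cong (+-congʳ xx) (+-congˡ (-‿cong (trans (sym (ι-* s s)) (trans (ι-cong (proj₂ (pythagorean h)))
               (trans (ι-+ _ _) (+-cong ι-1 (ι-* h h))))))) ⟩
        ((1# + (ι h + ι h) * x) - (ι h + ι h) * x) + (ι h * ι h - (1# + ι h * ι h))
          ≈⟨ solve 3 (λ o p q → ((o :+ p) :- p) :+ (q :- (o :+ q)) := con (+ 0)) refl 1# ((ι h + ι h) * x) (ι h * ι h) ⟩
        0# ∎

      x-rational : ∃ λ k → x ≈ ι k
      x-rational = [ (λ p → h K.+ s , (begin
          x                                ≈⟨ solve 3 (λ x h s → x := ((x :- h) :- s) :+ (h :+ s)) refl x (ι h) (ι s) ⟩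
          ((x - ι h) - ι s) + (ι h + ι s)  ≈⟨ trans (+-congʳ p) (+-identityˡ _) ⟩
          ι h + ι s                        ≈⟨ ι-+ h s ⟨
          ι (h K.+ s)                      ∎))
        , (λ p → h K.- s , (begin
          x                                ≈⟨ solve 3 (λ x h s → x := ((x :- h) :+ s) :+ (h :- s)) refl x (ι h) (ι s) ⟩
          ((x - ι h) + ι s) + (ι h - ι s)  ≈⟨ trans (+-congʳ p) (+-identityˡ _) ⟩
          ι h - ι s                        ≈⟨ trans (ι-+ h (K.- s)) (+-congˡ (ι-neg s)) ⟨
          ι (h K.- s)                      ∎)) ]′ (zero-product factored)

      -- If x lies in K, then e₂ = x e₁ is a multiple of e₁ over K, against the injectivity of f.
      1≈0 : K.1# K.≈ K.0#
      1≈0 = proj₂ (injective {K.0# , K.1#} {proj₁ x-rational , K.0#} (begin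
        e₂                                          ≈⟨ xe₁ ⟨
        x * e₁                                      ≈⟨ *-congʳ (proj₂ x-rational) ⟩
        ι (proj₁ x-rational) * e₁                   ≈⟨ +-identityʳ _ ⟨
        ι (proj₁ x-rational) * e₁ + 0#              ≈⟨ +-congˡ (trans (*-congʳ ι-0) (zeroˡ e₂)) ⟨
        ι (proj₁ x-rational) * e₁ + ι K.0# * e₂     ≈⟨ f≈ (proj₁ x-rational) K.0# ⟨
        f (proj₁ x-rational , K.0#)                 ∎))

-- The Pythagorean closure

module PythagoreanClosure {K : Field} (square? : ∀ x → Dec (Square K x)) (real : FormallyReal K) (exhaustion : Exhaustion K) where
  open Sequence square? real exhaustion

  module S k = Stage (stage k)
  open Union S.extension (λ k → Enlargement.embed (next k)) public
  open Thread
  private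
    module E k = ExtensionProperties (S.extension k)
    module U = ExtensionProperties union
    module Real k = FormallyRealProperties (Extension.top (S.extension k)) (S.formallyReal k)

  2≉0 : ¬ U.1# U.+ U.1# U.≈ U.0#
  2≉0 (n , p) = Real.2≉0 n (p n ℕₚ.≤-refl)

  -1-nonsquare : ¬ IsSquare union (U.- U.1#)
  -1-nonsquare (y , (n , p)) = Real.-1-nonsquare n (value y n , p n ℕₚ.≤-refl)

  -- The bound m found at the stage where x becomes coherent serves all later stages, because each
  -- step maps the n-th list into the n-th list.
  value-∈ₙ : ∀ x → ∃ λ m → ∀ k n → from x ≤ k → m ≤ n → S._∈ₙ_ k (value x k) n
  value-∈ₙ x = m , λ k n i≤k m≤n → go (ℕₚ.≤⇒≤′ i≤k) n m≤n
    where
    i = from x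
    exhausted = Exhaustion.exhausts (S.exhaustion i) (value x i)
    m = proj₁ exhausted
    go : ∀ {k} → i ≤′ k → ∀ n → m ≤ n → S._∈ₙ_ k (value x k) n
    go (≤′-reflexive ≡.refl) n m≤n = proj₂ exhausted n m≤n
    go (≤′-step {k} i≤′k) n m≤n =
      let (j , p) = Enlargement.embed-∈ₙ (next k) n (go i≤′k n m≤n) in
      j , E.trans (suc k) p (coherent x k (ℕₚ.≤′⇒≤ i≤′k))

  pythagorean : ∀ x → IsSquare union (1+_² {E = union} x)
  pythagorean x = Square-cong (Extension.top union)
      (U.trans (1+²-hom (inject (suc k)) (value x (suc k))) (1+²-cong union (U.sym (represented x i≤1+k))))
      (isSquare-hom (inject (suc k)) at-stage)
    where
    i = from x
    m = proj₁ (value-∈ₙ x)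
    -- At this index x is coherent and its value is in the k-th list of stage k, so stage k + 1
    -- contains a root of 1 + x².
    k = i ℕ.+ m
    i≤k : i ≤ k
    i≤k = ℕₚ.m≤m+n i m
    i≤1+k : i ≤ suc k
    i≤1+k = ℕₚ.m≤n⇒m≤1+n i≤k
    at-stage : IsSquare (S.extension (suc k)) (1+_² {E = S.extension (suc k)} (value x (suc k)))
    at-stage = let (j , p) = proj₂ (value-∈ₙ x) k k i≤k (ℕₚ.m≤n+m m i) in
      Square-cong (Extension.top (S.extension (suc k)))
        (E.trans (suc k) (1+²-hom (Enlargement.embed (next k)) _) (1+²-cong (S.extension (suc k))
          (E.trans (suc k) (Embedding.⟦⟧-cong (Enlargement.embed (next k)) p) (coherent x k i≤k))))
        (Enlargement.squares (next k) j)

  algebraic : Algebraic union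
  algebraic x = let i = from x ; (n , c , c≉0 , root) = finite⇒algebraic (S.spanning i) (value x i) in
    n , c , c≉0 , U.trans (eval-cong union c (represented x ℕₚ.≤-refl))
      (U.trans (U.sym (eval-hom (inject i) c (value x i)))
        (U.trans (Embedding.⟦⟧-cong (inject i) root) (Embedding.0#-homo (inject i))))

  module _ (L : Extension K) (finite : Finite L) (g : Embedding L union) where
    private
      L-spanning : Spanning L
      L-spanning = basis⇒spanning finite
      module Land = Landing L-spanning g
      module C = Closure (S.extension Land.stage) (S.formallyReal Land.stage) (S.spanning Land.stage) (S.family Land.stage)

    solvableClosure : Σ (GaloisClosure L) λ N → Solvable (Gal (GaloisClosure.closure N))
    solvableClosure = C.galoisClosure L L-spanning Land.land , C.solvable L L-spanning Land.land (S.fixedByDerived Land.stage)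

  quadraticExtension : Σ (Extension (Extension.top union)) λ F → HasDegree F 2
  quadraticExtension = nonsquare⇒quadraticExtension (Extension.top union) (U.- U.1#) -1-nonsquare

proposition3p5 : Σ (Extension ℚ-field) λ K →
    Prosolvable K ×
    (Σ (Extension (Extension.top K)) λ F → HasDegree F 2) ×
    NonDegenerate (Extension.top K) (⟨1,1⟩ (Extension.top K)) ×
    ¬ IsScaledTraceForm (Extension.top K) (⟨1,1⟩ (Extension.top K))
proposition3p5 = union , (algebraic , solvableClosure) , quadraticExtension , nonDegenerate , no-scaledTraceForm pythagorean
  where
  open PythagoreanClosure ℚ-square? ℚ-formallyReal ℚ-exhaustion
  open SumOfTwoSquares (Extension.top union) 2≉0
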